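{- Let $G$ be a finite simple graph with at least three vertices that is isomorphic to $P_3(T)$ for some finite tree $T$. Then every finite simple graph $H$ having the same deck as $G$ is isomorphic to $G$; that is, the Reconstruction Conjecture holds for the class of graphs isomorphic to the cube of a tree.
   Context: For a graph $G$, its third power (cube) $P_3(G)$ is the graph on the same vertex set in which two distinct vertices are adjacent if and only if their distance in $G$ is at most $3$. A card of a finite graph $G$ is an unlabelled vertex-deleted subgraph $G-v$; the deck of $G$ is the multiset of (isomorphism classes of) all its cards, one for each vertex. The Reconstruction Conjecture asserts that every finite simple graph with at least three vertices is determined up to isomorphism by its deck. -}

module Defs where

open import Level using (0ℓ)
open import Data.Nat using (ℕ; zero; suc; _≤_)
open import Data.Fin using (Fin; zero; suc; punchIn; inject₁; fromℕ)
open import Data.Product using (Σ; _×_; ∃; _,_)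
open import Relation.Nullary using (¬_)
open import Relation.Binary.PropositionalEquality using (_≡_; _≢_)
open import Function.Bundles using (_⤖_; Bijection; _⇔_)
open import Function.Definitions using (Injective)

record Graph (n : ℕ) : Set₁ where
  field
    Adj    : Fin n → Fin n → Set
    sym    : ∀ {u v} → Adj u v → Adj v u
    irrefl : ∀ {u} → ¬ Adj u u
open Graph public

data Walk {n : ℕ} (G : Graph n) : Fin n → Fin n → ℕ → Set where
  nil  : ∀ {u} → Walk G u u zero
  cons : ∀ {u w v ℓ} → Adj G u w → Walk G w v ℓ → Walk G u v (suc ℓ)

DistLE : ∀ {n} → Graph n → ℕ → Fin n → Fin n → Set
DistLE G d u v = Σ ℕ (λ ℓ → ℓ ≤ d × Walk G u v ℓ)

Connected : ∀ {n} → Graph n → Set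
Connected G = ∀ u v → Σ ℕ (λ ℓ → Walk G u v ℓ)

record Cycle {n : ℕ} (G : Graph n) : Set where
  field
    k    : ℕ
    c    : Fin (suc (suc (suc k))) → Fin n
    inj  : Injective _≡_ _≡_ c
    step : ∀ (i : Fin (suc (suc k))) → Adj G (c (inject₁ i)) (c (suc i))
    close : Adj G (c (fromℕ (suc (suc k)))) (c zero)

Acyclic : ∀ {n} → Graph n → Set
Acyclic G = ¬ Cycle G

IsTree : ∀ {n} → Graph n → Set
IsTree G = Connected G × Acyclic G

cube : ∀ {n} → Graph n → Graph n
cube G = record
  { Adj    = λ u v → u ≢ v × DistLE G 3 u v
  ; sym    = λ { (u≢v , ℓ , ℓ≤3 , w) → (λ e → u≢v (Relation.Binary.PropositionalEquality.sym e)) , ℓ , ℓ≤3 , rev w }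
  ; irrefl = λ { (u≢u , _) → u≢u Relation.Binary.PropositionalEquality.refl }
  }
  where
  snoc : ∀ {u w v ℓ} → Walk G u w ℓ → Adj G w v → Walk G u v (suc ℓ)
  snoc nil a = cons a nil
  snoc (cons a w) b = cons a (snoc w b)
  rev : ∀ {u v ℓ} → Walk G u v ℓ → Walk G v u ℓ
  rev nil = nil
  rev (cons a w) = snoc (rev w) (Graph.sym G a)

_≅_ : ∀ {n m} → Graph n → Graph m → Set
_≅_ {n} {m} G H =
  Σ (Fin n ⤖ Fin m) λ f →
    ∀ u v → Adj G u v ⇔ Adj H (Bijection.to f u) (Bijection.to f v)

card : ∀ {n} → Graph (suc n) → Fin (suc n) → Graph n
card G v = record
  { Adj    = λ a b → Adj G (punchIn v a) (punchIn v b)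
  ; sym    = Graph.sym G
  ; irrefl = Graph.irrefl G
  }

-- Same deck: a bijection between vertex sets matching each card with an
-- isomorphic card (equality of multisets of isomorphism classes of cards).
SameDeck : ∀ {n m} → Graph (suc n) → Graph (suc m) → Set
SameDeck {n} {m} G H =
  Σ (Fin (suc n) ⤖ Fin (suc m)) λ σ →
    ∀ v → card G v ≅ card H (Bijection.to σ v)

{-# OPTIONS --safe #-}
module Submission where

-- Let G = T³ and let H have the same deck. By Kelly's lemma corresponding vertices have equal
-- degrees and are simplicial (have a complete neighbourhood) simultaneously. A dominating vertex
-- of G settles the matter, so suppose there is none. Let ℓ be a simplicial vertex of minimal
-- degree; it is a leaf of T, say with neighbour p, and q is the next vertex. Delete p, or a
-- twin of ℓ if there is one, and identify H − p with G − p. There ℓ has too small a degree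
-- for a simplicial vertex, so p is adjacent to ℓ in H, and counting simplicial vertices shows
-- that ℓ is simplicial in H. Let e be farthest from ℓ. The card H − e is again the cube of a tree,
-- and in such a cube the tree neighbour of a simplicial vertex is dominated by all its neighbours
-- other than its twins. For ℓ this confines the neighbourhood of p in H to the ball of radius 2
-- about q, which is N(p) in G, and equality follows since the degrees agree. This breaks down only
-- if q has degree 2 in T. In that case T is compared with the tree behind H − e, and the two
-- neighbourhoods of p are found to differ at most by an exchange of two twins of G − p.

open import Defs
open import Data.Empty using (⊥; ⊥-elim)
open import Data.Fin using (Fin; zero; suc; toℕ; inject₁; fromℕ; punchIn; punchOut)
open import Data.Fin.Permutation using (Permutation; permutation; _⟨$⟩ʳ_; _⟨$⟩ˡ_; inverseˡ; inverseʳ;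
  id; flip; _∘ₚ_; insert; insert-punchIn; ↔⇒≡)
open import Data.Fin.Properties using (any?; all?; punchIn-punchOut; toℕ-injective; injective⇒≤)
  renaming (_≟_ to _≟F_)
open import Data.Nat using (ℕ; zero; suc; _+_; _*_; _∸_; _≤_; _<_; z≤n; s≤s; s≤s⁻¹; _≤?_; _<?_; _≟_)
open import Data.Nat.Properties hiding (_≟_; _≤?_; _<?_)
open import Data.Nat.Tactic.RingSolver using (solve-∀)
open import Data.Product using (Σ; _×_; _,_; proj₁; proj₂)
open import Data.Sum using (_⊎_; inj₁; inj₂; map₂)
open import Data.Unit using (⊤; tt)
open import Function using (_∘_)
open import Function.Bundles using (Equivalence; mk⇔)
open import Function.Properties.Bijection using (⤖⇒↔)
open import Function.Properties.Inverse using (↔⇒⤖)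
open import Relation.Binary using (tri<; tri≈; tri>)
open import Relation.Binary.PropositionalEquality using (_≡_; _≢_; refl; trans; cong; cong₂; subst; subst₂)
  renaming (sym to ≡-sym)
open import Relation.Nullary using (¬_; Dec; yes; no)
open import Relation.Nullary.Decidable using (¬?; _×-dec_; _→-dec_; decidable-stable; map′)
open import Algebra.Properties.CommutativeMonoid.Sum +-0-commutativeMonoid
  using (sum; sum-cong-≗; ∑-distrib-+; sum-permute)
open import Algebra.Properties.Semiring.Sum +-*-semiring using (*-distribˡ-sum)

-- Trees as metric spaces

-- The tree behind the card of `e` in `H` is only some tree with the right cube; nothing identifies
-- it with `T` without `e`. What passes between the two trees is the relation "distance at most 3",
-- so domination is phrased by inclusion of balls of radius 3. It yields that the neighbours of `p`
-- in `H`, apart from the deleted vertex, lie within 3 of every vertex other than `p` in the closed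
-- unit ball about `q`. If `q` has two neighbours besides `p`, a vertex at distance 3 from `q` is at
-- distance 4 from one of them, which leaves the ball of radius 2. If `q` has degree 2, such a
-- vertex is within 3 of both `q` and `s` and is not excluded; depths below `s` in the two trees are
-- then compared. Equality of the degree sequences, through sums of squares, finally gives the
-- relation of degrees that makes the exchanged vertices twins off `p`.

record TreeMetric (n : ℕ) : Set where
  field
    d       : Fin n → Fin n → ℕ
    d-refl  : ∀ x → d x x ≡ 0
    d-zero  : ∀ {x y} → d x y ≡ 0 → x ≡ y
    d-sym   : ∀ x y → d x y ≡ d y x
    d-tri   : ∀ x y z → d x z ≤ d x y + d y z
    hop     : ∀ {k} x y → d x y ≡ suc k → Σ (Fin n) λ z → d x z ≡ 1 × d z y ≡ k
    -- No cycles: at most one neighbour of z fails to be farther from v than z is.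
    closer! : ∀ {v z a b} → d z a ≡ 1 → d z b ≡ 1 → d v a ≤ d v z → d v b ≤ d v z → a ≡ b

module _ {n : ℕ} {G : Graph n} where

  _∈ʷ_ : ∀ {u v ℓ} → Fin n → Walk G u v ℓ → Set
  x ∈ʷ nil {u}          = x ≡ u
  x ∈ʷ cons {u} _ w     = x ≡ u ⊎ x ∈ʷ w

  Simple : ∀ {u v ℓ} → Walk G u v ℓ → Set
  Simple nil            = ⊤
  Simple (cons {u} _ w) = ¬ (u ∈ʷ w) × Simple w

  _∈ʷ?_ : ∀ {u v ℓ} x (w : Walk G u v ℓ) → Dec (x ∈ʷ w)
  x ∈ʷ? nil {u} = x ≟F u
  x ∈ʷ? cons {u} _ w with x ≟F u | x ∈ʷ? w
  ... | yes e | _     = yes (inj₁ e)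
  ... | no _  | yes m = yes (inj₂ m)
  ... | no ne | no nm = no λ { (inj₁ e) → ne e ; (inj₂ m) → nm m }

  _++ʷ_ : ∀ {u v w k ℓ} → Walk G u v k → Walk G v w ℓ → Walk G u w (k + ℓ)
  nil      ++ʷ q = q
  cons a p ++ʷ q = cons a (p ++ʷ q)

  ∈-++ : ∀ {u v w k ℓ x} (p : Walk G u v k) (q : Walk G v w ℓ) → x ∈ʷ (p ++ʷ q) → x ∈ʷ p ⊎ x ∈ʷ q
  ∈-++ nil        q m        = inj₂ m
  ∈-++ (cons a p) q (inj₁ e) = inj₁ (inj₁ e)
  ∈-++ (cons a p) q (inj₂ m) with ∈-++ p q m
  ... | inj₁ l = inj₁ (inj₂ l)
  ... | inj₂ r = inj₂ r

  snocʷ : ∀ {u v w ℓ} → Walk G u v ℓ → Adj G v w → Walk G u w (suc ℓ)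
  snocʷ nil        e = cons e nil
  snocʷ (cons a p) e = cons a (snocʷ p e)

  revʷ : ∀ {u v ℓ} → Walk G u v ℓ → Walk G v u ℓ
  revʷ nil        = nil
  revʷ (cons a p) = snocʷ (revʷ p) (Graph.sym G a)

  ∈-snoc : ∀ {u v w ℓ x} (p : Walk G u v ℓ) (e : Adj G v w) → x ∈ʷ snocʷ p e → x ∈ʷ p ⊎ x ≡ w
  ∈-snoc nil        e (inj₁ m) = inj₁ m
  ∈-snoc nil        e (inj₂ m) = inj₂ m
  ∈-snoc (cons a p) e (inj₁ m) = inj₁ (inj₁ m)
  ∈-snoc (cons a p) e (inj₂ m) with ∈-snoc p e m
  ... | inj₁ l = inj₁ (inj₂ l)
  ... | inj₂ r = inj₂ r

  ∈-rev : ∀ {u v ℓ x} (p : Walk G u v ℓ) → x ∈ʷ revʷ p → x ∈ʷ p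
  ∈-rev nil        m = m
  ∈-rev (cons a p) m with ∈-snoc (revʷ p) (Graph.sym G a) m
  ... | inj₁ l    = inj₂ (∈-rev p l)
  ... | inj₂ refl = inj₁ refl

  suffix : ∀ {u v ℓ x} (p : Walk G u v ℓ) → x ∈ʷ p → Σ ℕ λ k → k ≤ ℓ × Walk G x v k
  suffix nil        refl        = 0 , z≤n , nil
  suffix (cons a p) (inj₁ refl) = _ , ≤-refl , cons a p
  suffix (cons a p) (inj₂ m) with suffix p m
  ... | k , k≤ , q = k , m≤n⇒m≤1+n k≤ , q

  suffix-simple : ∀ {u v ℓ x} (p : Walk G u v ℓ) → Simple p → x ∈ʷ p →
    Σ ℕ λ k → Σ (Walk G x v k) λ q → Simple q × (∀ {y} → y ∈ʷ q → y ∈ʷ p)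
  suffix-simple nil        s       refl        = 0 , nil , s , λ m → m
  suffix-simple (cons a p) s       (inj₁ refl) = _ , cons a p , s , λ m → m
  suffix-simple (cons a p) (_ , s) (inj₂ m) with suffix-simple p s m
  ... | k , q , t , sub = k , q , t , λ y → inj₂ (sub y)

  shorten : ∀ {u v ℓ} (p : Walk G u v ℓ) →
    Σ ℕ λ k → Σ (Walk G u v k) λ q → Simple q × (∀ {y} → y ∈ʷ q → y ∈ʷ p)
  shorten nil = 0 , nil , _ , λ m → m
  shorten (cons {u} a p) with shorten p
  ... | k , q , s , sub with u ∈ʷ? q
  ... | no u∉ = suc k , cons a q , (u∉ , s) , λ { (inj₁ e) → inj₁ e ; (inj₂ m) → inj₂ (sub m) }
  ... | yes m with suffix-simple q s m
  ... | k′ , q′ , s′ , sub′ = k′ , q′ , s′ , λ y → inj₂ (sub (sub′ y))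

  at : ∀ {u v ℓ} → Walk G u v ℓ → Fin (suc ℓ) → Fin n
  at {u} nil        zero    = u
  at {u} (cons a p) zero    = u
  at     (cons a p) (suc i) = at p i

  at-start : ∀ {u v ℓ} (p : Walk G u v ℓ) → at p zero ≡ u
  at-start nil        = refl
  at-start (cons _ _) = refl

  at-end : ∀ {u v ℓ} (p : Walk G u v ℓ) → at p (fromℕ ℓ) ≡ v
  at-end nil        = refl
  at-end (cons _ p) = at-end p

  at∈ : ∀ {u v ℓ} (p : Walk G u v ℓ) i → at p i ∈ʷ p
  at∈ nil        zero    = refl
  at∈ (cons a p) zero    = inj₁ refl
  at∈ (cons a p) (suc i) = inj₂ (at∈ p i)

  at-inj : ∀ {u v ℓ} (p : Walk G u v ℓ) → Simple p → ∀ {i j} → at p i ≡ at p j → i ≡ j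
  at-inj nil        _        {zero}  {zero}  _ = refl
  at-inj (cons a p) (u∉ , s) {zero}  {zero}  _ = refl
  at-inj (cons a p) (u∉ , s) {zero}  {suc j} e = ⊥-elim (u∉ (subst (_∈ʷ p) (≡-sym e) (at∈ p j)))
  at-inj (cons a p) (u∉ , s) {suc i} {zero}  e = ⊥-elim (u∉ (subst (_∈ʷ p) e (at∈ p i)))
  at-inj (cons a p) (u∉ , s) {suc i} {suc j} e = cong suc (at-inj p s e)

  at-step : ∀ {u v ℓ} (p : Walk G u v ℓ) (i : Fin ℓ) → Adj G (at p (inject₁ i)) (at p (suc i))
  at-step (cons {u} a p) zero    = subst (Adj G u) (≡-sym (at-start p)) a
  at-step (cons a p)     (suc i) with p
  ... | cons b q = at-step (cons b q) i

  closing-cycle : ∀ {u v ℓ} (p : Walk G u v (suc (suc ℓ))) → Simple p → Adj G v u → Cycle G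
  closing-cycle {u} {v} {ℓ} p s e = record
    { k = ℓ ; c = at p ; inj = at-inj p s ; step = at-step p
    ; close = cong-adj (≡-sym (at-end p)) (≡-sym (at-start p)) e }
    where
    cong-adj : ∀ {a b a′ b′} → a ≡ a′ → b ≡ b′ → Adj G a b → Adj G a′ b′
    cong-adj refl refl x = x

least : {P : ℕ → Set} → (∀ k → Dec (P k)) → ∀ m → P m → Σ ℕ λ k → P k × (∀ j → P j → k ≤ j)
least P? zero    p = 0 , p , λ _ _ → z≤n
least P? (suc m) p with P? 0
... | yes p0 = 0 , p0 , λ _ _ → z≤n
... | no ¬p0 with least (λ k → P? (suc k)) m p
... | k , pk , min = suc k , pk , λ { zero p0 → ⊥-elim (¬p0 p0) ; (suc j) pj → s≤s (min j pj) }

module TreeDistance {n : ℕ} {T : Graph n} (conn : Connected T) (acyc : Acyclic T) where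

  -- Adjacency in `T` comes without a decision procedure. A simple walk supplies one: if it has more
  -- than one edge, an edge between its ends would close it to a cycle.
  adj? : ∀ u v → Dec (Adj T u v)
  adj? u v with u ≟F v
  ... | yes refl = no (irrefl T)
  ... | no u≢v with shorten (proj₂ (conn u v))
  ... | _ , nil , _                   = ⊥-elim (u≢v refl)
  ... | _ , cons a nil , _            = yes a
  ... | _ , p@(cons _ (cons _ _)) , s , _ = no λ e → acyc (closing-cycle p s (Graph.sym T e))

  walk? : ∀ k u v → Dec (Walk T u v k)
  walk? zero u v = map′ (λ { refl → nil }) (λ { nil → refl }) (u ≟F v)
  walk? (suc k) u v = map′ (λ { (_ , a , p) → cons a p }) (λ { (cons a p) → _ , a , p })
                           (any? λ w → adj? u w ×-dec walk? k w v)

  private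
    shortest : ∀ u v → Σ ℕ λ k → Walk T u v k × (∀ j → Walk T u v j → k ≤ j)
    shortest u v = least (λ k → walk? k u v) _ (proj₂ (conn u v))

  dist : Fin n → Fin n → ℕ
  dist u v = proj₁ (shortest u v)

  geodesic : ∀ u v → Walk T u v (dist u v)
  geodesic u v = proj₁ (proj₂ (shortest u v))

  dist-min : ∀ {u v k} → Walk T u v k → dist u v ≤ k
  dist-min {u} {v} = proj₂ (proj₂ (shortest u v)) _

  dist-sym : ∀ u v → dist u v ≡ dist v u
  dist-sym u v = ≤-antisym (dist-min (revʷ (geodesic v u))) (dist-min (revʷ (geodesic u v)))

  dist-refl : ∀ u → dist u u ≡ 0
  dist-refl u = n≤0⇒n≡0 (dist-min nil)

  private
    zero-walk : ∀ {u v k} → k ≡ 0 → Walk T u v k → u ≡ v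
    zero-walk refl nil = refl

    one-walk : ∀ {u v k} → k ≡ 1 → Walk T u v k → Adj T u v
    one-walk refl (cons a nil) = a

    first-step : ∀ {u v k j} → k ≡ suc j → Walk T u v k → Σ (Fin n) λ z → Adj T u z × Walk T z v j
    first-step refl (cons a p) = _ , a , p

    -- The first vertex `c` is not `z`, and a later visit to `z` would leave a walk from `z` to `v`
    -- shorter than `dist z v`.
    avoids : ∀ {v z c k} → dist z c ≡ 1 → (r : Walk T c v k) → k ≤ dist z v → ¬ (z ∈ʷ r)
    avoids zc nil        k≤ refl        = 0≢1+n (trans (≡-sym (dist-refl _)) zc)
    avoids zc (cons e r) k≤ (inj₁ refl) = 0≢1+n (trans (≡-sym (dist-refl _)) zc)
    avoids zc (cons e r) k≤ (inj₂ m) with suffix r m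
    ... | j , j≤k , q = <-irrefl refl (≤-trans (s≤s (≤-trans (dist-min q) j≤k)) k≤)

    dist-hop : ∀ {k} x y → dist x y ≡ suc k → Σ (Fin n) λ z → dist x z ≡ 1 × dist z y ≡ k
    dist-hop {k} x y e with first-step e (geodesic x y)
    ... | z , a , p = z , ≤-antisym (dist-min (cons a nil)) (n≢0⇒n>0 x≢z) , ≤-antisym (dist-min p) k≤
      where
      x≢z : dist x z ≢ 0
      x≢z dz = irrefl T (subst (Adj T x) (≡-sym (zero-walk dz (geodesic x z))) a)
      k≤ : k ≤ dist z y
      k≤ = s≤s⁻¹ (≤-trans (≤-reflexive (≡-sym e)) (dist-min (cons a (geodesic z y))))

    -- Geodesics from `a` and `b` to `v` both miss `z`; joined and shortened they give a simple walk
    -- from `a` to `b`, which closes through `z` to a cycle.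
    dist-closer! : ∀ {v z a b} → dist z a ≡ 1 → dist z b ≡ 1 → dist v a ≤ dist v z → dist v b ≤ dist v z → a ≡ b
    dist-closer! {v} {z} {a} {b} za zb va vb with a ≟F b
    ... | yes e = e
    ... | no a≢b with shorten (geodesic a v ++ʷ revʷ (geodesic b v))
    ... | _ , nil , _ = ⊥-elim (a≢b refl)
    ... | _ , p@(cons _ _) , s , sub =
      ⊥-elim (acyc (closing-cycle (cons (one-walk za (geodesic z a)) p) (z∉ , s)
                                  (Graph.sym T (one-walk zb (geodesic z b)))))
      where
      avoid : ∀ {c} → dist z c ≡ 1 → dist v c ≤ dist v z → ¬ (z ∈ʷ geodesic c v)
      avoid {c} zc vc = avoids zc (geodesic c v)
        (≤-trans (≤-reflexive (dist-sym c v)) (≤-trans vc (≤-reflexive (dist-sym v z))))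
      z∉ : ¬ (z ∈ʷ p)
      z∉ m with ∈-++ (geodesic a v) (revʷ (geodesic b v)) (sub m)
      ... | inj₁ l = avoid za va l
      ... | inj₂ r = avoid zb vb (∈-rev (geodesic b v) r)

  metric : TreeMetric n
  metric = record
    { d = dist ; d-refl = dist-refl ; d-sym = dist-sym ; hop = dist-hop ; closer! = dist-closer!
    ; d-zero = λ {x} {y} e → zero-walk e (geodesic x y)
    ; d-tri = λ x y z → dist-min (geodesic x y ++ʷ geodesic y z) }

  distLE⇒ : ∀ {u v k} → DistLE T k u v → dist u v ≤ k
  distLE⇒ (_ , ℓ≤k , p) = ≤-trans (dist-min p) ℓ≤k

  distLE⇐ : ∀ {u v k} → dist u v ≤ k → DistLE T k u v
  distLE⇐ le = _ , le , geodesic _ _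

-- Counting along the deck

sum-≤ : ∀ {n} {f g : Fin n → ℕ} → (∀ i → f i ≤ g i) → sum f ≤ sum g
sum-≤ {zero}  f≤g = z≤n
sum-≤ {suc n} f≤g = +-mono-≤ (f≤g zero) (sum-≤ (f≤g ∘ suc))

sum-≤-tight : ∀ {n} {f g : Fin n → ℕ} → (∀ i → f i ≤ g i) → sum g ≤ sum f → ∀ i → f i ≡ g i
sum-≤-tight {suc n} {f} {g} f≤g g≤f zero = ≤-antisym (f≤g zero)
  (+-cancelʳ-≤ (sum (f ∘ suc)) _ _ (≤-trans (+-monoʳ-≤ (g zero) (sum-≤ (f≤g ∘ suc))) g≤f))
sum-≤-tight {suc n} {f} {g} f≤g g≤f (suc i) = sum-≤-tight (f≤g ∘ suc)
  (+-cancelˡ-≤ (f zero) _ _ (≤-trans (+-monoˡ-≤ _ (f≤g zero)) g≤f)) i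

sum-const : ∀ {n} (k : ℕ) → sum {n} (λ _ → k) ≡ n * k
sum-const {zero}  k = refl
sum-const {suc n} k = cong (k +_) (sum-const {n} k)

sum-zero : ∀ {n} {f : Fin n → ℕ} → (∀ i → f i ≡ 0) → sum f ≡ 0
sum-zero {n} f0 = trans (sum-cong-≗ f0) (trans (sum-const {n} 0) (*-zeroʳ n))

sum≡0 : ∀ {n} {f : Fin n → ℕ} → sum f ≡ 0 → ∀ i → f i ≡ 0
sum≡0 {suc n} {f} e zero    = m+n≡0⇒m≡0 (f zero) e
sum≡0 {suc n} {f} e (suc i) = sum≡0 (m+n≡0⇒n≡0 (f zero) e) i

𝟙 : ∀ {P : Set} → Dec P → ℕ
𝟙 (yes _) = 1
𝟙 (no _)  = 0

𝟙-cong : ∀ {P Q : Set} (p : Dec P) (q : Dec Q) → (P → Q) → (Q → P) → 𝟙 p ≡ 𝟙 q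
𝟙-cong (yes p) (yes q) f g = refl
𝟙-cong (yes p) (no ¬q) f g = ⊥-elim (¬q (f p))
𝟙-cong (no ¬p) (yes q) f g = ⊥-elim (¬p (g q))
𝟙-cong (no ¬p) (no ¬q) f g = refl

𝟙-mono : ∀ {P Q : Set} (p : Dec P) (q : Dec Q) → (P → Q) → 𝟙 p ≤ 𝟙 q
𝟙-mono (yes p) (yes q) f = ≤-refl
𝟙-mono (yes p) (no ¬q) f = ⊥-elim (¬q (f p))
𝟙-mono (no ¬p) q       f = z≤n

𝟙-yes : ∀ {P : Set} (p : Dec P) → P → 𝟙 p ≡ 1
𝟙-yes (yes _) _ = refl
𝟙-yes (no ¬p) p = ⊥-elim (¬p p)

𝟙-no : ∀ {P : Set} (p : Dec P) → ¬ P → 𝟙 p ≡ 0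
𝟙-no (yes p) ¬p = ⊥-elim (¬p p)
𝟙-no (no _)  _  = refl

𝟙⇒ : ∀ {P : Set} (p : Dec P) → 𝟙 p ≢ 0 → P
𝟙⇒ (yes p) _ = p
𝟙⇒ (no _)  h = ⊥-elim (h refl)

δ ρ : ∀ {n} → Fin n → Fin n → ℕ
δ v x = 𝟙 (x ≟F v)
ρ v x = 1 ∸ δ v x

δ-suc : ∀ {n} (v x : Fin n) → δ (suc v) (suc x) ≡ δ v x
δ-suc v x = 𝟙-cong (suc x ≟F suc v) (x ≟F v) (λ { refl → refl }) (cong suc)

sum-δ : ∀ {n} (v : Fin n) (f : Fin n → ℕ) → sum (λ x → δ v x * f x) ≡ f v
sum-δ {suc n} zero f = trans (cong (f zero + 0 +_) (sum-zero {n} λ i → refl))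
  (trans (+-identityʳ _) (+-identityʳ _))
sum-δ {suc n} (suc v) f = trans (sum-cong-≗ λ x → cong (_* f (suc x)) (δ-suc v x)) (sum-δ v (f ∘ suc))

-- The isomorphism of cards is extended by `v` to `w` to a permutation of all vertices, so that sums
-- over the whole vertex set can be reindexed.
record CardIso {n m} (G : Graph n) (H : Graph m) (v : Fin n) (w : Fin m) : Set where
  field
    φ    : Permutation n m
    φ-at : φ ⟨$⟩ʳ v ≡ w
    φ-to : ∀ {x y} → x ≢ v → y ≢ v → Adj G x y → Adj H (φ ⟨$⟩ʳ x) (φ ⟨$⟩ʳ y)
    φ-of : ∀ {x y} → x ≢ v → y ≢ v → Adj H (φ ⟨$⟩ʳ x) (φ ⟨$⟩ʳ y) → Adj G x y

record Deck {n m} (G : Graph n) (H : Graph m) : Set where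
  field
    σ     : Permutation n m
    cards : ∀ v → CardIso G H v (σ ⟨$⟩ʳ v)

perm-inj : ∀ {n m} (π : Permutation n m) {x y} → π ⟨$⟩ʳ x ≡ π ⟨$⟩ʳ y → x ≡ y
perm-inj π {x} {y} e = trans (≡-sym (inverseˡ π)) (trans (cong (π ⟨$⟩ˡ_) e) (inverseˡ π))

-- Kelly's lemma in the following form: if every total Σ w splits as a part depending only on
-- the v-th card plus k times the weight of v, then both Σ w and w can be read off the deck.
kelly : ∀ {N} (σ : Permutation N N) (k : ℕ) (w r w′ r′ : Fin N → ℕ) →
  (∀ v → sum w ≡ r v + suc k * w v) → (∀ v → sum w′ ≡ r′ v + suc k * w′ v) →
  (∀ v → r v ≡ r′ (σ ⟨$⟩ʳ v)) → suc k < N → ∀ v → w v ≡ w′ (σ ⟨$⟩ʳ v)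
kelly {N} σ k w r w′ r′ split split′ same k<N v =
  *-cancelˡ-≡ _ _ (suc k) (+-cancelˡ-≡ (r v) _ _ (trans (≡-sym (split v)) (trans sum≡
    (trans (split′ _) (cong (_+ suc k * w′ (σ ⟨$⟩ʳ v)) (≡-sym (same v)))))))
  where
  -- Adding up the splittings over all `v`; as `suc k < N`, the total weight is then recovered by
  -- division.
  total : (w r : Fin N → ℕ) → (∀ v → sum w ≡ r v + suc k * w v) → N * sum w ≡ sum r + suc k * sum w
  total w r split = trans (≡-sym (sum-const {N} (sum w))) (trans (sum-cong-≗ split)
    (trans (∑-distrib-+ r _) (cong (sum r +_) (≡-sym (*-distribˡ-sum (suc k) w)))))
  sum-r : sum r ≡ sum r′
  sum-r = trans (sum-cong-≗ same) (≡-sym (sum-permute r′ σ))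
  excess : ∀ S T → N * T ≡ S + suc k * T → (N ∸ suc k) * T ≡ S
  excess S T e = trans (*-distribʳ-∸ T N (suc k)) (trans (cong (_∸ suc k * T) e) (m+n∸n≡m S (suc k * T)))
  sum≡ : sum w ≡ sum w′
  sum≡ with N ∸ suc k | m<n⇒0<n∸m k<N | excess _ _ (total w r split) | excess _ _ (total w′ r′ split′)
  ... | suc j | _ | e | e′ = *-cancelˡ-≡ _ _ (suc j) (trans e (trans sum-r (≡-sym e′)))

Simplicial : ∀ {n} → Graph n → Fin n → Set
Simplicial G v = ∀ {y z} → Adj G v y → Adj G v z → y ≢ z → Adj G y z

module Counts {N : ℕ} (G : Graph N) (adj? : ∀ u v → Dec (Adj G u v)) where

  a : Fin N → Fin N → ℕ
  a x y = 𝟙 (adj? x y)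

  a-sym : ∀ x y → a x y ≡ a y x
  a-sym x y = 𝟙-cong (adj? x y) (adj? y x) (Graph.sym G) (Graph.sym G)

  a-irr : ∀ x → a x x ≡ 0
  a-irr x = 𝟙-no (adj? x x) (irrefl G)

  -- `a x y` and `δ x y` are never both 1, so the truncated subtraction is exact.
  nonadj : Fin N → Fin N → ℕ
  nonadj x y = 1 ∸ (a x y + δ x y)

  -- Pairs are ordered: `tri x` is twice the number of triangles at `x`, and `cherry x` twice the
  -- number of induced paths on three vertices with middle `x`, so it vanishes exactly when `x` is
  -- simplicial.
  deg tri cherry : Fin N → ℕ
  deg x    = sum λ y → a x y
  tri x    = sum λ y → sum λ z → a x y * (a y z * a x z)
  cherry x = sum λ y → sum λ z → nonadj y z * (a x y * a x z)

  edges-avoiding triangles-avoiding : Fin N → ℕ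
  edges-avoiding v     = sum λ x → sum λ y → ρ v x * (ρ v y * a x y)
  triangles-avoiding v = sum λ x → sum λ y → sum λ z → ρ v x * (ρ v y * (ρ v z * (a x y * (a y z * a x z))))

  private
    edge-split : ∀ v x y → a x y ≡ ρ v x * (ρ v y * a x y) + δ v x * a x y + δ v y * a x y
    edge-split v x y with x ≟F v | y ≟F v
    ... | yes refl | yes refl rewrite a-irr v = refl
    ... | yes refl | no _ = arith (a x y) where
      arith : ∀ t → t ≡ 0 + (t + 0) + 0
      arith = solve-∀
    ... | no _ | yes refl = arith (a x y) where
      arith : ∀ t → t ≡ 0 + 0 + (t + 0)
      arith = solve-∀
    ... | no _ | no _ = arith (a x y) where
      arith : ∀ t → t ≡ (t + 0) + 0 + 0 + 0
      arith = solve-∀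

    triangle-split : ∀ v x y z → let t = a x y * (a y z * a x z) in
      t ≡ ρ v x * (ρ v y * (ρ v z * t)) + δ v x * t + δ v y * t + δ v z * t
    triangle-split v x y z with x ≟F v | y ≟F v | z ≟F v
    ... | yes refl | yes refl | yes _ rewrite a-irr v = refl
    ... | yes refl | yes refl | no _  rewrite a-irr v = refl
    ... | yes refl | no _ | yes refl rewrite a-irr v | *-zeroʳ (a y v) | *-zeroʳ (a v y) = refl
    ... | no _ | yes refl | yes refl rewrite a-irr v | *-zeroʳ (a x v) = refl
    ... | yes refl | no _ | no _ = arith (a x y * (a y z * a x z)) where
      arith : ∀ t → t ≡ 0 + (t + 0) + 0 + 0
      arith = solve-∀
    ... | no _ | yes refl | no _ = arith (a x y * (a y z * a x z)) where
      arith : ∀ t → t ≡ 0 + 0 + (t + 0) + 0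
      arith = solve-∀
    ... | no _ | no _ | yes refl = arith (a x y * (a y z * a x z)) where
      arith : ∀ t → t ≡ 0 + 0 + 0 + (t + 0)
      arith = solve-∀
    ... | no _ | no _ | no _ = arith (a x y * (a y z * a x z)) where
      arith : ∀ t → t ≡ (t + 0 + 0 + 0) + 0 + 0 + 0
      arith = solve-∀

    sum₂-+ : (f g : Fin N → Fin N → ℕ) →
      sum (λ x → sum λ y → f x y + g x y) ≡ sum (λ x → sum (f x)) + sum (λ x → sum (g x))
    sum₂-+ f g = trans (sum-cong-≗ λ x → ∑-distrib-+ (f x) (g x))
      (∑-distrib-+ (λ x → sum (f x)) (λ x → sum (g x)))

    sum₃-+ : (f g : Fin N → Fin N → Fin N → ℕ) →
      sum (λ x → sum λ y → sum λ z → f x y z + g x y z) ≡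
      sum (λ x → sum λ y → sum (f x y)) + sum (λ x → sum λ y → sum (g x y))
    sum₃-+ f g = trans (sum-cong-≗ λ x → sum₂-+ (f x) (g x))
      (∑-distrib-+ (λ x → sum λ y → sum (f x y)) (λ x → sum λ y → sum (g x y)))

    sum₂-cong : {f g : Fin N → Fin N → ℕ} → (∀ x y → f x y ≡ g x y) →
      sum (λ x → sum (f x)) ≡ sum (λ x → sum (g x))
    sum₂-cong e = sum-cong-≗ λ x → sum-cong-≗ (e x)

    sum₃-cong : {f g : Fin N → Fin N → Fin N → ℕ} → (∀ x y z → f x y z ≡ g x y z) →
      sum (λ x → sum λ y → sum (f x y)) ≡ sum (λ x → sum λ y → sum (g x y))
    sum₃-cong e = sum-cong-≗ λ x → sum₂-cong (e x)

    sum₂-δ : ∀ v (f : Fin N → Fin N → ℕ) → sum (λ x → sum λ y → δ v x * f x y) ≡ sum (f v)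
    sum₂-δ v f = trans (sum-cong-≗ λ x → ≡-sym (*-distribˡ-sum (δ v x) (f x))) (sum-δ v (λ x → sum (f x)))

    sum₃-δ : ∀ v (f : Fin N → Fin N → Fin N → ℕ) →
      sum (λ x → sum λ y → sum λ z → δ v x * f x y z) ≡ sum λ y → sum (f v y)
    sum₃-δ v f = trans (sum₂-cong λ x y → ≡-sym (*-distribˡ-sum (δ v x) (f x y))) (sum₂-δ v (λ x y → sum (f x y)))

  edges-split : ∀ v → sum deg ≡ edges-avoiding v + 2 * deg v
  edges-split v = trans (sum₂-cong (edge-split v)) (trans (sum₂-+ _ _) (trans (cong₂ _+_ (sum₂-+ _ _) at-y)
    (trans (cong (λ t → edges-avoiding v + t + deg v) (sum₂-δ v a)) (arith (edges-avoiding v) (deg v)))))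
    where
    arith : ∀ e d → e + d + d ≡ e + 2 * d
    arith = solve-∀
    at-y : sum (λ x → sum λ y → δ v y * a x y) ≡ deg v
    at-y = sum-cong-≗ λ x → trans (sum-δ v (a x)) (a-sym x v)

  triangles-split : ∀ v → sum tri ≡ triangles-avoiding v + 3 * tri v
  triangles-split v = trans (sum₃-cong (triangle-split v)) (trans (sum₃-+ _ _) (trans (cong₂ _+_
    (trans (sum₃-+ _ _) (cong₂ _+_ (trans (sum₃-+ _ _) (cong (triangles-avoiding v +_) (sum₃-δ v _))) at-y)) at-z)
    (arith (triangles-avoiding v) (tri v))))
    where
    arith : ∀ e d → e + d + d + d ≡ e + 3 * d
    arith = solve-∀
    at-y : sum (λ x → sum λ y → sum λ z → δ v y * (a x y * (a y z * a x z))) ≡ tri v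
    at-y = sum-cong-≗ λ x → trans (sum₂-δ v _) (sum-cong-≗ λ z → swap (a-sym x v) (a v z) (a x z))
      where
      swap : ∀ {p q} → p ≡ q → ∀ r s → p * (r * s) ≡ q * (s * r)
      swap {p} refl r s = cong (p *_) (*-comm r s)
    at-z : sum (λ x → sum λ y → sum λ z → δ v z * (a x y * (a y z * a x z))) ≡ tri v
    at-z = sum₂-cong λ x y → trans (sum-δ v _) (swap (a x y) (a-sym y v) (a-sym x v))
      where
      arith′ : ∀ t r s → t * (r * s) ≡ s * (t * r)
      arith′ = solve-∀
      swap : ∀ t {r r′ s s′} → r ≡ r′ → s ≡ s′ → t * (r * s) ≡ s′ * (t * r′)
      swap t {r} {_} {s} refl refl = arith′ t r s

  -- An ordered pair of neighbours of `v` is adjacent, equal, or the pair of ends of an induced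
  -- path. Hence `cherry` follows from `deg` and `tri`, which Kelly's lemma reads off the deck.
  cherry-split : ∀ v → deg v * deg v ≡ tri v + deg v + cherry v
  cherry-split v = trans square (trans (sum₂-cong pointwise) (trans (sum₂-+ _ _) (cong (_+ cherry v)
    (trans (sum₂-+ _ _) (cong (tri v +_) (sum-cong-≗ λ y → sum-δ y (a v)))))))
    where
    square : deg v * deg v ≡ sum λ y → sum λ z → a v y * a v z
    square = trans (*-distribˡ-sum (deg v) (a v)) (sum-cong-≗ λ y →
      trans (*-comm (deg v) (a v y)) (*-distribˡ-sum (a v y) (a v)))
    a² : ∀ x y → a x y * a x y ≡ a x y
    a² x y with adj? x y
    ... | yes _ = refl
    ... | no _  = refl
    pointwise : ∀ y z → a v y * a v z ≡
      a v y * (a y z * a v z) + δ y z * a v z + nonadj y z * (a v y * a v z)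
    pointwise y z with z ≟F y
    ... | yes refl rewrite a-irr y | a² v y | *-zeroʳ (a v y) = arith (a v y) where
      arith : ∀ t → t ≡ t + 0 + 0
      arith = solve-∀
    ... | no _ with adj? y z
    ... | yes _ = arith (a v y) (a v z) where
      arith : ∀ s t → s * t ≡ s * (t + 0) + 0 + 0
      arith = solve-∀
    ... | no _ = arith (a v y) (a v z) where
      arith : ∀ s t → s * t ≡ s * 0 + 0 + (s * t + 0)
      arith = solve-∀

  simplicial⇒ : ∀ v → Simplicial G v → cherry v ≡ 0
  simplicial⇒ v sim = sum-zero λ y → sum-zero λ z → term y z
    where
    term : ∀ y z → nonadj y z * (a v y * a v z) ≡ 0
    term y z with adj? v y | adj? v z
    ... | no _  | _     = *-zeroʳ (nonadj y z)
    ... | yes _ | no _  = *-zeroʳ (nonadj y z)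
    ... | yes p | yes q with z ≟F y
    ... | yes refl rewrite a-irr y = refl
    ... | no z≢y rewrite 𝟙-yes (adj? y z) (sim p q (z≢y ∘ ≡-sym)) = refl

  simplicial⇐ : ∀ v → cherry v ≡ 0 → Simplicial G v
  simplicial⇐ v c0 {y} {z} p q y≢z with adj? y z in eq
  ... | yes e = e
  ... | no ne = ⊥-elim (1+n≢0 (trans (≡-sym bad) (sum≡0 (sum≡0 c0 y) z)))
    where
    bad : nonadj y z * (a v y * a v z) ≡ 1
    bad rewrite eq | 𝟙-no (z ≟F y) (y≢z ∘ ≡-sym) | 𝟙-yes (adj? v y) p | 𝟙-yes (adj? v z) q = refl

  simplicial? : ∀ v → Dec (Simplicial G v)
  simplicial? v with cherry v ≟ 0
  ... | yes e = yes (simplicial⇐ v e)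
  ... | no ne = no λ s → ne (simplicial⇒ v s)

-- Kept apart from the triangle counts: counting edges requires only three vertices, which is all
-- that the case of a dominating vertex provides.
module DeckDegrees {N : ℕ} {G H : Graph N} (G? : ∀ u v → Dec (Adj G u v)) (H? : ∀ u v → Dec (Adj H u v))
  (𝔻 : Deck G H) (2<N : 2 < N) where

  open Deck 𝔻
  private
    module CG = Counts G G?
    module CH = Counts H H?

  module _ (v : Fin N) where
    open CardIso (cards v)

    ρ-φ : ∀ x → ρ v x ≡ ρ (σ ⟨$⟩ʳ v) (φ ⟨$⟩ʳ x)
    ρ-φ x = cong (1 ∸_) (𝟙-cong (x ≟F v) ((φ ⟨$⟩ʳ x) ≟F (σ ⟨$⟩ʳ v))
      (λ { refl → φ-at }) (λ e → perm-inj φ (trans e (≡-sym φ-at))))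

    a-φ : ∀ x y → x ≢ v → y ≢ v → CG.a x y ≡ CH.a (φ ⟨$⟩ʳ x) (φ ⟨$⟩ʳ y)
    a-φ x y x≢ y≢ = 𝟙-cong (G? x y) (H? (φ ⟨$⟩ʳ x) (φ ⟨$⟩ʳ y)) (φ-to x≢ y≢) (φ-of x≢ y≢)

    edges-φ : CG.edges-avoiding v ≡ CH.edges-avoiding (σ ⟨$⟩ʳ v)
    edges-φ = trans (sum-cong-≗ λ x → trans (sum-cong-≗ (pt x)) (≡-sym (sum-permute _ φ))) (≡-sym (sum-permute _ φ))
      where
      pt : ∀ x y → ρ v x * (ρ v y * CG.a x y) ≡
        ρ (σ ⟨$⟩ʳ v) (φ ⟨$⟩ʳ x) * (ρ (σ ⟨$⟩ʳ v) (φ ⟨$⟩ʳ y) * CH.a (φ ⟨$⟩ʳ x) (φ ⟨$⟩ʳ y))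
      pt x y rewrite ≡-sym (ρ-φ x) | ≡-sym (ρ-φ y) with x ≟F v | y ≟F v
      ... | yes _ | _     = refl
      ... | no _  | yes _ = refl
      ... | no nx | no ny rewrite a-φ x y nx ny = refl

    triangles-φ : CG.triangles-avoiding v ≡ CH.triangles-avoiding (σ ⟨$⟩ʳ v)
    triangles-φ = trans (sum-cong-≗ λ x → trans (sum-cong-≗ λ y → trans (sum-cong-≗ (pt x y))
      (≡-sym (sum-permute _ φ))) (≡-sym (sum-permute _ φ))) (≡-sym (sum-permute _ φ))
      where
      pt : ∀ x y z → ρ v x * (ρ v y * (ρ v z * (CG.a x y * (CG.a y z * CG.a x z)))) ≡
        ρ (σ ⟨$⟩ʳ v) (φ ⟨$⟩ʳ x) * (ρ (σ ⟨$⟩ʳ v) (φ ⟨$⟩ʳ y) * (ρ (σ ⟨$⟩ʳ v) (φ ⟨$⟩ʳ z) *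
          (CH.a (φ ⟨$⟩ʳ x) (φ ⟨$⟩ʳ y) * (CH.a (φ ⟨$⟩ʳ y) (φ ⟨$⟩ʳ z) * CH.a (φ ⟨$⟩ʳ x) (φ ⟨$⟩ʳ z)))))
      pt x y z rewrite ≡-sym (ρ-φ x) | ≡-sym (ρ-φ y) | ≡-sym (ρ-φ z) with x ≟F v | y ≟F v | z ≟F v
      ... | yes _ | _     | _     = refl
      ... | no _  | yes _ | _     = refl
      ... | no _  | no _  | yes _ = refl
      ... | no nx | no ny | no nz rewrite a-φ x y nx ny | a-φ y z ny nz | a-φ x z nx nz = refl

  deg-σ : ∀ v → CG.deg v ≡ CH.deg (σ ⟨$⟩ʳ v)
  deg-σ = kelly σ 1 CG.deg CG.edges-avoiding CH.deg CH.edges-avoiding CG.edges-split CH.edges-split edges-φ 2<N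

module DeckCounts {N : ℕ} {G H : Graph N} (G? : ∀ u v → Dec (Adj G u v)) (H? : ∀ u v → Dec (Adj H u v))
  (𝔻 : Deck G H) (3<N : 3 < N) where

  open Deck 𝔻
  open DeckDegrees G? H? 𝔻 (<⇒≤ 3<N) public using (deg-σ)
  private
    module CG = Counts G G?
    module CH = Counts H H?

  tri-σ : ∀ v → CG.tri v ≡ CH.tri (σ ⟨$⟩ʳ v)
  tri-σ = kelly σ 2 CG.tri CG.triangles-avoiding CH.tri CH.triangles-avoiding CG.triangles-split CH.triangles-split (DeckDegrees.triangles-φ G? H? 𝔻 (<⇒≤ 3<N)) 3<N

  cherry-σ : ∀ v → CG.cherry v ≡ CH.cherry (σ ⟨$⟩ʳ v)
  cherry-σ v = +-cancelˡ-≡ (CG.tri v + CG.deg v) _ _ (trans (≡-sym (CG.cherry-split v))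
    (trans (cong₂ _*_ (deg-σ v) (deg-σ v)) (trans (CH.cherry-split _)
      (cong (_+ CH.cherry (σ ⟨$⟩ʳ v)) (cong₂ _+_ (≡-sym (tri-σ v)) (≡-sym (deg-σ v)))))))

  simplicial-σ : ∀ {v} → Simplicial G v → Simplicial H (σ ⟨$⟩ʳ v)
  simplicial-σ {v} s = CH.simplicial⇐ _ (trans (≡-sym (cherry-σ v)) (CG.simplicial⇒ v s))

  simplicial-σ⁻¹ : ∀ {v} → Simplicial H (σ ⟨$⟩ʳ v) → Simplicial G v
  simplicial-σ⁻¹ {v} s = CG.simplicial⇐ v (trans (cherry-σ v) (CH.simplicial⇒ _ s))

-- Isomorphisms, cards and relabelling

record Iso {n m} (G : Graph n) (H : Graph m) : Set where
  field
    π  : Permutation n m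
    to : ∀ {x y} → Adj G x y → Adj H (π ⟨$⟩ʳ x) (π ⟨$⟩ʳ y)
    of : ∀ {x y} → Adj H (π ⟨$⟩ʳ x) (π ⟨$⟩ʳ y) → Adj G x y

≅⇒Iso : ∀ {n m} {G : Graph n} {H : Graph m} → G ≅ H → Iso G H
≅⇒Iso (f , e) = record
  { π = ⤖⇒↔ f ; to = Equivalence.to (e _ _) ; of = Equivalence.from (e _ _) }

Iso⇒≅ : ∀ {n m} {G : Graph n} {H : Graph m} → Iso G H → G ≅ H
Iso⇒≅ i = ↔⇒⤖ π , λ u v → mk⇔ to of
  where open Iso i

Iso-sym : ∀ {n m} {G : Graph n} {H : Graph m} → Iso G H → Iso H G
Iso-sym {G = G} {H} i = record
  { π  = flip π
  ; to = λ e → of (subst₂ (Adj H) (≡-sym (inverseʳ π)) (≡-sym (inverseʳ π)) e)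
  ; of = λ e → subst₂ (Adj H) (inverseʳ π) (inverseʳ π) (to e) }
  where open Iso i

Iso-trans : ∀ {n m k} {G : Graph n} {H : Graph m} {K : Graph k} → Iso G H → Iso H K → Iso G K
Iso-trans i j = record { π = Iso.π i ∘ₚ Iso.π j ; to = Iso.to j ∘ Iso.to i ; of = Iso.of i ∘ Iso.of j }

insert-self : ∀ {n m} (i : Fin (suc n)) (j : Fin (suc m)) (π : Permutation n m) → insert i j π ⟨$⟩ʳ i ≡ j
insert-self i j π with i ≟F i
... | yes _ = refl
... | no ne = ⊥-elim (ne refl)

card-iso : ∀ {n m} {G : Graph (suc n)} {H : Graph (suc m)} v w → card G v ≅ card H w → CardIso G H v w
card-iso {G = G} {H} v w (f , e) = record { φ = φ ; φ-at = insert-self v w π ; φ-to = φ-to ; φ-of = φ-of }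
  where
  π = ⤖⇒↔ f
  φ = insert v w π
  at-punchIn : ∀ {x} (x≢ : x ≢ v) → φ ⟨$⟩ʳ x ≡ punchIn w (π ⟨$⟩ʳ punchOut (x≢ ∘ ≡-sym))
  at-punchIn x≢ = trans (cong (φ ⟨$⟩ʳ_) (≡-sym (punchIn-punchOut (x≢ ∘ ≡-sym)))) (insert-punchIn v w π _)
  φ-to : ∀ {x y} → x ≢ v → y ≢ v → Adj G x y → Adj H (φ ⟨$⟩ʳ x) (φ ⟨$⟩ʳ y)
  φ-to x≢ y≢ a = subst₂ (Adj H) (≡-sym (at-punchIn x≢)) (≡-sym (at-punchIn y≢)) (Equivalence.to (e _ _)
    (subst₂ (Adj G) (≡-sym (punchIn-punchOut (x≢ ∘ ≡-sym))) (≡-sym (punchIn-punchOut (y≢ ∘ ≡-sym))) a))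
  φ-of : ∀ {x y} → x ≢ v → y ≢ v → Adj H (φ ⟨$⟩ʳ x) (φ ⟨$⟩ʳ y) → Adj G x y
  φ-of x≢ y≢ a = subst₂ (Adj G) (punchIn-punchOut (x≢ ∘ ≡-sym)) (punchIn-punchOut (y≢ ∘ ≡-sym))
    (Equivalence.from (e _ _) (subst₂ (Adj H) (at-punchIn x≢) (at-punchIn y≢) a))

same-deck : ∀ {n m} {G : Graph (suc n)} {H : Graph (suc m)} → SameDeck G H → Deck G H
same-deck (σ , cards) = record { σ = ⤖⇒↔ σ ; cards = λ v → card-iso v _ (cards v) }

third : ∀ {k} (x y : Fin (suc (suc (suc k)))) → Σ (Fin (suc (suc (suc k)))) λ z → x ≢ z × y ≢ z
third zero          zero          = suc zero , (λ ()) , (λ ())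
third zero          (suc zero)    = suc (suc zero) , (λ ()) , (λ ())
third zero          (suc (suc _)) = suc zero , (λ ()) , (λ ())
third (suc zero)    zero          = suc (suc zero) , (λ ()) , (λ ())
third (suc (suc _)) zero          = suc zero , (λ ()) , (λ ())
third (suc _)       (suc _)       = zero , (λ ()) , (λ ())

-- Any two vertices of `H` survive in the card of some third vertex, where adjacency is decided in
-- `G`.
deck-dec : ∀ {k m} {G : Graph (suc (suc (suc k)))} {H : Graph m} →
  (∀ u v → Dec (Adj G u v)) → Deck G H → ∀ u v → Dec (Adj H u v)
deck-dec {G = G} {H} G? 𝔻 u v with third (Deck.σ 𝔻 ⟨$⟩ˡ u) (Deck.σ 𝔻 ⟨$⟩ˡ v)
... | z , u≢ , v≢ = map′
  (λ a → subst₂ (Adj H) (inverseʳ φ) (inverseʳ φ) (φ-to (off u≢) (off v≢) a))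
  (λ a → φ-of (off u≢) (off v≢) (subst₂ (Adj H) (≡-sym (inverseʳ φ)) (≡-sym (inverseʳ φ)) a))
  (G? (φ ⟨$⟩ˡ u) (φ ⟨$⟩ˡ v))
  where
  open Deck 𝔻
  open CardIso (cards z)
  off : ∀ {x} → σ ⟨$⟩ˡ x ≢ z → φ ⟨$⟩ˡ x ≢ z
  off ne e = ne (perm-inj σ (trans (inverseʳ σ) (trans (≡-sym (inverseʳ φ)) (trans (cong (φ ⟨$⟩ʳ_) e) φ-at))))

pull : ∀ {n m} → Graph m → Permutation n m → Graph n
pull H π = record
  { Adj = λ x y → Adj H (π ⟨$⟩ʳ x) (π ⟨$⟩ʳ y) ; sym = Graph.sym H ; irrefl = irrefl H }

record AgreesOff {n} (G H : Graph n) (p : Fin n) : Set where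
  field
    deck  : Deck G H
    σ-fix : Deck.σ deck ⟨$⟩ʳ p ≡ p
    off⇒  : ∀ {x y} → x ≢ p → y ≢ p → Adj G x y → Adj H x y
    off⇐  : ∀ {x y} → x ≢ p → y ≢ p → Adj H x y → Adj G x y

-- Relabelling `H` by the isomorphism of the cards at `p` turns that isomorphism into the identity
-- off `p`. The deck bijection, relabelled likewise, fixes `p`, so that Kelly's lemma compares `p`
-- with itself.
normalise : ∀ {n} {G H : Graph n} → Deck G H → ∀ p → Σ (Graph n) λ H′ → AgreesOff G H′ p × Iso H H′
normalise {n} {G} {H} 𝔻 p = pull H φₚ , record
  { deck = record { σ = σ ∘ₚ flip φₚ ; cards = cards′ }
  ; σ-fix = trans (cong (φₚ ⟨$⟩ˡ_) (≡-sym φₚ-at)) (inverseˡ φₚ)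
  ; off⇒ = CardIso.φ-to (cards p) ; off⇐ = CardIso.φ-of (cards p) }
  , Iso-sym (record { π = φₚ ; to = λ a → a ; of = λ a → a })
  where
  open Deck 𝔻
  φₚ = CardIso.φ (cards p)
  φₚ-at = CardIso.φ-at (cards p)
  cards′ : ∀ v → CardIso G (pull H φₚ) v ((σ ∘ₚ flip φₚ) ⟨$⟩ʳ v)
  cards′ v = record
    { φ = φ ∘ₚ flip φₚ ; φ-at = cong (φₚ ⟨$⟩ˡ_) φ-at
    ; φ-to = λ x≢ y≢ a → subst₂ (Adj H) (≡-sym (inverseʳ φₚ)) (≡-sym (inverseʳ φₚ)) (φ-to x≢ y≢ a)
    ; φ-of = λ x≢ y≢ a → φ-of x≢ y≢ (subst₂ (Adj H) (inverseʳ φₚ) (inverseʳ φₚ) a) }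
    where open CardIso (cards v)

-- Geometry of tree metrics

module Metric {n : ℕ} (M : TreeMetric n) where
  open TreeMetric M public

  private V = Fin n

  flip≡ : ∀ {x y k} → d x y ≡ k → d y x ≡ k
  flip≡ {x} {y} e = trans (d-sym y x) e

  flip≤ : ∀ {x y k} → d x y ≤ k → d y x ≤ k
  flip≤ {x} {y} le = ≤-trans (≤-reflexive (d-sym y x)) le

  via : ∀ {x y z j k} → d x y ≤ j → d y z ≤ k → d x z ≤ j + k
  via {x} {y} {z} p q = ≤-trans (d-tri x y z) (+-mono-≤ p q)

  -- A tree is bipartite: if `a` and `z` were equally far from `v`, then `closer!` would identify
  -- `a` with the next vertex from `z` towards `v`, which is nearer.
  step : ∀ v {z a} → d z a ≡ 1 → d v a ≡ suc (d v z) ⊎ d v z ≡ suc (d v a)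
  step v {z} {a} za with <-cmp (d v a) (d v z)
  ... | tri< lt _ _ = inj₂ (≤-antisym
          (≤-trans (d-tri v a z) (≤-reflexive (trans (cong (d v a +_) (flip≡ za)) (+-comm (d v a) 1)))) lt)
  ... | tri> _ _ gt = inj₁ (≤-antisym
          (≤-trans (d-tri v z a) (≤-reflexive (trans (cong (d v z +_) za) (+-comm (d v z) 1)))) gt)
  ... | tri≈ _ e _ = ⊥-elim (level (d v z) refl)
    where
    level : ∀ k → d v z ≡ k → ⊥
    level zero vz = 0≢1+n (trans (≡-sym (d-refl v))
      (trans (cong₂ d (d-zero vz) (d-zero (trans e vz))) za))
    level (suc k) vz with hop z v (flip≡ vz)
    ... | b , zb , bv = 1+n≢n (trans (≡-sym vz) (trans (≡-sym e) (trans (cong (d v) a≡b) (flip≡ bv))))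
      where
      a≡b : a ≡ b
      a≡b = closer! za zb (≤-reflexive e)
        (≤-trans (≤-reflexive (flip≡ bv)) (≤-trans (n≤1+n k) (≤-reflexive (≡-sym vz))))

  away : ∀ v {z a b} → d z a ≡ 1 → d z b ≡ 1 → a ≢ b → d v z ≡ suc (d v a) → d v b ≡ suc (d v z)
  away v za zb a≢b e with step v zb
  ... | inj₁ f = f
  ... | inj₂ f = ⊥-elim (a≢b (closer! za zb (≤-trans (n≤1+n _) (≤-reflexive (≡-sym e)))
                                            (≤-trans (n≤1+n _) (≤-reflexive (≡-sym f)))))

  ≢-by : ∀ {x y v j k} → d x v ≡ j → d y v ≡ k → j ≢ k → x ≢ y
  ≢-by xv yv j≢k refl = j≢k (trans (≡-sym xv) yv)

  1≢0 : ∀ {x y} → d x y ≡ 1 → x ≢ y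
  1≢0 {x} e refl = 0≢1+n (trans (≡-sym (d-refl x)) e)

  bound : ∀ {x y k} → d x y ≡ k → d x y ≤ k
  bound = ≤-reflexive

  clash : ∀ {x y j k} → d x y ≡ k → d x y ≤ j → j < k → ⊥
  clash refl le lt = <⇒≱ lt le

  dist2 : ∀ {x y z} → d y x ≡ 1 → d y z ≡ 1 → x ≢ z → d x z ≡ 2
  dist2 {x} {y} {z} yx yz x≢z = trans (away x yx yz x≢z (trans (flip≡ yx) (cong suc (≡-sym (d-refl x)))))
    (cong suc (flip≡ yx))

  -- For a vertex c that is simplicial in the cube restricted to a geodesically closed set P, with
  -- the first steps of a long path from c; simp is all that is needed of simpliciality.
  record Pendant (P : V → Set) (c : V) : Set where
    field
      hopP    : ∀ {k} x y → P x → P y → d x y ≡ suc k → Σ V λ z → P z × d x z ≡ 1 × d z y ≡ k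
      Pc      : P c
      x₁ x₂ x₃ : V
      Px₁     : P x₁
      Px₂     : P x₂
      Px₃     : P x₃
      c─x₁    : d c x₁ ≡ 1
      x₁─x₂   : d x₁ x₂ ≡ 1
      x₂─x₃   : d x₂ x₃ ≡ 1
      c≢x₂    : c ≢ x₂
      x₁≢x₃   : x₁ ≢ x₃
      simp    : ∀ y → P y → d y c ≤ 3 → d y x₃ ≤ 3

    -- If `v` lies beyond `x₂` as seen from `x₁`, then `d v c` exceeds `d v x₂` by 2; otherwise
    -- `d v x₃` exceeds `d v x₁` by 2 and is bounded by `simp`.
    near : ∀ v → P v → d v c ≤ 3 → d v x₁ ≤ 1 ⊎ d v x₂ ≤ 1
    near v Pv vc with step v x₁─x₂
    ... | inj₂ e = inj₂ (s≤s⁻¹ (s≤s⁻¹ (≤-trans (≤-reflexive (trans (cong suc (≡-sym e))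
                     (≡-sym (away v x₁─x₂ (flip≡ c─x₁) (λ q → c≢x₂ (≡-sym q)) e)))) vc)))
    ... | inj₁ e = inj₁ (s≤s⁻¹ (s≤s⁻¹ (≤-trans (≤-reflexive (trans (cong suc (≡-sym e))
                     (≡-sym (away v (flip≡ x₁─x₂) x₂─x₃ x₁≢x₃ e)))) (simp v Pv vc))))

    c-x₂ : d c x₂ ≡ 2
    c-x₂ = dist2 (flip≡ c─x₁) x₁─x₂ c≢x₂

    x₁-x₃ : d x₁ x₃ ≡ 2
    x₁-x₃ = dist2 (flip≡ x₁─x₂) x₂─x₃ x₁≢x₃

    -- A deeper branch at `x₁` off `x₂` would contain a vertex `w` at distance 2 from `x₁`, within 3
    -- of `c` but violating `near`.
    side : ∀ v → P v → d v x₂ ≡ suc (d v x₁) → d v x₁ ≤ 1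
    side v Pv e = go (d v x₁) refl
      where
      go : ∀ k → d v x₁ ≡ k → k ≤ 1
      go zero    _ = z≤n
      go (suc zero) _ = ≤-refl
      go (suc (suc k)) vx₁ with hopP x₁ v Px₁ Pv (flip≡ vx₁)
      ... | b , Pb , x₁b , bv with hopP b v Pb Pv bv
      ... | w , Pw , bw , wv with near w Pw (flip≤ (via (bound c─x₁) (via (bound x₁b) (bound bw))))
      ... | inj₁ w1 = ⊥-elim (clash vx₁ (via (bound (flip≡ wv)) w1) (s≤s (≤-reflexive (+-comm k 1))))
      ... | inj₂ w2 = ⊥-elim (clash (trans e (cong suc vx₁)) (via (bound (flip≡ wv)) w2)
                        (s≤s (≤-trans (≤-reflexive (+-comm k 1)) (n≤1+n _))))

    to-x₂ : ∀ v → P v → d v x₁ ≤ 3 → d v x₂ ≤ 2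
    to-x₂ v Pv le with step v x₁─x₂
    ... | inj₂ e = s≤s⁻¹ (≤-trans (≤-reflexive (≡-sym e)) le)
    ... | inj₁ e = ≤-trans (≤-reflexive e) (s≤s (side v Pv e))

    -- Together with `near` this makes each neighbour `b` of `x₁` other than `x₂` and `c` a twin of
    -- `c`.
    off-side : ∀ b → d x₁ b ≡ 1 → b ≢ x₂ → ∀ v → P v → d v b ≤ 3 → d v c ≤ 3
    off-side b x₁b b≢ v Pv vb with step v x₁b
    ... | inj₁ e = via {j = 2} (s≤s⁻¹ (≤-trans (≤-reflexive (≡-sym e)) vb)) (bound (flip≡ c─x₁))
    ... | inj₂ e = via {j = 2} (≤-trans (side v Pv (away v x₁b x₁─x₂ b≢ e)) (s≤s z≤n)) (bound (flip≡ c─x₁))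

    -- Both alternatives are inclusions of closed neighbourhoods in the cube, hence statements about
    -- the graph and not about a particular tree.
    Dominated : V → Set
    Dominated b = (∀ v → P v → d v x₁ ≤ 3 → d v b ≤ 3) ⊎ (∀ v → P v → d v b ≤ 3 → d v c ≤ 3)

    dominated : ∀ b → P b → d b c ≤ 3 → Dominated b
    dominated b Pb bc with near b Pb bc
    ... | inj₂ b2 = inj₁ λ v Pv le → via (to-x₂ v Pv le) (flip≤ b2)
    ... | inj₁ b1 = by-dist (d b x₁) refl b1
      where
      by-dist : ∀ k → d b x₁ ≡ k → k ≤ 1 → Dominated b
      by-dist zero e _ with d-zero e
      ... | refl = inj₁ λ v Pv le → le
      by-dist (suc zero) e _ with b ≟F x₂
      ... | yes refl = inj₁ λ v Pv le → ≤-trans (to-x₂ v Pv le) (n≤1+n 2)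
      ... | no b≢ = inj₂ (off-side b (flip≡ e) b≢)
      by-dist (suc (suc _)) e (s≤s ())

    leaf : ∀ b → P b → d c b ≡ 1 → b ≡ x₁
    leaf b Pb cb with b ≟F x₁
    ... | yes e = e
    ... | no b≢ with near b Pb (≤-trans (bound (flip≡ cb)) (s≤s z≤n))
    ... | inj₁ b1 = ⊥-elim (clash b-x₁ b1 ≤-refl)
      where
      b-x₁ = dist2 cb c─x₁ b≢
    ... | inj₂ b2 = ⊥-elim (clash (trans (away b (flip≡ c─x₁) x₁─x₂ c≢x₂ (trans b-x₁ (cong suc (≡-sym (flip≡ cb)))))
                                         (cong suc b-x₁)) b2 (s≤s (s≤s z≤n)))
      where
      b-x₁ = dist2 cb c─x₁ b≢

pull-metric : ∀ {n m} → TreeMetric m → Permutation n m → TreeMetric n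
pull-metric M π = record
  { d = λ x y → d (π ⟨$⟩ʳ x) (π ⟨$⟩ʳ y)
  ; d-refl = λ x → d-refl _
  ; d-zero = λ {x} {y} e → trans (≡-sym (inverseˡ π)) (trans (cong (π ⟨$⟩ˡ_) (d-zero e)) (inverseˡ π))
  ; d-sym = λ x y → d-sym _ _
  ; d-tri = λ x y z → d-tri _ _ _
  ; hop = λ x y e → let (z , xz , zy) = hop _ _ e in
      π ⟨$⟩ˡ z , trans (cong (d _) (inverseʳ π)) xz , trans (cong (λ t → d t _) (inverseʳ π)) zy
  ; closer! = λ za zb va vb →
      trans (≡-sym (inverseˡ π)) (trans (cong (π ⟨$⟩ˡ_) (closer! za zb va vb)) (inverseˡ π)) }
  where open TreeMetric M

module Structure {n : ℕ} (M : TreeMetric n) where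
  open Metric M

  private V = Fin n

  Leaf : V → Set
  Leaf u = ∀ {a b} → d u a ≡ 1 → d u b ≡ 1 → a ≡ b

  -- A geodesic with a leaf in its interior would have to return to the vertex it came from. So the
  -- complement of a leaf is geodesically closed, as `Pendant` demands.
  hop-off-leaf : ∀ {u} → Leaf u → ∀ {k} x y → x ≢ u → y ≢ u → d x y ≡ suc k →
    Σ V λ z → z ≢ u × d x z ≡ 1 × d z y ≡ k
  hop-off-leaf {u} leaf-u {k} x y x≢ y≢ e with hop x y e
  ... | z , xz , zy = z , z≢ k e zy , xz , zy
    where
    z≢ : ∀ k → d x y ≡ suc k → d z y ≡ k → z ≢ u
    z≢ zero    _ zy refl = y≢ (≡-sym (d-zero zy))
    z≢ (suc k) e zy refl with hop z y zy
    ... | b , zb , by with leaf-u zb (flip≡ xz)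
    ... | refl = m≢1+n+m k {1} (trans (≡-sym by) e)

  make-pendant : ∀ {P : V → Set} {c} →
    (∀ {k} x y → P x → P y → d x y ≡ suc k → Σ V λ z → P z × d x z ≡ 1 × d z y ≡ k) →
    P c → (∀ {y z} → P y → P z → d y c ≤ 3 → d z c ≤ 3 → d y z ≤ 3) →
    ∀ {g} → P g → 3 < d c g → Pendant P c
  make-pendant {P} {c} hopP Pc simp {g} Pg far = go _ refl far
    where
    go : ∀ k → d c g ≡ k → 3 < k → Pendant P c
    go (suc (suc (suc (suc k)))) cg _ with hopP c g Pc Pg cg
    ... | a , Pa , ca , ag with hopP a g Pa Pg ag
    ... | b , Pb , ab , bg with hopP b g Pb Pg bg
    ... | f , Pf , bf , fg = record
      { hopP = hopP ; Pc = Pc ; Px₁ = Pa ; Px₂ = Pb ; Px₃ = Pf ; c─x₁ = ca ; x₁─x₂ = ab ; x₂─x₃ = bf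
      ; c≢x₂ = ≢-by cg bg (λ ()) ; x₁≢x₃ = ≢-by ag fg (λ ())
      ; simp = λ y Py yc → simp Py Pf yc (flip≤ (via (bound ca) (via (bound ab) (bound bf)))) }
    go (suc (suc (suc zero))) _ (s≤s (s≤s (s≤s ())))
    go (suc (suc zero)) _ (s≤s (s≤s ()))
    go (suc zero) _ (s≤s ())
    go zero _ ()

  -- The ball of radius 3 about a vertex e deepest below o is covered by the unit balls
  -- about the parent and the grandparent of e.
  deepest-simplicial : ∀ {o e} → (∀ y → d o y ≤ d o e) → 1 < d o e →
    ∀ {y z} → d y e ≤ 3 → d z e ≤ 3 → d y z ≤ 3
  deepest-simplicial {o} {e} deep 1<oe = start _ refl 1<oe
    where
    start : ∀ k → d o e ≡ k → 1 < k → ∀ {y z} → d y e ≤ 3 → d z e ≤ 3 → d y z ≤ 3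
    start zero _ ()
    start (suc zero) _ (s≤s ())
    start (suc (suc k)) oe _ with hop e o (flip≡ oe)
    ... | f , ef , fo with hop f o fo
    ... | g , fg , go = λ ye ze → combine (cover _ ye) (cover _ ze)
      where
      of : d o e ≡ suc (d o f)
      of = trans oe (cong suc (≡-sym (flip≡ fo)))
      og : d o f ≡ suc (d o g)
      og = trans (flip≡ fo) (cong suc (≡-sym (flip≡ go)))
      deep! : ∀ {b} → d o b ≡ suc (d o e) → ⊥
      deep! {b} q = clash q (deep b) ≤-refl
      -- A vertex two steps below `f` would lie deeper than `e`.
      below-f : ∀ y → d y g ≡ suc (d y f) → d y f ≤ 2 → d y f ≤ 1
      below-f y yg yf≤2 = by-dist (d y f) refl yf≤2
        where
        by-dist : ∀ j → d y f ≡ j → j ≤ 2 → j ≤ 1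
        by-dist zero _ _ = z≤n
        by-dist (suc zero) _ _ = ≤-refl
        by-dist (suc (suc zero)) yf _ with hop f y (flip≡ yf)
        ... | b , fb , by = ⊥-elim (deep! (trans (away o (flip≡ fb) by f≢y (trans ob (cong suc refl)))
                (cong suc (trans ob (≡-sym of)))))
          where
          f≢y : f ≢ y
          f≢y refl = 0≢1+n (trans (≡-sym (d-refl f)) yf)
          b≢g : b ≢ g
          b≢g = ≢-by by (flip≡ (trans yg (cong suc yf))) (λ ())
          ob : d o b ≡ suc (d o f)
          ob = away o fg fb (λ q → b≢g (≡-sym q)) og
        by-dist (suc (suc (suc _))) _ (s≤s (s≤s ()))
      cover : ∀ y → d y e ≤ 3 → d y f ≤ 1 ⊎ d y g ≤ 1
      cover y ye with step y ef
      ... | inj₁ yf = beyond-e (d y e) refl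
        where
        beyond-e : ∀ j → d y e ≡ j → d y f ≤ 1 ⊎ d y g ≤ 1
        beyond-e zero    ye0 = inj₁ (bound (trans yf (cong suc ye0)))
        beyond-e (suc j) yej with hop e y (flip≡ yej)
        ... | b , eb , by = ⊥-elim (deep! (away o ef eb
                (≢-by (flip≡ (trans yf (cong suc yej))) by λ q → m≢1+n+m j {1} (≡-sym q)) of))
      ... | inj₂ yf with step y fg
      ... | inj₂ yg = inj₂ (s≤s⁻¹ (s≤s⁻¹ (≤-trans (≤-reflexive (trans (cong suc (≡-sym yg)) (≡-sym yf))) ye)))
      ... | inj₁ yg = inj₁ (below-f y yg (s≤s⁻¹ (≤-trans (≤-reflexive (≡-sym yf)) ye)))
      combine : ∀ {y z} → d y f ≤ 1 ⊎ d y g ≤ 1 → d z f ≤ 1 ⊎ d z g ≤ 1 → d y z ≤ 3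
      combine (inj₁ y1) (inj₁ z1) = ≤-trans (via y1 (flip≤ z1)) (n≤1+n 2)
      combine (inj₁ y1) (inj₂ z2) = via y1 (via (bound fg) (flip≤ z2))
      combine (inj₂ y2) (inj₁ z1) = via y2 (via (bound (flip≡ fg)) (flip≤ z1))
      combine (inj₂ y2) (inj₂ z2) = ≤-trans (via y2 (flip≤ z2)) (n≤1+n 2)

  module NoTwin {ℓ} (Pn : Pendant (λ _ → ⊤) ℓ)
    (no-twin : ∀ y → (∀ v → d v y ≤ 3 → d v ℓ ≤ 3) → (∀ v → d v ℓ ≤ 3 → d v y ≤ 3) → y ≡ ℓ) where

    open Pendant Pn renaming (x₁ to p; x₂ to q)

    -- A further neighbour of `p` would be a twin of `ℓ`: one inclusion of balls is `off-side`, the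
    -- other follows from `near`.
    p-neighbours : ∀ {y} → d p y ≡ 1 → y ≡ ℓ ⊎ y ≡ q
    p-neighbours {y} py with y ≟F q
    ... | yes e = inj₂ e
    ... | no y≢q = inj₁ (no-twin y (λ v → off-side y py y≢q v tt) near-y)
      where
      near-y : ∀ v → d v ℓ ≤ 3 → d v y ≤ 3
      near-y v vℓ with near v tt vℓ
      ... | inj₁ vp = ≤-trans (via vp (bound py)) (n≤1+n 2)
      ... | inj₂ vq = via vq (via (bound (flip≡ x₁─x₂)) (bound py))

    beyond : ∀ {v} → v ≢ ℓ → v ≢ p → d v p ≡ suc (d v q) × d v ℓ ≡ suc (d v p)
    beyond {v} v≢ℓ v≢p with step v x₁─x₂
    ... | inj₂ e = e , away v x₁─x₂ (flip≡ c─x₁) (λ z → c≢x₂ (≡-sym z)) e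
    ... | inj₁ e = ⊥-elim (at-p (d v p) refl (side v tt e))
      where
      at-p : ∀ k → d v p ≡ k → k ≤ 1 → ⊥
      at-p zero vp _ = v≢p (d-zero vp)
      at-p (suc zero) vp _ with p-neighbours (flip≡ vp)
      ... | inj₁ z    = v≢ℓ z
      ... | inj₂ refl = 0≢1+n (trans (≡-sym (d-refl q)) e)
      at-p (suc (suc k)) _ (s≤s ())

    ℓ-ball : ∀ {v} → d v ℓ ≤ 3 → v ≡ ℓ ⊎ d v q ≤ 1
    ℓ-ball {v} vℓ with v ≟F ℓ | v ≟F p
    ... | yes e | _        = inj₁ e
    ... | no _  | yes refl = inj₂ (bound x₁─x₂)
    ... | no n₁ | no n₂    = inj₂ (s≤s⁻¹ (s≤s⁻¹ (≤-trans (≤-reflexive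
                               (≡-sym (trans (proj₂ (beyond n₁ n₂)) (cong suc (proj₁ (beyond n₁ n₂)))))) vℓ)))

  -- P looks like a path c, x₁, x₂, x₃ with everything else hanging off x₃.
  record Beyond (P : V → Set) (c x₁ x₂ x₃ : V) : Set where
    field
      hopP  : ∀ {k} x y → P x → P y → d x y ≡ suc k → Σ V λ z → P z × d x z ≡ 1 × d z y ≡ k
      Px₃   : P x₃
      along : ∀ {v} → P v → v ≢ c → v ≢ x₁ → v ≢ x₂ →
        d v x₂ ≡ suc (d v x₃) × d v x₁ ≡ suc (d v x₂) × d v c ≡ suc (d v x₁)

    D : V → ℕ
    D v = d v x₃

    -- Depth is measured by `D` from the root `x₃`; `t` is the ancestor of `a` at depth 1, so it is
    -- the actual parent only if `a` has depth 2.
    parent : ∀ {a k} → P a → D a ≡ suc k → Σ V λ t → P t × D t ≡ 1 × d t a ≡ k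
    parent Pa e with hopP x₃ _ Px₃ Pa (flip≡ e)
    ... | t , Pt , x₃t , ta = t , Pt , flip≡ x₃t , ta

    -- Vertices of depth 2 under different children of `x₃` are at distance 4.
    same-parent : ∀ {a b t} → D a ≡ 2 → D b ≡ 2 → d a b ≤ 3 → D t ≡ 1 → d t a ≡ 1 → d t b ≡ 1
    same-parent {a} {b} {t} Da Db ab Dt ta with step b (flip≡ Dt)
    ... | inj₂ e = flip≡ (suc-injective (trans (≡-sym e) Db))
    ... | inj₁ e = ⊥-elim (clash (trans (away b Dt ta x₃≢a e) (cong suc (trans e (cong suc Db))))
                     (flip≤ ab) ≤-refl)
      where
      x₃≢a : x₃ ≢ a
      x₃≢a refl = 0≢1+n (trans (≡-sym (d-refl x₃)) Da)

    -- At most one neighbour of `t` is nearer to `v` than `t` is, so `t` is nearer to `v` than one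
    -- of `a` and `b`.
    siblings : ∀ {a b t v} → a ≢ b → d t a ≡ 1 → d t b ≡ 1 → d v a ≤ 3 → d v b ≤ 3 → d v t ≤ 3
    siblings {v = v} a≢b ta tb va vb with step v ta
    ... | inj₁ e = ≤-trans (n≤1+n _) (≤-trans (≤-reflexive (≡-sym e)) va)
    ... | inj₂ e = ≤-trans (n≤1+n _) (≤-trans (≤-reflexive (≡-sym (away v ta tb a≢b e))) vb)

    -- The witness is the parent of `v`. A vertex of depth 2 within 3 of it shares its parent by
    -- `same-parent`, hence is within 3 of `v`.
    third-level : ∀ {v} → P v → D v ≡ 3 →
      Σ V λ a → P a × D a ≡ 2 × d a v ≡ 1 × (∀ {b} → D b ≡ 2 → d a b ≤ 3 → d b v ≤ 3)
    third-level {v} Pv Dv with parent Pv Dv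
    ... | t , Pt , Dt , tv with hopP t v Pt Pv tv
    ... | a , Pa , ta , av = a , Pa , Da , av , λ Db ab →
            via (bound (flip≡ (same-parent Da Db ab Dt ta))) (via (bound ta) (bound av))
      where
      Da : D a ≡ 2
      Da = ≤-antisym (via (bound (flip≡ ta)) (bound Dt))
        (s≤s⁻¹ (≤-trans (≤-reflexive (≡-sym Dv)) (≤-trans (d-tri v a x₃) (+-monoˡ-≤ _ (bound (flip≡ av))))))

  -- The bound `only` on the ball about `c` rules out side branches at `x₁` and `x₂`, so the tree
  -- ends in a bare path.
  record Tail (P : V → Set) (c : V) : Set where
    field
      pendant : Pendant P c
    open Pendant pendant public
    field
      only : ∀ v → P v → d v c ≤ 3 → v ≡ c ⊎ v ≡ x₁ ⊎ v ≡ x₂ ⊎ v ≡ x₃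

    along : ∀ {v} → P v → v ≢ c → v ≢ x₁ → v ≢ x₂ →
      d v x₂ ≡ suc (d v x₃) × d v x₁ ≡ suc (d v x₂) × d v c ≡ suc (d v x₁)
    along {v} Pv v≢c v≢x₁ v≢x₂ = at-x₂ , at-x₁ , away v x₁─x₂ (flip≡ c─x₁) (λ z → c≢x₂ (≡-sym z)) at-x₁
      where
      at-x₁ : d v x₁ ≡ suc (d v x₂)
      at-x₁ with step v x₁─x₂
      ... | inj₂ e = e
      ... | inj₁ e with only v Pv (≤-trans (via (side v Pv e) (bound (flip≡ c─x₁))) (n≤1+n 2))
      ... | inj₁ z                 = ⊥-elim (v≢c z)
      ... | inj₂ (inj₁ z)          = ⊥-elim (v≢x₁ z)
      ... | inj₂ (inj₂ (inj₁ z))   = ⊥-elim (v≢x₂ z)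
      ... | inj₂ (inj₂ (inj₂ refl)) = ⊥-elim (clash (flip≡ x₁-x₃) (side v Pv e) ≤-refl)
      at-x₂ : d v x₂ ≡ suc (d v x₃)
      at-x₂ with step v x₂─x₃
      ... | inj₂ e = e
      ... | inj₁ e = ⊥-elim (go (d v x₂) refl)
        where
        go : ∀ k → d v x₂ ≡ k → ⊥
        go zero e₀ = v≢x₂ (d-zero e₀)
        go (suc k) e₁ with hopP x₂ v Px₂ Pv (flip≡ e₁)
        ... | b , Pb , x₂b , bv with only b Pb (flip≤ (via (bound c-x₂) (bound x₂b)))
        ... | inj₁ refl                 = clash (flip≡ c-x₂) (bound x₂b) ≤-refl
        ... | inj₂ (inj₁ refl)          = m≢1+n+m k {1} (trans (≡-sym (flip≡ bv)) (trans at-x₁ (cong suc e₁)))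
        ... | inj₂ (inj₂ (inj₁ refl))   = 0≢1+n (trans (≡-sym (d-refl x₂)) x₂b)
        ... | inj₂ (inj₂ (inj₂ refl))   = m≢1+n+m k {1} (trans (≡-sym (flip≡ bv)) (trans e (cong suc e₁)))

    tail-beyond : Beyond P c x₁ x₂ x₃
    tail-beyond = record { hopP = hopP ; Px₃ = Px₃ ; along = along }

-- Graphs agreeing off one vertex

record IsCube {N} (G : Graph N) (M : TreeMetric N) : Set where
  open TreeMetric M
  field
    close : ∀ {x y} → Adj G x y → d x y ≤ 3
    join  : ∀ {x y} → x ≢ y → d x y ≤ 3 → Adj G x y

  adj? : ∀ x y → Dec (Adj G x y)
  adj? x y with x ≟F y
  ... | yes refl = no (irrefl G)
  ... | no ne with d x y ≤? 3
  ... | yes le = yes (join ne le)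
  ... | no gt  = no (gt ∘ close)

-- The card H − u is the cube of a tree metric restricted to the complement of a leaf u.
record CardMetric {N} (H : Graph N) (u : Fin N) : Set where
  field
    metric : TreeMetric N
    leaf-u : Structure.Leaf metric u
  open TreeMetric metric using () renaming (d to d′) public
  field
    close′ : ∀ {x y} → x ≢ u → y ≢ u → Adj H x y → d′ x y ≤ 3
    join′  : ∀ {x y} → x ≢ u → y ≢ u → x ≢ y → d′ x y ≤ 3 → Adj H x y

-- `σ` gives the two properties equally many vertices, so the inclusion `sub` is an equality. This
-- is how simplicial vertices are counted.
count-tight : ∀ {N} (σ : Permutation N N) {A B : Fin N → Set} (A? : ∀ x → Dec (A x)) (B? : ∀ x → Dec (B x)) →
  (∀ {x} → A x → B (σ ⟨$⟩ʳ x)) → (∀ {x} → B (σ ⟨$⟩ʳ x) → A x) → (∀ x → B x → A x) → ∀ x → A x → B x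
count-tight σ A? B? to of sub x Ax =
  𝟙⇒ (B? x) λ e → 1+n≢0 (trans (≡-sym (𝟙-yes (A? x) Ax)) (trans (≡-sym (tight x)) e))
  where
  tight : ∀ x → 𝟙 (B? x) ≡ 𝟙 (A? x)
  tight = sum-≤-tight (λ x → 𝟙-mono (B? x) (A? x) (sub x))
    (≤-reflexive (trans (sum-cong-≗ λ x → 𝟙-cong (A? x) (B? (σ ⟨$⟩ʳ x)) to of)
      (≡-sym (sum-permute (λ x → 𝟙 (B? x)) σ))))

sum-δ1 : ∀ {N} (v : Fin N) → sum (δ v) ≡ 1
sum-δ1 v = trans (sum-cong-≗ λ x → ≡-sym (*-identityʳ (δ v x))) (sum-δ v (λ _ → 1))

module Cube {N : ℕ} {G : Graph N} (M : TreeMetric N) (isCube : IsCube G M)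
  (far : ∀ c → Σ (Fin N) λ g → 3 < TreeMetric.d M c g) where

  open Metric M
  open Structure M
  open IsCube isCube public
  module CG = Counts G adj?

  private V = Fin N

  simplicial-metric : ∀ {c} → Simplicial G c → ∀ {y z} → d y c ≤ 3 → d z c ≤ 3 → d y z ≤ 3
  simplicial-metric {c} sim {y} {z} yc zc with y ≟F z | y ≟F c | z ≟F c
  ... | yes refl | _ | _ = ≤-trans (bound (d-refl y)) z≤n
  ... | no _ | yes refl | _ = flip≤ zc
  ... | no _ | no _ | yes refl = yc
  ... | no ne | no y≢ | no z≢ = close (sim (join (y≢ ∘ ≡-sym) (flip≤ yc)) (join (z≢ ∘ ≡-sym) (flip≤ zc)) ne)

  metric-simplicial : ∀ {c} → (∀ {y z} → d y c ≤ 3 → d z c ≤ 3 → d y z ≤ 3) → Simplicial G c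
  metric-simplicial h cy cz ne = join ne (h (flip≤ (close cy)) (flip≤ (close cz)))

  abstract
    pendant : ∀ {c} → Simplicial G c → Pendant (λ _ → ⊤) c
    pendant {c} sim = make-pendant
      (λ x y _ _ e → let (z , xz , zy) = hop x y e in z , tt , xz , zy)
      tt (λ _ _ → simplicial-metric sim) tt (proj₂ (far c))

  simplicial-leaf : ∀ {c} → Simplicial G c → Leaf c
  simplicial-leaf sim ca cb = trans (leaf _ tt ca) (≡-sym (leaf _ tt cb))
    where open Pendant (pendant sim)

module OffCard {N : ℕ} {G H : Graph N} (G? : ∀ x y → Dec (Adj G x y)) (H? : ∀ x y → Dec (Adj H x y)) {p : Fin N}
  (off⇒ : ∀ {x y} → x ≢ p → y ≢ p → Adj G x y → Adj H x y) (off⇐ : ∀ {x y} → x ≢ p → y ≢ p → Adj H x y → Adj G x y)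
  (deg-p : Counts.deg G G? p ≡ Counts.deg H H? p) where

  -- The degrees of p in G and H agree, so one inclusion of neighbourhoods already suffices.
  private
    identity : (∀ y → Adj G p y → Adj H p y) → (∀ y → Adj H p y → Adj G p y) → Iso H G
    identity G⊆H H⊆G = record { π = id ; to = to ; of = of }
      where
      to : ∀ {x y} → Adj H x y → Adj G x y
      to {x} {y} e with x ≟F p | y ≟F p
      ... | yes refl | _        = H⊆G y e
      ... | no _     | yes refl = Graph.sym G (H⊆G x (Graph.sym H e))
      ... | no x≢    | no y≢    = off⇐ x≢ y≢ e
      of : ∀ {x y} → Adj G x y → Adj H x y
      of {x} {y} e with x ≟F p | y ≟F p
      ... | yes refl | _        = G⊆H y e
      ... | no _     | yes refl = Graph.sym H (G⊆H x (Graph.sym G e))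
      ... | no x≢    | no y≢    = off⇒ x≢ y≢ e

  by-⊆ : (∀ y → Adj G p y → Adj H p y) → Iso H G
  by-⊆ sub = identity sub λ y → 𝟙⇒ (G? p y) ∘ nonzero y
    where
    tight : ∀ y → Counts.a G G? p y ≡ Counts.a H H? p y
    tight = sum-≤-tight (λ y → 𝟙-mono (G? p y) (H? p y) (sub y)) (≤-reflexive (≡-sym deg-p))
    nonzero : ∀ y → Adj H p y → Counts.a G G? p y ≢ 0
    nonzero y e z = 1+n≢0 (trans (≡-sym (𝟙-yes (H? p y) e)) (trans (≡-sym (tight y)) z))

  by-⊇ : (∀ y → Adj H p y → Adj G p y) → Iso H G
  by-⊇ sub = identity (λ y → 𝟙⇒ (H? p y) ∘ nonzero y) sub
    where
    tight : ∀ y → Counts.a H H? p y ≡ Counts.a G G? p y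
    tight = sum-≤-tight (λ y → 𝟙-mono (H? p y) (G? p y) (sub y)) (≤-reflexive deg-p)
    nonzero : ∀ y → Adj G p y → Counts.a H H? p y ≢ 0
    nonzero y e z = 1+n≢0 (trans (≡-sym (𝟙-yes (G? p y) e)) (trans (≡-sym (tight y)) z))

module Hole {N : ℕ} {G H : Graph N} (M : TreeMetric N) (isCube : IsCube G M)
  (far : ∀ c → Σ (Fin N) λ g → 3 < TreeMetric.d M c g)
  (H? : ∀ x y → Dec (Adj H x y)) (3<N : 3 < N) (p : Fin N) (agrees : AgreesOff G H p) where

  open Cube M isCube far public
  open Metric M
  open Structure M
  open AgreesOff agrees public
  open Deck deck public
  open DeckCounts adj? H? deck 3<N public
  module CH = Counts H H?

  private V = Fin N

  sym-G : ∀ {x y} → Adj G x y → Adj G y x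
  sym-G = Graph.sym G

  sym-H : ∀ {x y} → Adj H x y → Adj H y x
  sym-H = Graph.sym H

  ≢-H : ∀ {x y} → Adj H x y → x ≢ y
  ≢-H e refl = irrefl H e

  deg-p : CG.deg p ≡ CH.deg p
  deg-p = trans (deg-σ p) (cong CH.deg σ-fix)

  open OffCard {G = G} {H} adj? H? off⇒ off⇐ deg-p public

  simplicial-min : ∀ {k} → (∀ x → Simplicial G x → k ≤ CG.deg x) → ∀ x → Simplicial H x → k ≤ CH.deg x
  simplicial-min {k} min x sim = subst (λ t → k ≤ CH.deg t) (inverseʳ σ)
    (≤-trans (min _ (simplicial-σ⁻¹ (subst (Simplicial H) (≡-sym (inverseʳ σ)) sim))) (≤-reflexive (deg-σ _)))

  -- If H lacked the edge ℓp, then ℓ would be simplicial in H of degree below the minimum.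
  locate : ∀ {ℓ} → Simplicial G ℓ → (∀ x → Simplicial G x → CG.deg ℓ ≤ CG.deg x) → Adj G ℓ p → Adj H ℓ p
  locate {ℓ} sim min ℓp with H? ℓ p
  ... | yes e = e
  ... | no ¬e = ⊥-elim (<⇒≱ smaller (simplicial-min min ℓ sim-H))
    where
    ℓ≢p : ℓ ≢ p
    ℓ≢p refl = irrefl G ℓp
    ≢p : ∀ {y} → Adj H ℓ y → y ≢ p
    ≢p e refl = ¬e e
    sim-H : Simplicial H ℓ
    sim-H y z ne = off⇒ (≢p y) (≢p z) (sim (off⇐ ℓ≢p (≢p y) y) (off⇐ ℓ≢p (≢p z) z) ne)
    pointwise : ∀ y → CH.a ℓ y + δ p y ≤ CG.a ℓ y
    pointwise y with y ≟F p
    ... | yes refl = ≤-reflexive (trans (cong (_+ 1) (𝟙-no (H? ℓ p) ¬e)) (≡-sym (𝟙-yes (adj? ℓ p) ℓp)))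
    ... | no y≢ = ≤-trans (≤-reflexive (+-identityʳ _)) (𝟙-mono (H? ℓ y) (adj? ℓ y) (off⇐ ℓ≢p y≢))
    smaller : CH.deg ℓ < CG.deg ℓ
    smaller = ≤-trans (≤-reflexive (trans (+-comm 1 (CH.deg ℓ)) (trans (cong (CH.deg ℓ +_) (≡-sym (sum-δ1 p)))
      (≡-sym (∑-distrib-+ (CH.a ℓ) (δ p)))))) (sum-≤ pointwise)

  abstract
    -- The vertex of `G` matched with `u` is simplicial, hence a leaf of the tree. The metric is
    -- pulled back with the leaf included, so that the vertex set remains that of `H`.
    card-metric : ∀ {u} → Simplicial H u → CardMetric H u
    card-metric {u} sim = record
      { metric = pull-metric M (flip φ)
      ; leaf-u = λ {a} {b} ua ub → trans (≡-sym (inverseʳ φ)) (trans (cong (φ ⟨$⟩ʳ_)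
          (simplicial-leaf (simplicial-σ⁻¹ (subst (Simplicial H) (≡-sym (inverseʳ σ)) sim))
            (subst (λ t → d t (φ ⟨$⟩ˡ a) ≡ 1) φu ua) (subst (λ t → d t (φ ⟨$⟩ˡ b) ≡ 1) φu ub))) (inverseʳ φ))
      ; close′ = λ x≢ y≢ e → close (φ-of (off x≢) (off y≢)
          (subst₂ (Adj H) (≡-sym (inverseʳ φ)) (≡-sym (inverseʳ φ)) e))
      ; join′ = λ x≢ y≢ ne le → subst₂ (Adj H) (inverseʳ φ) (inverseʳ φ) (φ-to (off x≢) (off y≢)
          (join (λ q → ne (perm-inj (flip φ) q)) le)) }
      where
      u′ : V
      u′ = σ ⟨$⟩ˡ u
      open CardIso (cards u′)
      φu : φ ⟨$⟩ˡ u ≡ u′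
      φu = trans (cong (φ ⟨$⟩ˡ_) (≡-sym (trans φ-at (inverseʳ σ)))) (inverseˡ φ)
      off : ∀ {x} → x ≢ u → φ ⟨$⟩ˡ x ≢ u′
      off ne e = ne (perm-inj (flip φ) (trans e (≡-sym φu)))

  -- As a twin of `ℓ`, `p` is simplicial in `G`, hence in `H`, where it is adjacent to `ℓ`. Each
  -- further neighbour of `p` in `H` is thus a neighbour of `ℓ` in both graphs, and so of `p` in
  -- `G`.
  twin : ∀ {ℓ} → Simplicial G ℓ → (∀ x → Simplicial G x → CG.deg ℓ ≤ CG.deg x) → p ≢ ℓ →
    (∀ v → d v p ≤ 3 → d v ℓ ≤ 3) → (∀ v → d v ℓ ≤ 3 → d v p ≤ 3) → Iso H G
  twin {ℓ} sim min p≢ℓ p⊆ℓ ℓ⊆p = by-⊇ λ y py → join (≢-H py) (flip≤ (ball y py))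
    where
    ℓp : Adj G ℓ p
    ℓp = join (p≢ℓ ∘ ≡-sym) (flip≤ (p⊆ℓ p (≤-trans (bound (d-refl p)) z≤n)))
    sim-p : Simplicial H p
    sim-p = subst (Simplicial H) σ-fix (simplicial-σ (metric-simplicial λ yp zp →
      simplicial-metric sim (p⊆ℓ _ yp) (p⊆ℓ _ zp)))
    ball : ∀ y → Adj H p y → d y p ≤ 3
    ball y py with y ≟F ℓ
    ... | yes refl = close ℓp
    ... | no y≢ℓ = ℓ⊆p y (close (off⇐ (≢-H py ∘ ≡-sym) (p≢ℓ ∘ ≡-sym)
                     (sim-p py (sym-H (locate sim min ℓp)) y≢ℓ)))

  transfer : (∀ x → Simplicial H x → Simplicial G x) → ∀ x → Simplicial G x → Simplicial H x
  transfer = count-tight σ CG.simplicial? CH.simplicial? simplicial-σ simplicial-σ⁻¹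

  transfer-≤ : ∀ k → (∀ x → Simplicial H x → CH.deg x ≤ k → Simplicial G x × CG.deg x ≤ k) →
    ∀ x → Simplicial G x → CG.deg x ≤ k → Simplicial H x
  transfer-≤ k sub x sim le = proj₁ (count-tight σ
    (λ x → CG.simplicial? x ×-dec (CG.deg x ≤? k)) (λ x → CH.simplicial? x ×-dec (CH.deg x ≤? k))
    (λ { {x} (s , l) → simplicial-σ s , ≤-trans (≤-reflexive (≡-sym (deg-σ x))) l })
    (λ { {x} (s , l) → simplicial-σ⁻¹ s , ≤-trans (≤-reflexive (deg-σ x)) l })
    (λ x (s , l) → sub x s l) x (sim , le))

  -- If the neighbourhoods of p in G and H differ by exchanging t for z, then comparing the sums of
  -- the squared degrees of G and H gives deg z + 1 = deg t.
  exchange : ∀ {t z} → t ≢ p → z ≢ p → Adj G p t → ¬ Adj H p t → ¬ Adj G p z → Adj H p z →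
    (∀ {x} → x ≢ t → x ≢ z → Adj G p x → Adj H p x) → (∀ {x} → x ≢ t → x ≢ z → Adj H p x → Adj G p x) →
    CG.deg t ≡ suc (CG.deg z)
  exchange {t} {z} t≢p z≢p pt ¬pt ¬pz pz G⇒H H⇒G = *-cancelˡ-≡ _ _ 2 (+-cancelˡ-≡ (sq + 0) _ _ squares)
    where
    sq : ℕ
    sq = sum (λ x → CG.deg x * CG.deg x)
    t≢z : t ≢ z
    t≢z refl = ¬pt pz
    -- Away from `p`, a degree changes only through the adjacency with `p`.
    row : ∀ x → x ≢ p → CH.deg x + CG.a p x ≡ CG.deg x + CH.a p x
    row x x≢p = trans (cong (CH.deg x +_) (trans (CG.a-sym p x) (≡-sym (sum-δ p (CG.a x)))))
      (trans (≡-sym (∑-distrib-+ (CH.a x) _)) (trans (sum-cong-≗ pointwise) (trans (∑-distrib-+ (CG.a x) _)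
        (cong (CG.deg x +_) (trans (sum-δ p (CH.a x)) (CH.a-sym x p))))))
      where
      pointwise : ∀ y → CH.a x y + δ p y * CG.a x y ≡ CG.a x y + δ p y * CH.a x y
      pointwise y with y ≟F p
      ... | yes refl = trans (cong (CH.a x p +_) (+-identityʳ _))
                         (trans (+-comm (CH.a x p) (CG.a x p)) (cong (CG.a x p +_) (≡-sym (+-identityʳ _))))
      ... | no y≢p = cong (_+ 0) (𝟙-cong (H? x y) (adj? x y) (off⇐ x≢p y≢p) (off⇒ x≢p y≢p))
    deg-t : CG.deg t ≡ suc (CH.deg t)
    deg-t = trans (≡-sym (+-identityʳ _)) (trans (cong (CG.deg t +_) (≡-sym (𝟙-no (H? p t) ¬pt)))
      (trans (≡-sym (row t t≢p)) (trans (cong (CH.deg t +_) (𝟙-yes (adj? p t) pt)) (+-comm _ 1))))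
    deg-z : CH.deg z ≡ suc (CG.deg z)
    deg-z = trans (≡-sym (+-identityʳ _)) (trans (cong (CH.deg z +_) (≡-sym (𝟙-no (adj? p z) ¬pz)))
      (trans (row z z≢p) (trans (cong (CG.deg z +_) (𝟙-yes (H? p z) pz)) (+-comm _ 1))))
    deg-x : ∀ x → x ≢ t → x ≢ z → CH.deg x ≡ CG.deg x
    deg-x x x≢t x≢z with x ≟F p
    ... | yes refl = ≡-sym deg-p
    ... | no x≢p = +-cancelʳ-≡ (CG.a p x) _ _ (trans (row x x≢p)
            (cong (CG.deg x +_) (𝟙-cong (H? p x) (adj? p x) (H⇒G x≢t x≢z) (G⇒H x≢t x≢z))))
    same-squares : sum (λ x → CH.deg x * CH.deg x) ≡ sq
    same-squares = trans (sum-permute (λ x → CH.deg x * CH.deg x) σ)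
      (sum-cong-≗ λ x → ≡-sym (cong₂ _*_ (deg-σ x) (deg-σ x)))
    -- From `G` to `H` the degree drops by one at `t`, grows by one at `z`, and is unchanged
    -- elsewhere.
    pointwise : ∀ x → CH.deg x * CH.deg x + δ t x * (2 * CG.deg t) ≡
                      CG.deg x * CG.deg x + δ z x * (2 * CG.deg z + 1) + δ t x * 1
    pointwise x with x ≟F t | x ≟F z
    ... | yes refl | yes refl = ⊥-elim (t≢z refl)
    ... | yes refl | no _ rewrite deg-t = arith (CH.deg t) where
      arith : ∀ k → k * k + (2 * suc k + 0) ≡ suc k * suc k + 0 + 1
      arith = solve-∀
    ... | no _ | yes refl rewrite deg-z = arith (CG.deg z) where
      arith : ∀ k → suc k * suc k + 0 ≡ k * k + (2 * k + 1 + 0) + 0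
      arith = solve-∀
    ... | no nt | no nz rewrite deg-x x nt nz = arith (CG.deg x * CG.deg x) where
      arith : ∀ k → k + 0 ≡ k + 0 + 0
      arith = solve-∀
    summed : sum (λ x → CH.deg x * CH.deg x) + 2 * CG.deg t ≡ sq + (2 * CG.deg z + 1) + 1
    summed = trans (cong (_ +_) (≡-sym (sum-δ t (λ _ → 2 * CG.deg t)))) (trans (≡-sym (∑-distrib-+ (λ x → CH.deg x * CH.deg x) _))
      (trans (sum-cong-≗ pointwise) (trans (∑-distrib-+ (λ x → CG.deg x * CG.deg x + δ z x * (2 * CG.deg z + 1)) _)
        (cong₂ _+_ (trans (∑-distrib-+ (λ x → CG.deg x * CG.deg x) _) (cong (sq +_) (sum-δ z (λ _ → 2 * CG.deg z + 1))))
          (sum-δ t (λ _ → 1))))))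
    squares : sq + 0 + 2 * CG.deg t ≡ sq + 0 + 2 * suc (CG.deg z)
    squares = trans (cong (_+ 2 * CG.deg t) (trans (+-identityʳ sq) (≡-sym same-squares))) (trans summed (arith sq (CG.deg z)))
      where
      arith : ∀ s k → s + (2 * k + 1) + 1 ≡ s + 0 + 2 * suc k
      arith = solve-∀

-- Collects what the final argument uses: ℓ is a simplicial vertex of minimal degree without twins,
-- ℓ, p, q, s, t starts the path to a vertex e farthest from ℓ, and H agrees with G off p.
record Situation {N : ℕ} (G H : Graph N) (M : TreeMetric N) : Set where
  open Metric M
  field
    isCube      : IsCube G M
    far         : ∀ c → Σ (Fin N) λ g → 3 < d c g
    H?          : ∀ x y → Dec (Adj H x y)
  open IsCube isCube public
  module CG = Counts G adj?
  module CH = Counts H H?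
  field
    ℓ p q s t e : Fin N
    ℓ─p         : d ℓ p ≡ 1
    p─q         : d p q ≡ 1
    q─s         : d q s ≡ 1
    s─t         : d s t ≡ 1
    q-t         : d q t ≡ 2
    ℓ-q         : d ℓ q ≡ 2
    t-ℓ         : d t ℓ ≡ 4
    s≢p         : s ≢ p
    e-q         : 3 < d e q
    t-e         : suc (suc (d t e)) ≡ d q e
    deep        : ∀ y → d ℓ y ≤ d ℓ e
    beyond      : ∀ {v} → v ≢ ℓ → v ≢ p → d v p ≡ suc (d v q) × d v ℓ ≡ suc (d v p)
    ℓ-ball      : ∀ {v} → d v ℓ ≤ 3 → v ≡ ℓ ⊎ d v q ≤ 1
    p-ball      : ∀ {v} → d v p ≤ 3 → d v q ≤ 2
    sim-ℓ       : Simplicial G ℓ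
    sim-e       : Simplicial G e
    off⇒        : ∀ {x y} → x ≢ p → y ≢ p → Adj G x y → Adj H x y
    off⇐        : ∀ {x y} → x ≢ p → y ≢ p → Adj H x y → Adj G x y
    not-simplicial-H-p : ¬ Simplicial H p
    ℓp          : Adj H ℓ p
    by-⊆        : (∀ y → Adj G p y → Adj H p y) → Iso H G
    by-⊇        : (∀ y → Adj H p y → Adj G p y) → Iso H G
    card-metric : ∀ {u} → Simplicial H u → CardMetric H u
    another     : Σ (Fin N) λ u → u ≢ ℓ × Simplicial H u
    transfer    : (∀ x → Simplicial H x → Simplicial G x) → ∀ x → Simplicial G x → Simplicial H x
    transfer-≤  : ∀ k → (∀ x → Simplicial H x → CH.deg x ≤ k → Simplicial G x × CG.deg x ≤ k) →
      ∀ x → Simplicial G x → CG.deg x ≤ k → Simplicial H x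
    deg-p       : CG.deg p ≡ CH.deg p
    exchange    : ∀ {t z} → t ≢ p → z ≢ p → Adj G p t → ¬ Adj H p t → ¬ Adj G p z → Adj H p z →
      (∀ {x} → x ≢ t → x ≢ z → Adj G p x → Adj H p x) → (∀ {x} → x ≢ t → x ≢ z → Adj H p x → Adj G p x) →
      CG.deg t ≡ suc (CG.deg z)

  private V = Fin N

  sym-G : ∀ {x y} → Adj G x y → Adj G y x
  sym-G = Graph.sym G

  sym-H : ∀ {x y} → Adj H x y → Adj H y x
  sym-H = Graph.sym H

  ≢-H : ∀ {x y} → Adj H x y → x ≢ y
  ≢-H a refl = irrefl H a

  ℓ≢p : ℓ ≢ p
  ℓ≢p = 1≢0 ℓ─p

  p≢q : p ≢ q
  p≢q = 1≢0 p─q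

  e≢ℓ : e ≢ ℓ
  e≢ℓ z = <⇒≱ e-q (≤-trans (bound (trans (cong (λ x → d x q) z) ℓ-q)) (n≤1+n 2))

  e≢p : e ≢ p
  e≢p z = <⇒≱ e-q (≤-trans (bound (trans (cong (λ x → d x q) z) p─q)) (s≤s z≤n))

  t≢ℓ : t ≢ ℓ
  t≢ℓ z = 0≢1+n (trans (≡-sym (d-refl ℓ)) (trans (cong (λ x → d x ℓ) (≡-sym z)) t-ℓ))

  t≢p : t ≢ p
  t≢p = ≢-by (flip≡ q-t) p─q λ ()

  beyond-ℓ : ∀ {v} → v ≢ ℓ → v ≢ p → d v ℓ ≡ suc (suc (d v q))
  beyond-ℓ v≢ℓ v≢p = trans (proj₂ (beyond v≢ℓ v≢p)) (cong suc (proj₁ (beyond v≢ℓ v≢p)))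

  q-ball : ∀ {v} → d v q ≤ 2 → d v p ≤ 3
  q-ball le = via le (bound (flip≡ p─q))

  far-from-q : ∀ {v} → d v q ≤ 3 → v ≢ e
  far-from-q le z = <⇒≱ e-q (subst (λ x → d x q ≤ 3) z le)

  hub-ℓ : ∀ {b} → d b q ≤ 1 → b ≢ p → Adj H b ℓ
  hub-ℓ bq b≢p = off⇒ b≢p ℓ≢p (join b≢ℓ (via bq (bound (flip≡ ℓ-q))))
    where
    b≢ℓ : _ ≢ ℓ
    b≢ℓ z = clash ℓ-q (subst (λ x → d x q ≤ 1) z bq) ≤-refl

  -- `ℓ` and `t` are both adjacent to `b` in `H`, yet at distance 4.
  hub-not-simplicial : ∀ {b} → d b q ≤ 1 → b ≢ p → ¬ Simplicial H b
  hub-not-simplicial bq b≢p sim = clash (flip≡ t-ℓ)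
    (close (off⇐ ℓ≢p t≢p (sim (hub-ℓ bq b≢p) (off⇒ b≢p t≢p (join b≢t (via bq (bound q-t)))) (t≢ℓ ∘ ≡-sym)))) ≤-refl
    where
    b≢t : _ ≢ t
    b≢t z = clash (flip≡ q-t) (subst (λ x → d x q ≤ 1) z bq) ≤-refl

  -- N[p] lies inside the ball about every b in N[q], so the full case settles H once u is not in N[p].
  full : ∀ {u b} → ¬ (d u q ≤ 2) → d b q ≤ 1 → (∀ v → v ≢ p → v ≢ u → d v b ≤ 3 → Adj H p v) → Iso H G
  full {u} u-far bq f = by-⊆ λ v pv → f v (λ { refl → irrefl G pv })
    (λ z → u-far (subst (λ x → d x q ≤ 2) z (p-ball (flip≤ (close pv)))))
    (via {j = 2} (p-ball (flip≤ (close pv))) (flip≤ bq))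

  -- The card of `e` says nothing about an edge from `p` to `e`. Simpliciality of `e` moves this
  -- edge to the vertex before `e` on the way from `q`.
  before-e : ∀ k → d q e ≡ suc k → 3 ≤ k → Simplicial H e → Adj H p e → Σ V λ x → x ≢ e × d x q ≡ k × Adj H p x
  before-e k qe 3≤k sim pe with hop e q (flip≡ qe)
  ... | x , ex , xq = x , x≢e , xq , sym-H (sim (off⇒ e≢p x≢p (join (x≢e ∘ ≡-sym) (≤-trans (bound ex) (s≤s z≤n)))) (sym-H pe) x≢p)
    where
    x≢e : x ≢ e
    x≢e = 1≢0 ex ∘ ≡-sym
    x≢p : x ≢ p
    x≢p z = <⇒≱ (≤-trans (s≤s (s≤s z≤n)) 3≤k) (≤-trans (≤-reflexive (≡-sym xq)) (bound (trans (cong (λ y → d y q) z) p─q)))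

deg-≥4 : ∀ {N} (G : Graph N) (G? : ∀ u v → Dec (Adj G u v)) {x a b c d : Fin N} →
  a ≢ b → a ≢ c → a ≢ d → b ≢ c → b ≢ d → c ≢ d →
  Adj G x a → Adj G x b → Adj G x c → Adj G x d → 4 ≤ Counts.deg G G? x
deg-≥4 G G? {x} {a} {b} {c} {d} ab ac ad bc bd cd xa xb xc xd =
  ≤-trans (≤-reflexive (≡-sym four)) (sum-≤ pointwise)
  where
  open Counts G G? using () renaming (a to adj)
  four : sum (λ y → δ a y + (δ b y + (δ c y + δ d y))) ≡ 4
  four = trans (∑-distrib-+ (δ a) _) (cong₂ _+_ (sum-δ1 a) (trans (∑-distrib-+ (δ b) _)
    (cong₂ _+_ (sum-δ1 b) (trans (∑-distrib-+ (δ c) _) (cong₂ _+_ (sum-δ1 c) (sum-δ1 d))))))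
  pointwise : ∀ y → δ a y + (δ b y + (δ c y + δ d y)) ≤ adj x y
  pointwise y with y ≟F a | y ≟F b | y ≟F c | y ≟F d
  ... | yes refl | yes q    | _        | _        = ⊥-elim (ab q)
  ... | yes refl | no _     | yes q    | _        = ⊥-elim (ac q)
  ... | yes refl | no _     | no _     | yes q    = ⊥-elim (ad q)
  ... | yes refl | no _     | no _     | no _     = ≤-reflexive (≡-sym (𝟙-yes (G? x y) xa))
  ... | no _     | yes refl | yes q    | _        = ⊥-elim (bc q)
  ... | no _     | yes refl | no _     | yes q    = ⊥-elim (bd q)
  ... | no _     | yes refl | no _     | no _     = ≤-reflexive (≡-sym (𝟙-yes (G? x y) xb))
  ... | no _     | no _     | yes refl | yes q    = ⊥-elim (cd q)
  ... | no _     | no _     | yes refl | no _     = ≤-reflexive (≡-sym (𝟙-yes (G? x y) xc))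
  ... | no _     | no _     | no _     | yes refl = ≤-reflexive (≡-sym (𝟙-yes (G? x y) xd))
  ... | no _     | no _     | no _     | no _     = z≤n

-- Recovering the neighbourhood of `p`

module Reconstruction {N : ℕ} {G H : Graph N} {M : TreeMetric N} (S : Situation G H M) where

  open Situation S
  open Metric M
  open Structure M

  private V = Fin N

  -- In the tree behind H − u, the neighbour X₁ of ℓ is dominated by all neighbours of ℓ that are not
  -- its twins; this pins down the neighbourhood of p.
  module Card {u} (sim-ℓ-H : Simplicial H ℓ) (sim-u : Simplicial H u) (u≢ℓ : u ≢ ℓ) (u≢t : u ≢ t) where

    open CardMetric (card-metric sim-u) public
    module M′ = Metric metric
    module S′ = Structure metric

    u≢p : u ≢ p
    u≢p z = not-simplicial-H-p (subst (Simplicial H) z sim-u)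

    abstract
      pend′ : M′.Pendant (_≢ u) ℓ
      pend′ = S′.make-pendant (S′.hop-off-leaf leaf-u) (u≢ℓ ∘ ≡-sym) sim (u≢t ∘ ≡-sym) (≰⇒> λ le →
          clash (flip≡ t-ℓ) (close (off⇐ ℓ≢p t≢p (join′ (u≢ℓ ∘ ≡-sym) (u≢t ∘ ≡-sym) (t≢ℓ ∘ ≡-sym) le))) ≤-refl)
        where
        sim : ∀ {y z} → y ≢ u → z ≢ u → d′ y ℓ ≤ 3 → d′ z ℓ ≤ 3 → d′ y z ≤ 3
        sim {y} {z} y≢ z≢ yℓ zℓ with y ≟F z | y ≟F ℓ | z ≟F ℓ
        ... | yes refl | _ | _ = ≤-trans (M′.bound (M′.d-refl y)) z≤n
        ... | no _ | yes refl | _ = M′.flip≤ zℓ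
        ... | no _ | no _ | yes refl = yℓ
        ... | no ne | no yn | no zn = close′ y≢ z≢ (sim-ℓ-H
                (sym-H (join′ y≢ (u≢ℓ ∘ ≡-sym) yn yℓ)) (sym-H (join′ z≢ (u≢ℓ ∘ ≡-sym) zn zℓ)) ne)

    open M′.Pendant pend′ public using (dominated) renaming (x₁ to X₁; Px₁ to X₁≢u; c─x₁ to ℓ─X₁)

    ℓX₁ : Adj H ℓ X₁
    ℓX₁ = join′ (u≢ℓ ∘ ≡-sym) X₁≢u (M′.1≢0 ℓ─X₁) (≤-trans (M′.bound ℓ─X₁) (s≤s z≤n))

    -- `Full` bounds the neighbourhood of `p` in `H` from below by a ball, `Confined` from above by
    -- an intersection of balls. As the degree of `p` is known, an inclusion in either direction can
    -- settle `H`.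
    Full : Set
    Full = Σ V λ b → d b q ≤ 1 × b ≢ p × (∀ v → v ≢ p → v ≢ u → d v b ≤ 3 → Adj H p v)

    Confined : Set
    Confined = ∀ v → v ≢ u → Adj H p v → ∀ b → d b q ≤ 1 → b ≢ p → d v b ≤ 3

    hub≢u : ∀ {b} → d b q ≤ 1 → b ≢ p → b ≢ u
    hub≢u bq b≢p z = hub-not-simplicial bq b≢p (subst (Simplicial H) (≡-sym z) sim-u)

    -- Every such `b` is adjacent to `ℓ`, so `dominated` applies to it. Its second alternative fails
    -- at `t`, which is within 3 of `b` but not of `ℓ`; the first confines the neighbours of `X₁`,
    -- that is of `p`.
    confined-by-p : X₁ ≡ p → Confined
    confined-by-p z v v≢u pv b bq b≢p with dominated b (hub≢u bq b≢p)
                                               (close′ (hub≢u bq b≢p) (u≢ℓ ∘ ≡-sym) (hub-ℓ bq b≢p))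
    ... | inj₁ dom = to-G (dom v v≢u (subst (λ x → d′ v x ≤ 3) (≡-sym z) (close′ v≢u (u≢p ∘ ≡-sym) (sym-H pv))))
      where
      to-G : d′ v b ≤ 3 → d v b ≤ 3
      to-G le with v ≟F b
      ... | yes refl = ≤-trans (bound (d-refl v)) z≤n
      ... | no ne = close (off⇐ (≢-H pv ∘ ≡-sym) b≢p (join′ v≢u (hub≢u bq b≢p) ne le))
    ... | inj₂ dom = ⊥-elim (clash t-ℓ (close (off⇐ t≢p ℓ≢p (join′ (u≢t ∘ ≡-sym) (u≢ℓ ∘ ≡-sym) t≢ℓ
                       (dom t (u≢t ∘ ≡-sym) (close′ (u≢t ∘ ≡-sym) (hub≢u bq b≢p)
                         (off⇒ t≢p b≢p (join t≢b (via {j = 2} (bound (flip≡ q-t)) (flip≤ bq))))))))) ≤-refl)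
      where
      t≢b : t ≢ b
      t≢b z = clash (flip≡ q-t) (subst (λ x → d x q ≤ 1) (≡-sym z) bq) ≤-refl

    Small : Set
    Small = ∀ v → v ≢ u → Adj H p v → d v q ≤ 2

    -- Now `dominated` is applied to `p` itself. Up to `u`, either `p` is adjacent to all neighbours
    -- of `X₁`, which lies within 1 of `q`, or all neighbours of `p` lie in the closed neighbourhood
    -- of `ℓ`.
    otherwise : X₁ ≢ p → Full ⊎ Small
    otherwise X₁≢p with ℓ-ball (close (off⇐ X₁≢p ℓ≢p (sym-H ℓX₁)))
    ... | inj₁ z = ⊥-elim (M′.1≢0 ℓ─X₁ (≡-sym z))
    ... | inj₂ Xq with dominated p (u≢p ∘ ≡-sym) (close′ (u≢p ∘ ≡-sym) (u≢ℓ ∘ ≡-sym) (sym-H ℓp))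
    ... | inj₁ dom = inj₁ (X₁ , Xq , X₁≢p , λ v v≢p v≢u vX → sym-H (join′ v≢u (u≢p ∘ ≡-sym) v≢p (dom v v≢u (to-H v≢p v≢u vX))))
      where
      to-H : ∀ {v} → v ≢ p → v ≢ u → d v X₁ ≤ 3 → d′ v X₁ ≤ 3
      to-H {v} v≢p v≢u le with v ≟F X₁
      ... | yes refl = ≤-trans (M′.bound (M′.d-refl v)) z≤n
      ... | no ne = close′ v≢u X₁≢u (off⇒ v≢p X₁≢p (join ne le))
    ... | inj₂ dom = inj₂ small
      where
      small : Small
      small v v≢u pv with v ≟F ℓ
      ... | yes v≡ℓ = bound (trans (cong (λ x → d x q) v≡ℓ) ℓ-q)
      ... | no v≢ℓ with ℓ-ball (close (off⇐ (≢-H pv ∘ ≡-sym) ℓ≢p (join′ v≢u (u≢ℓ ∘ ≡-sym) v≢ℓ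
                          (dom v v≢u (close′ v≢u (u≢p ∘ ≡-sym) (sym-H pv))))))
      ... | inj₁ z = ⊥-elim (v≢ℓ z)
      ... | inj₂ vq = ≤-trans vq (s≤s z≤n)

    small⇒confined : Small → Confined
    small⇒confined small v v≢u pv b bq b≢p = via (small v v≢u pv) (flip≤ bq)

    dichotomy : Full ⊎ Confined
    dichotomy with X₁ ≟F p
    ... | yes z = inj₂ (confined-by-p z)
    ... | no z  = map₂ small⇒confined (otherwise z)

  module Branching {b₃} (q─b₃ : d q b₃ ≡ 1) (b₃≢p : b₃ ≢ p) (b₃≢s : b₃ ≢ s) where

    -- `q` has at least two branches besides that of `p`, so one of them is not that of `a`.
    avoiding : ∀ a → Σ V λ b → d q b ≡ 1 × b ≢ p × b ≢ a
    avoiding a with s ≟F a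
    ... | yes s≡a  = b₃ , q─b₃ , b₃≢p , (λ z → b₃≢s (trans z (≡-sym s≡a)))
    ... | no s≢a   = s , q─s , s≢p , s≢a

    -- The critical pair is `p` and another neighbour `z` of `x` in `G`. If they were not adjacent,
    -- `x` would be adjacent in `H` to two vertices too far apart: `ℓ` and `z` if `x` is within 1 of
    -- `q`, and otherwise `z` and a neighbour `b` of `q` off the branch of `x`, unless `z` lies
    -- beyond `b` and hence too far from `x`.
    simplicial-⊆ : ∀ x → Simplicial H x → Simplicial G x
    simplicial-⊆ x sim = clique
      where
      x≢p : x ≢ p
      x≢p z = not-simplicial-H-p (subst (Simplicial H) z sim)

      with-p : ∀ {z} → Adj G x p → Adj G x z → z ≢ p → Adj G p z
      with-p {z} xp xz z≢p with x ≟F ℓ | d z q ≤? 2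
      ... | yes x≡ℓ | _      = sim-ℓ (subst (λ y → Adj G y p) x≡ℓ xp) (subst (λ y → Adj G y z) x≡ℓ xz) (z≢p ∘ ≡-sym)
      ... | no _     | yes le = join (z≢p ∘ ≡-sym) (flip≤ (q-ball le))
      ... | no x≢ℓ   | no gt  = ⊥-elim (by-dist (d x q) refl (p-ball (close xp)))
        where
        z-q : 3 ≤ d z q
        z-q = ≰⇒> gt
        z≢ℓ : z ≢ ℓ
        z≢ℓ y = gt (bound (trans (cong (λ x → d x q) y) ℓ-q))
        hub : d x q ≤ 1 → ⊥
        hub xq with ℓ-ball (flip≤ (close (off⇐ ℓ≢p z≢p (sim (hub-ℓ xq x≢p) (off⇒ x≢p z≢p xz) (z≢ℓ ∘ ≡-sym)))))
        ... | inj₁ e₁ = z≢ℓ e₁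
        ... | inj₂ zq = gt (≤-trans zq (s≤s z≤n))
        by-dist : ∀ k → d x q ≡ k → k ≤ 2 → ⊥
        by-dist zero xq _ = hub (≤-trans (bound xq) z≤n)
        by-dist (suc zero) xq _ = hub (bound xq)
        by-dist (suc (suc zero)) xq _ with hop q x (flip≡ xq)
        ... | a , qa , ax with avoiding a
        ... | b , qb , b≢p , b≢a = far-side (step z qb)
          where
          b≢z : b ≢ z
          b≢z y = gt (subst (λ x → d x q ≤ 2) y (≤-trans (bound (flip≡ qb)) (s≤s z≤n)))
          x-b : d x b ≡ 3
          x-b = trans (away x qa qb (b≢a ∘ ≡-sym) (trans xq (cong suc (≡-sym (flip≡ ax))))) (cong suc xq)
          x≢b : x ≢ b
          x≢b = ≢-by xq (flip≡ qb) λ ()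
          zb : d z b ≤ 3
          zb = flip≤ (close (off⇐ b≢p z≢p (sim (off⇒ x≢p b≢p (join x≢b (bound x-b))) (off⇒ x≢p z≢p xz) b≢z)))
          q≢x : q ≢ x
          q≢x y = 0≢1+n (trans (≡-sym (d-refl q)) (trans (cong (λ x → d x q) y) xq))
          far-side : d z b ≡ suc (d z q) ⊎ d z q ≡ suc (d z b) → ⊥
          far-side (inj₁ e₁) = <⇒≱ (s≤s z-q) (≤-trans (≤-reflexive (≡-sym e₁)) zb)
          far-side (inj₂ e₁) = <⇒≱ (s≤s z-q) (≤-trans (≤-trans (n≤1+n _) (≤-reflexive (≡-sym
            (trans (away z (flip≡ qa) ax q≢x z-a) (cong suc z-a))))) (flip≤ (close xz)))
            where
            z-a : d z a ≡ suc (d z q)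
            z-a = away z qb qa b≢a e₁
        by-dist (suc (suc (suc _))) _ (s≤s (s≤s ()))

      clique : Simplicial G x
      clique {y} {z} xy xz y≢z with y ≟F p | z ≟F p
      ... | no y≢p | no z≢p = off⇐ y≢p z≢p (sim (off⇒ x≢p y≢p xy) (off⇒ x≢p z≢p xz) y≢z)
      ... | yes y≡p | yes z≡p = ⊥-elim (y≢z (trans y≡p (≡-sym z≡p)))
      ... | yes y≡p | no z≢p = subst (λ x → Adj G x z) (≡-sym y≡p) (with-p (subst (Adj G x) y≡p xy) xz z≢p)
      ... | no y≢p | yes z≡p = subst (Adj G y) (≡-sym z≡p) (sym-G (with-p (subst (Adj G x) z≡p xz) xy y≢p))

    simplicial-same : ∀ x → Simplicial G x → Simplicial H x
    simplicial-same = transfer simplicial-⊆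

    sim-ℓ-H = simplicial-same ℓ sim-ℓ
    sim-e-H = simplicial-same e sim-e

    open Card sim-ℓ-H sim-e-H e≢ℓ (far-from-q (≤-trans (bound (flip≡ q-t)) (n≤1+n 2)) ∘ ≡-sym)

    -- The choice of `q` as `b` bounds the distance by 3. A vertex at distance exactly 3 is at
    -- distance 4 from a neighbour of `q` off its branch, and the third neighbour `b₃` guarantees
    -- one other than `p`.
    in-ball : Confined → ∀ v → v ≢ e → Adj H p v → d v q ≤ 2
    in-ball conf v v≢e pv = by-dist (d v q) refl (conf v v≢e pv q (≤-trans (bound (d-refl q)) z≤n) (p≢q ∘ ≡-sym))
      where
      by-dist : ∀ k → d v q ≡ k → k ≤ 3 → k ≤ 2
      by-dist zero _ _ = z≤n
      by-dist (suc zero) _ _ = s≤s z≤n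
      by-dist (suc (suc zero)) _ _ = ≤-refl
      by-dist (suc (suc (suc zero))) vq _ with hop q v (flip≡ vq)
      ... | a , qa , av with avoiding a
      ... | b , qb , b≢p , b≢a = ⊥-elim (clash
              (trans (away v qa qb (b≢a ∘ ≡-sym) (trans vq (cong suc (≡-sym (flip≡ av))))) (cong suc vq))
              (conf v v≢e pv b (bound (flip≡ qb)) b≢p) ≤-refl)
      by-dist (suc (suc (suc (suc _)))) _ (s≤s (s≤s (s≤s ())))

    e-not-adjacent : Confined → ¬ Adj H p e
    e-not-adjacent conf pe = go (d q e) refl (≤-trans e-q (≤-reflexive (d-sym e q)))
      where
      go : ∀ k → d q e ≡ k → 3 < k → ⊥
      go (suc k) qe (s≤s 3≤k) with before-e k qe 3≤k sim-e-H pe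
      ... | x , x≢e , xq , px = <⇒≱ 3≤k (≤-trans (≤-reflexive (≡-sym xq)) (in-ball conf x x≢e px))

    reconstruct : Iso H G
    reconstruct with dichotomy
    ... | inj₁ (b , bq , b≢p , f) = full (λ le → <⇒≱ e-q (≤-trans le (n≤1+n 2))) bq f
    ... | inj₂ conf = by-⊇ λ y py → join (≢-H py) (flip≤ (q-ball (in-ball conf y
            (λ z → e-not-adjacent conf (subst (Adj H p) z py)) py)))

  -- Here the tree ends in the path ℓ, p, q, s.
  module Thin (q-neighbours : ∀ {b} → d q b ≡ 1 → b ≡ p ⊎ b ≡ s) where

    ℓ≢q : ℓ ≢ q
    ℓ≢q z = 0≢1+n (trans (≡-sym (d-refl q)) (trans (cong (λ x → d x q) (≡-sym z)) ℓ-q))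

    p-s : d p s ≡ 2
    p-s = dist2 (flip≡ p─q) q─s (s≢p ∘ ≡-sym)

    within-1 : ∀ {v} → d v q ≤ 1 → v ≡ q ⊎ v ≡ p ⊎ v ≡ s
    within-1 {v} le = go (d v q) refl le
      where
      go : ∀ k → d v q ≡ k → k ≤ 1 → v ≡ q ⊎ v ≡ p ⊎ v ≡ s
      go zero vq _ = inj₁ (d-zero vq)
      go (suc zero) vq _ = inj₂ (q-neighbours (flip≡ vq))
      go (suc (suc _)) _ (s≤s ())

    ℓ-ball₄ : ∀ {v} → d v ℓ ≤ 3 → v ≡ ℓ ⊎ v ≡ p ⊎ v ≡ q ⊎ v ≡ s
    ℓ-ball₄ le with ℓ-ball le
    ... | inj₁ z = inj₁ z
    ... | inj₂ vq with within-1 vq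
    ... | inj₁ z = inj₂ (inj₂ (inj₁ z))
    ... | inj₂ (inj₁ z) = inj₂ (inj₁ z)
    ... | inj₂ (inj₂ z) = inj₂ (inj₂ (inj₂ z))

    abstract
      beyond-s : Beyond (λ _ → ⊤) ℓ p q s
      beyond-s = record
        { hopP = λ x y _ _ xy → let (z , xz , zy) = hop x y xy in z , tt , xz , zy
        ; Px₃ = tt ; along = λ {v} _ v≢ℓ v≢p v≢q → past-q v≢ℓ v≢p v≢q , beyond v≢ℓ v≢p }
        where
        past-q : ∀ {v} → v ≢ ℓ → v ≢ p → v ≢ q → d v q ≡ suc (d v s)
        past-q {v} v≢ℓ v≢p v≢q with step v q─s
        ... | inj₂ z = z
        ... | inj₁ z = ⊥-elim (go (d v q) refl)
          where
          go : ∀ k → d v q ≡ k → ⊥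
          go zero vq = v≢q (d-zero vq)
          go (suc k) vq with hop q v (flip≡ vq)
          ... | b , qb , bv with q-neighbours qb
          ... | inj₁ refl = m≢1+n+m k {1} (trans (≡-sym (flip≡ bv)) (trans (proj₁ (beyond v≢ℓ v≢p)) (cong suc vq)))
          ... | inj₂ refl = m≢1+n+m k {1} (trans (≡-sym (flip≡ bv)) (trans z (cong suc vq)))

    open Beyond beyond-s hiding (hopP; Px₃) public

    along-ℓ : ∀ {v} → v ≢ ℓ → v ≢ p → v ≢ q → d v ℓ ≡ 3 + D v
    along-ℓ a b c = let (x , y , z) = along tt a b c in trans z (cong suc (trans y (cong suc x)))

    D-q : ∀ {v} → v ≢ ℓ → v ≢ p → v ≢ q → d v q ≡ suc (D v)
    D-q a b c = proj₁ (along tt a b c)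

    D-p : ∀ {v} → v ≢ ℓ → v ≢ p → v ≢ q → d v p ≡ suc (suc (D v))
    D-p a b c = let (x , y , z) = along tt a b c in trans y (cong suc x)

    ℓ-s : d ℓ s ≡ 3
    ℓ-s = flip≡ (trans (along-ℓ s≢ℓ s≢p (1≢0 q─s ∘ ≡-sym)) (cong (3 +_) (d-refl s)))
      where
      s≢ℓ : s ≢ ℓ
      s≢ℓ z = 0≢1+n (suc-injective (trans (≡-sym q─s) (trans (cong (d q) z) (flip≡ ℓ-q))))

    deep-D : ∀ {v} → 2 < d v q → 3 + D v ≡ d v ℓ
    deep-D {v} lt = ≡-sym (along-ℓ (λ z → <⇒≱ lt (bound (trans (cong (λ x → d x q) z) ℓ-q)))
      (λ z → <⇒≱ lt (≤-trans (bound (trans (cong (λ x → d x q) z) p─q)) (s≤s z≤n)))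
      (λ z → <⇒≱ lt (≤-trans (bound (trans (cong (λ x → d x q) z) (d-refl q))) z≤n)))

    -- As `s` is not dominating, some vertex is at distance more than 3 from it. This is not `ℓ`,
    -- whose depth is exactly 3, and `e` is at least as deep.
    e-D : 3 < D e
    e-D with far s
    ... | g , lt = ≤-trans g-D (+-cancelˡ-≤ 3 _ _ (≤-trans (≤-reflexive (deep-D g-q))
                     (≤-trans (flip≤ (deep g)) (≤-trans (bound (d-sym ℓ e)) (≤-reflexive (≡-sym (deep-D (≤-trans (n≤1+n 3) e-q))))))))
      where
      g-D : 3 < D g
      g-D = ≤-trans lt (bound (d-sym s g))
      g-q : 2 < d g q
      g-q = s≤s⁻¹ (≤-trans g-D (≤-trans (d-tri g q s) (≤-trans (+-monoʳ-≤ (d g q) (bound q─s)) (≤-reflexive (+-comm (d g q) 1)))))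

    e≢q : e ≢ q
    e≢q z = <⇒≱ e-q (≤-trans (bound (trans (cong (λ x → d x q) z) (d-refl q))) z≤n)

    -- `z` and `v` continue the path from `s` through `t` towards `e`. At depth 3, `v` is adjacent
    -- to `s` but not to `q`, which tells the two apart.
    record Path₄ : Set where
      field
        z v    : V
        t─z    : d t z ≡ 1
        z─v    : d z v ≡ 1
        D-z    : D z ≡ 2
        D-v    : D v ≡ 3
        v≢e    : v ≢ e

    D-t : D t ≡ 1
    D-t = flip≡ s─t

    e-t : D e ≡ suc (d t e)
    e-t = suc-injective (trans (≡-sym (D-q e≢ℓ e≢p e≢q)) (trans (d-sym e q) (≡-sym t-e)))

    abstract
      path₄ : Path₄
      path₄ = go _ refl (s≤s⁻¹ (≤-trans e-D (≤-reflexive e-t)))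
        where
        go : ∀ k → d t e ≡ k → 2 < k → Path₄
        go zero _ ()
        go (suc zero) _ (s≤s ())
        go (suc (suc zero)) _ (s≤s (s≤s ()))
        go (suc (suc (suc k))) te _ with hop t e te
        ... | z , tz , ze with hop z e ze
        ... | v , zv , ve = record
          { z = z ; v = v ; t─z = tz ; z─v = zv ; D-z = Dz ; D-v = trans (d-sym v s)
              (trans (away s (flip≡ tz) zv (≢-by te ve λ ()) (trans (flip≡ Dz) (cong suc (≡-sym s─t)))) (cong suc (flip≡ Dz)))
          ; v≢e = λ x → 0≢1+n (trans (≡-sym (d-refl e)) (trans (cong (λ y → d y e) (≡-sym x)) ve)) }
          where
          s≢z : s ≢ z
          s≢z x = m≢1+n+m (suc (suc k)) {1} (trans (≡-sym ze) (trans (cong (λ y → d y e) (≡-sym x))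
                    (trans (d-sym s e) (trans e-t (cong suc te)))))
          Dz : D z ≡ 2
          Dz = flip≡ (dist2 (flip≡ s─t) tz s≢z)

    open Path₄ path₄ public

    D-ℓ : D ℓ ≡ 3
    D-ℓ = ℓ-s

    t≢q : t ≢ q
    t≢q x = 0≢1+n (trans (≡-sym (d-refl q)) (trans (cong (d q) (≡-sym x)) q-t))

    z≢p : z ≢ p
    z≢p = ≢-by (flip≡ t─z) (flip≡ (trans (D-p t≢ℓ t≢p t≢q) (cong (2 +_) D-t))) λ ()

    z≢ℓ : z ≢ ℓ
    z≢ℓ = ≢-by D-z D-ℓ λ ()

    z≢q : z ≢ q
    z≢q = ≢-by D-z q─s λ ()

    v≢p : v ≢ p
    v≢p = ≢-by D-v p-s λ ()

    v≢ℓ : v ≢ ℓ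
    v≢ℓ = ≢-by (flip≡ z─v) (flip≡ (trans (along-ℓ z≢ℓ z≢p z≢q) (cong (3 +_) D-z))) λ ()

    v≢q : v ≢ q
    v≢q = ≢-by D-v q─s λ ()

    z-q : d z q ≡ 3
    z-q = trans (D-q z≢ℓ z≢p z≢q) (cong suc D-z)

    v-q : d v q ≡ 4
    v-q = trans (D-q v≢ℓ v≢p v≢q) (cong suc D-v)

    join-H : ∀ {x y} → x ≢ p → y ≢ p → x ≢ y → d x y ≤ 3 → Adj H x y
    join-H x≢p y≢p x≢y le = off⇒ x≢p y≢p (join x≢y le)

    deg-ℓ : CG.deg ℓ ≤ 3
    deg-ℓ = ≤-trans (sum-≤ pointwise) (≤-reflexive (trans (∑-distrib-+ (δ p) _) (cong₂ _+_ (sum-δ1 p)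
        (trans (∑-distrib-+ (δ q) (δ s)) (cong₂ _+_ (sum-δ1 q) (sum-δ1 s))))))
      where
      pointwise : ∀ y → CG.a ℓ y ≤ δ p y + (δ q y + δ s y)
      pointwise y with adj? ℓ y
      ... | no _ = z≤n
      ... | yes ℓy with ℓ-ball₄ (flip≤ (close ℓy))
      ... | inj₁ x               = ⊥-elim (irrefl G (subst (Adj G ℓ) x ℓy))
      ... | inj₂ (inj₁ x)        = ≤-trans (≤-reflexive (≡-sym (𝟙-yes (y ≟F p) x))) (m≤m+n _ _)
      ... | inj₂ (inj₂ (inj₁ x)) = ≤-trans (≤-reflexive (≡-sym (𝟙-yes (y ≟F q) x))) (≤-trans (m≤m+n _ _) (m≤n+m _ (δ p y)))
      ... | inj₂ (inj₂ (inj₂ x)) = ≤-trans (≤-reflexive (≡-sym (𝟙-yes (y ≟F s) x))) (≤-trans (m≤n+m _ (δ q y)) (m≤n+m _ (δ p y)))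

    -- For each position of `x`, four neighbours are found among `ℓ`, `q`, `s`, `t`, `z`, `v`. The
    -- bound 4 separates these vertices from `ℓ`, whose degree in `G` is at most 3.
    deg-near : ∀ {x} → x ≢ ℓ → x ≢ p → d x q ≤ 2 → 4 ≤ CH.deg x
    deg-near {x} x≢ℓ x≢p xq with x ≟F q | x ≟F s | x ≟F t
    ... | yes refl | _ | _ = deg-≥4 H H?
            (≢-by D-ℓ (d-refl s) λ ()) (≢-by D-ℓ D-t λ ()) (≢-by D-ℓ D-z λ ())
            (≢-by (d-refl s) D-t λ ()) (≢-by (d-refl s) D-z λ ()) (≢-by D-t D-z λ ())
            (join-H x≢p ℓ≢p x≢ℓ (≤-trans (bound (flip≡ ℓ-q)) (n≤1+n 2))) (join-H x≢p s≢p (1≢0 q─s) (≤-trans (bound q─s) (s≤s z≤n)))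
            (join-H x≢p t≢p (t≢q ∘ ≡-sym) (≤-trans (bound q-t) (n≤1+n 2))) (join-H x≢p z≢p (z≢q ∘ ≡-sym) (bound (flip≡ z-q)))
    ... | no x≢q | yes refl | _ = deg-≥4 H H?
            (ℓ≢q) (≢-by D-ℓ D-t λ ()) (≢-by D-ℓ D-z λ ())
            (t≢q ∘ ≡-sym) (z≢q ∘ ≡-sym) (≢-by D-t D-z λ ())
            (join-H x≢p ℓ≢p x≢ℓ (bound (flip≡ D-ℓ))) (join-H x≢p (p≢q ∘ ≡-sym) x≢q (≤-trans (bound (flip≡ q─s)) (s≤s z≤n)))
            (join-H x≢p t≢p (1≢0 s─t) (≤-trans (bound s─t) (s≤s z≤n))) (join-H x≢p z≢p (≢-by (d-refl s) D-z λ ()) (≤-trans (bound (flip≡ D-z)) (n≤1+n 2)))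
    ... | no x≢q | no x≢s | yes refl = deg-≥4 H H?
            (1≢0 q─s) (z≢q ∘ ≡-sym) (v≢q ∘ ≡-sym) (≢-by (d-refl s) D-z λ ()) (≢-by (d-refl s) D-v λ ()) (1≢0 z─v)
            (join-H x≢p (p≢q ∘ ≡-sym) x≢q (≤-trans (bound (flip≡ q-t)) (n≤1+n 2))) (join-H x≢p s≢p x≢s (≤-trans (bound (flip≡ s─t)) (s≤s z≤n)))
            (join-H x≢p z≢p (1≢0 t─z) (≤-trans (bound t─z) (s≤s z≤n)))
            (join-H x≢p v≢p (≢-by D-t D-v λ ()) (≤-trans (via (bound t─z) (bound z─v)) (n≤1+n 2)))
    ... | no x≢q | no x≢s | no x≢t = deg-≥4 H H?
            (1≢0 q─s) (t≢q ∘ ≡-sym) (z≢q ∘ ≡-sym) (1≢0 s─t) (≢-by (d-refl s) D-z λ ()) (1≢0 t─z)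
            (join-H x≢p (p≢q ∘ ≡-sym) x≢q (≤-trans xq (n≤1+n 2))) (join-H x≢p s≢p x≢s (≤-trans xs (s≤s z≤n)))
            (join-H x≢p t≢p x≢t (≤-trans (via xs (bound s─t)) (n≤1+n 2)))
            (join-H x≢p z≢p (λ y → clash D-z (subst (λ x → d x s ≤ 1) y xs) ≤-refl) (via xs (bound (flip≡ D-z))))
      where
      xs : D x ≤ 1
      xs = s≤s⁻¹ (≤-trans (≤-reflexive (≡-sym (D-q x≢ℓ x≢p x≢q))) xq)

    -- Only simplicial vertices of degree at most 3 are counted. By `deg-near`, such a vertex of `H`
    -- other than `ℓ` is not adjacent to `p` in `G`, so its neighbourhood in `G` is contained in
    -- that in `H`.
    sim-ℓ-H : Simplicial H ℓ
    sim-ℓ-H = transfer-≤ 3 sub ℓ sim-ℓ deg-ℓ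
      where
      sub : ∀ x → Simplicial H x → CH.deg x ≤ 3 → Simplicial G x × CG.deg x ≤ 3
      sub x sim le with x ≟F ℓ | adj? x p
      ... | yes x≡ℓ | _ = subst (λ y → Simplicial G y × CG.deg y ≤ 3) (≡-sym x≡ℓ) (sim-ℓ , deg-ℓ)
      ... | no x≢ℓ | yes xp = ⊥-elim (<⇒≱ (deg-near x≢ℓ x≢p (p-ball (close xp))) le)
        where
        x≢p : x ≢ p
        x≢p y = not-simplicial-H-p (subst (Simplicial H) y sim)
      ... | no x≢ℓ | no ¬xp = (λ xy xz ne → off⇐ (≢p xy) (≢p xz) (sim (to-H xy) (to-H xz) ne))
                            , ≤-trans (sum-≤ λ y → 𝟙-mono (adj? x y) (H? x y) to-H) le
        where
        x≢p : x ≢ p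
        x≢p y = not-simplicial-H-p (subst (Simplicial H) y sim)
        ≢p : ∀ {y} → Adj G x y → y ≢ p
        ≢p xy y = ¬xp (subst (Adj G x) y xy)
        to-H : ∀ {y} → Adj G x y → Adj H x y
        to-H xy = off⇒ x≢p (≢p xy) xy

    near-q-and-v : ∀ {x} → x ≢ p → x ≢ q → x ≢ v → d x q ≤ 3 → d x v ≤ 3 → ¬ Simplicial H x
    near-q-and-v x≢p x≢q x≢v xq xv sim = clash (flip≡ v-q) (close (off⇐ (p≢q ∘ ≡-sym) v≢p
      (sim (join-H x≢p (p≢q ∘ ≡-sym) x≢q xq) (join-H x≢p v≢p x≢v xv) (v≢q ∘ ≡-sym)))) ≤-refl

    -- As long as `p` and `e` may be adjacent in `H`, `e` is not known to be simplicial there; the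
    -- card of another simplicial vertex `u` is used instead.
    e-apart : Iso H G ⊎ ¬ Adj H p e
    e-apart with another | H? p e
    ... | _ | no ¬pe = inj₂ ¬pe
    ... | u , u≢ℓ , sim-u | yes pe = go dichotomy
      where
      u≢t : u ≢ t
      u≢t y = near-q-and-v t≢p t≢q (≢-by D-t D-v λ ()) (≤-trans (bound (flip≡ q-t)) (n≤1+n 2))
        (≤-trans (via (bound t─z) (bound z─v)) (n≤1+n 2)) (subst (Simplicial H) y sim-u)
      z≢u : z ≢ u
      z≢u y = near-q-and-v z≢p z≢q (1≢0 z─v) (bound z-q) (≤-trans (bound z─v) (s≤s z≤n)) (subst (Simplicial H) (≡-sym y) sim-u)
      open Card sim-ℓ-H sim-u u≢ℓ u≢t
      q-q : d q q ≤ 1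
      q-q = ≤-trans (bound (d-refl q)) z≤n
      e-e : d q e ≡ suc (D e)
      e-e = flip≡ (D-q e≢ℓ e≢p e≢q)
      go : Full ⊎ Confined → Iso H G ⊎ ¬ Adj H p e
      go (inj₂ conf) with e ≟F u
      ... | no e≢u = ⊥-elim (<⇒≱ e-q (conf e e≢u pe q q-q (p≢q ∘ ≡-sym)))
      ... | yes e≡u with before-e (D e) e-e (≤-trans (n≤1+n 3) e-D) (subst (Simplicial H) (≡-sym e≡u) sim-u) pe
      ... | x , x≢e , xq , px = ⊥-elim (<⇒≱ e-D (≤-trans (≤-reflexive (≡-sym xq))
              (conf x (λ y → x≢e (trans y (≡-sym e≡u))) px q q-q (p≢q ∘ ≡-sym))))
      go (inj₁ (b , bq , b≢p , f)) with d u q ≤? 2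
      ... | no u-far = inj₁ (full u-far bq f)
      -- In `H`, `p` is adjacent to its neighbours in `G` other than `u`, and also to `z` and `e`:
      -- one more than its degree allows.
      ... | yes uq = ⊥-elim (1+n≰n (+-cancelˡ-≤ (CH.deg p) _ _ count))
        where
        u≢e : u ≢ e
        u≢e = far-from-q (≤-trans uq (n≤1+n 2))
        z-b : d z b ≤ 3
        z-b with within-1 bq
        ... | inj₁ y        = bound (trans (cong (d z) y) z-q)
        ... | inj₂ (inj₁ y) = ⊥-elim (b≢p y)
        ... | inj₂ (inj₂ y) = ≤-trans (bound (trans (cong (d z) y) D-z)) (n≤1+n 2)
        pointwise : ∀ y → CG.a p y + (δ z y + δ e y) ≤ CH.a p y + δ u y
        pointwise y with y ≟F z | y ≟F e | y ≟F u
        ... | yes y≡z | yes y≡e | _ = ⊥-elim (far-from-q (bound z-q) (trans (≡-sym y≡z) y≡e))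
        ... | yes y≡z | no _ | yes y≡u = ⊥-elim (z≢u (trans (≡-sym y≡z) y≡u))
        ... | yes refl | no _ | no _ = ≤-reflexive (trans (cong (_+ 1) (𝟙-no (adj? p y) λ py →
                clash z-q (p-ball (flip≤ (close py))) ≤-refl))
                (≡-sym (trans (+-identityʳ (CH.a p y)) (𝟙-yes (H? p y) (f y z≢p z≢u z-b)))))
        ... | no _ | yes y≡e | yes y≡u = ⊥-elim (u≢e (trans (≡-sym y≡u) y≡e))
        ... | no _ | yes refl | no _ = ≤-reflexive (trans (cong (_+ 1) (𝟙-no (adj? p y) λ py →
                <⇒≱ e-q (≤-trans (p-ball (flip≤ (close py))) (n≤1+n 2))))
                (≡-sym (trans (+-identityʳ (CH.a p y)) (𝟙-yes (H? p y) pe))))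
        ... | no _ | no _ | yes refl = ≤-trans (≤-reflexive (+-identityʳ (CG.a p y))) (≤-trans (𝟙≤1 (adj? p y)) (m≤n+m 1 (CH.a p y)))
          where
          𝟙≤1 : ∀ {P : Set} (P? : Dec P) → 𝟙 P? ≤ 1
          𝟙≤1 (yes _) = ≤-refl
          𝟙≤1 (no _)  = z≤n
        ... | no _ | no _ | no y≢u = +-monoˡ-≤ 0 (𝟙-mono (adj? p y) (H? p y) λ py → f y (λ x → irrefl G (subst (Adj G p) x py)) y≢u
                (via {j = 2} (p-ball (flip≤ (close py))) (flip≤ bq)))
        count : CH.deg p + 2 ≤ CH.deg p + 1
        count = ≤-trans (≤-reflexive (trans (cong₂ _+_ (≡-sym deg-p) (≡-sym (trans (∑-distrib-+ (δ z) (δ e))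
            (cong₂ _+_ (sum-δ1 z) (sum-δ1 e))))) (≡-sym (∑-distrib-+ (CG.a p) _))))
          (≤-trans (sum-≤ pointwise) (≤-reflexive (trans (∑-distrib-+ (CH.a p) (δ u)) (cong (CH.deg p +_) (sum-δ1 u)))))

    -- ℓ, p, q, s is a pendant path both of T and of the tree behind H − e. If N(p) differs in G and
    -- H, the two differ by exchanging the only non-leaf neighbour τ of s for a child b of τ, and
    -- these turn out to be twins in G − p.
    module Exchange (¬pe : ¬ Adj H p e) (C : CardMetric H e)
      (B′ : Structure.Beyond (CardMetric.metric C) (_≢ e) ℓ p q s) where

      open CardMetric C
      module M′ = Metric metric
      module B′ = Structure.Beyond B′
      open B′ using () renaming (D to D′)

      ℓ≢e = e≢ℓ ∘ ≡-sym
      p≢e = e≢p ∘ ≡-sym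
      q≢e = e≢q ∘ ≡-sym

      s≢ℓ : s ≢ ℓ
      s≢ℓ = ≢-by (d-refl s) D-ℓ λ ()

      s≢e : s ≢ e
      s≢e z = <⇒≱ e-D (≤-trans (bound (trans (cong (λ x → d x s) (≡-sym z)) (d-refl s))) z≤n)

      record Out (v : V) : Set where
        constructor out
        field
          ≢ℓ : v ≢ ℓ
          ≢p : v ≢ p
          ≢q : v ≢ q
          ≢s : v ≢ s
          ≢e : v ≢ e
      open Out

      ≢e-by : ∀ {v k} → D v ≡ k → k ≤ 3 → v ≢ e
      ≢e-by Dv k≤3 z = <⇒≱ e-D (≤-trans (bound (trans (cong (λ x → d x s) (≡-sym z)) Dv)) k≤3)

      out₁ : ∀ {v} → D v ≡ 1 → v ≢ q → Out v
      out₁ Dv v≢q = out (≢-by Dv D-ℓ λ ()) (≢-by Dv p-s λ ()) v≢q (≢-by Dv (d-refl s) λ ()) (≢e-by Dv (s≤s z≤n))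

      out₂ : ∀ {v} → D v ≡ 2 → v ≢ p → Out v
      out₂ Dv v≢p = out (≢-by Dv D-ℓ λ ()) v≢p (≢-by Dv q─s λ ()) (≢-by Dv (d-refl s) λ ()) (≢e-by Dv (s≤s (s≤s z≤n)))

      q-of : ∀ {v} → Out v → d v q ≡ suc (D v)
      q-of o = D-q (≢ℓ o) (≢p o) (≢q o)

      p-of : ∀ {v} → Out v → d v p ≡ suc (suc (D v))
      p-of o = D-p (≢ℓ o) (≢p o) (≢q o)

      q-of′ : ∀ {v} → Out v → d′ v q ≡ suc (D′ v)
      q-of′ o = proj₁ (B′.along (≢e o) (≢ℓ o) (≢p o) (≢q o))

      p-of′ : ∀ {v} → Out v → d′ v p ≡ suc (suc (D′ v))
      p-of′ o = trans (proj₁ (proj₂ (B′.along (≢e o) (≢ℓ o) (≢p o) (≢q o)))) (cong suc (q-of′ o))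

      D≢0 : ∀ {v} → Out v → D v ≢ 0
      D≢0 o z = ≢s o (d-zero z)

      D′≢0 : ∀ {v} → Out v → D′ v ≢ 0
      D′≢0 o z = ≢s o (M′.d-zero z)

      level₁ : ∀ {k} → k ≢ 0 → k ≤ 1 → k ≡ 1
      level₁ {zero} n _ = ⊥-elim (n refl)
      level₁ {suc zero} _ _ = refl
      level₁ {suc (suc _)} _ (s≤s ())

      level₂ : ∀ {k} → k ≢ 0 → k ≢ 1 → k ≤ 2 → k ≡ 2
      level₂ {zero} n _ _ = ⊥-elim (n refl)
      level₂ {suc zero} _ n _ = ⊥-elim (n refl)
      level₂ {suc (suc zero)} _ _ _ = refl
      level₂ {suc (suc (suc _))} _ _ (s≤s (s≤s ()))

      level₃ : ∀ {k} → ¬ (k ≤ 2) → k ≤ 3 → k ≡ 3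
      level₃ n le = ≤-antisym le (≰⇒> n)

      H⇒′ : ∀ {x y} → x ≢ e → y ≢ e → x ≢ p → y ≢ p → d x y ≤ 3 → d′ x y ≤ 3
      H⇒′ {x} {y} x≢e y≢e x≢p y≢p le with x ≟F y
      ... | yes refl = ≤-trans (M′.bound (M′.d-refl x)) z≤n
      ... | no x≢y = close′ x≢e y≢e (join-H x≢p y≢p x≢y le)

      ′⇒H : ∀ {x y} → x ≢ e → y ≢ e → x ≢ p → y ≢ p → d′ x y ≤ 3 → d x y ≤ 3
      ′⇒H {x} {y} x≢e y≢e x≢p y≢p le with x ≟F y
      ... | yes refl = ≤-trans (bound (d-refl x)) z≤n
      ... | no x≢y = close (off⇐ x≢p y≢p (join′ x≢e y≢e x≢y le))

      -- In either tree, depth at most 2 amounts to adjacency with `q`, which is the same for both.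
      -- Only the division into depths 1 and 2 can differ: depth 1 is adjacency to `p`, in `G` for
      -- `D` and in `H` for `D′`.
      D⇒D′ : ∀ {v} → Out v → D v ≤ 2 → D′ v ≤ 2
      D⇒D′ o le = s≤s⁻¹ (≤-trans (≤-reflexive (≡-sym (q-of′ o)))
        (H⇒′ (≢e o) q≢e (≢p o) (p≢q ∘ ≡-sym) (≤-trans (bound (q-of o)) (s≤s le))))

      D′⇒D : ∀ {v} → Out v → D′ v ≤ 2 → D v ≤ 2
      D′⇒D o le = s≤s⁻¹ (≤-trans (≤-reflexive (≡-sym (q-of o)))
        (′⇒H (≢e o) q≢e (≢p o) (p≢q ∘ ≡-sym) (≤-trans (M′.bound (q-of′ o)) (s≤s le))))

      H-level₁ : ∀ {v} → Out v → Adj H p v → D′ v ≡ 1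
      H-level₁ o pv = level₁ (D′≢0 o) (s≤s⁻¹ (s≤s⁻¹ (≤-trans (≤-reflexive (≡-sym (p-of′ o)))
        (close′ (≢e o) p≢e (sym-H pv)))))

      level₁-H : ∀ {v} → Out v → D′ v ≡ 1 → Adj H p v
      level₁-H o z = sym-H (join′ (≢e o) p≢e (≢p o) (M′.bound (trans (p-of′ o) (cong (2 +_) z))))

      G-level₁ : ∀ {v} → Out v → Adj G p v → D v ≡ 1
      G-level₁ o pv = level₁ (D≢0 o) (s≤s⁻¹ (≤-trans (≤-reflexive (≡-sym (q-of o))) (p-ball (flip≤ (close pv)))))

      level₁-G : ∀ {v} → Out v → D v ≡ 1 → Adj G p v
      level₁-G o z = sym-G (join (≢p o) (q-ball (bound (trans (q-of o) (cong suc z)))))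

      not-H-level₂ : ∀ {v} → Out v → D v ≤ 2 → ¬ Adj H p v → D′ v ≡ 2
      not-H-level₂ o le ¬pv = level₂ (D′≢0 o) (¬pv ∘ level₁-H o) (D⇒D′ o le)

      not-G-level₂ : ∀ {v} → Out v → D′ v ≤ 2 → ¬ Adj G p v → D v ≡ 2
      not-G-level₂ o le ¬pv = level₂ (D≢0 o) (¬pv ∘ level₁-G o) (D′⇒D o le)

      ℓ-near : ∀ {y} → d y q ≤ 1 → y ≢ p → Adj H p y
      ℓ-near yq y≢p = sim-ℓ-H ℓp (sym-H (hub-ℓ yq y≢p)) (y≢p ∘ ≡-sym)

      pq-H : Adj H p q
      pq-H = ℓ-near (≤-trans (bound (d-refl q)) z≤n) (p≢q ∘ ≡-sym)

      ps-H : Adj H p s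
      ps-H = ℓ-near (bound (flip≡ q─s)) s≢p

      p-near : ∀ {y} → p ≢ y → d p y ≤ 2 → Adj G p y
      p-near p≢y le = join p≢y (≤-trans le (n≤1+n 2))

      pℓ-G : Adj G p ℓ
      pℓ-G = p-near (ℓ≢p ∘ ≡-sym) (≤-trans (bound (flip≡ ℓ─p)) (s≤s z≤n))

      pq-G : Adj G p q
      pq-G = p-near p≢q (≤-trans (bound p─q) (s≤s z≤n))

      ps-G : Adj G p s
      ps-G = p-near (s≢p ∘ ≡-sym) (bound p-s)

      module Difference {y₀ b : V} (py₀ : Adj G p y₀) (¬py₀ : ¬ Adj H p y₀) (pb : Adj H p b) (¬pb : ¬ Adj G p b) where

        out-b : Out b
        out-b = out (λ z → ¬pb (subst (Adj G p) (≡-sym z) pℓ-G)) (≢-H pb ∘ ≡-sym) (λ z → ¬pb (subst (Adj G p) (≡-sym z) pq-G))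
                    (λ z → ¬pb (subst (Adj G p) (≡-sym z) ps-G)) (λ z → ¬pe (subst (Adj H p) z pb))

        out-y₀ : Out y₀
        out-y₀ = out (λ z → ¬py₀ (subst (Adj H p) (≡-sym z) (sym-H ℓp))) (λ z → irrefl G (subst (Adj G p) z py₀))
                     (λ z → ¬py₀ (subst (Adj H p) (≡-sym z) pq-H)) (λ z → ¬py₀ (subst (Adj H p) (≡-sym z) ps-H))
                     (λ z → <⇒≱ e-q (≤-trans (p-ball (flip≤ (close (subst (Adj G p) z py₀)))) (n≤1+n 2)))

        D′b : D′ b ≡ 1
        D′b = H-level₁ out-b pb

        Db : D b ≡ 2
        Db = not-G-level₂ out-b (≤-trans (≤-reflexive D′b) (s≤s z≤n)) ¬pb

        Dy₀ : D y₀ ≡ 1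
        Dy₀ = G-level₁ out-y₀ py₀

        τ : V
        τ = proj₁ (parent tt Db)

        Dτ : D τ ≡ 1
        Dτ = proj₁ (proj₂ (proj₂ (parent tt Db)))

        τ─b : d τ b ≡ 1
        τ─b = proj₂ (proj₂ (proj₂ (parent tt Db)))

        τ≢q : τ ≢ q
        τ≢q = ≢-by τ─b (flip≡ (trans (q-of out-b) (cong suc Db))) λ ()

        out-τ : Out τ
        out-τ = out₁ Dτ τ≢q

        -- b is within distance 3 of all the vertices at level 2, so these are all children of τ.
        children : ∀ {a} → Out a → D a ≡ 2 → d τ a ≡ 1
        children {a} o Da = same-parent Db Da (flip≤ (′⇒H (≢e o) (≢e out-b) (≢p o) (≢p out-b)
          (M′.via {j = 2} (D⇒D′ o (≤-reflexive Da)) (M′.bound (M′.flip≡ D′b))))) Dτ τ─b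

        -- Otherwise `D′ y` is 2. In the tree of the card let `a` be the parent of `v`; its depth in
        -- `T` is at most 2, so `y` is within 3 of it. By `third-level`, `y` is then within 3 of
        -- `v`; but in `T`, `v` hangs below `τ`, at distance 4 from `y`.
        kept : ∀ {y} → Out y → D y ≡ 1 → y ≢ τ → Adj H p y
        kept {y} o Dy y≢τ with H? p y
        ... | yes py = py
        ... | no ¬py = ⊥-elim (via-v (B′.third-level (≢e out-v) D′v))
          where
          out-v : Out v
          out-v = out v≢ℓ v≢p v≢q (≢-by D-v (d-refl s) λ ()) v≢e
          D′v : D′ v ≡ 3
          D′v = level₃ (λ le → clash D-v (D′⇒D out-v le) ≤-refl)
            (H⇒′ (≢e out-v) s≢e (≢p out-v) s≢p (bound D-v))
          D′y : D′ y ≡ 2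
          D′y = not-H-level₂ o (≤-trans (≤-reflexive Dy) (s≤s z≤n)) ¬py
          τ-v : d τ v ≡ 2
          τ-v with third-level tt D-v
          ... | a , _ , Da , av , _ = ≤-antisym
                  (via (bound (children (out₂ Da (≢-by av (flip≡ (trans (p-of out-v) (cong (2 +_) D-v))) λ ())) Da)) (bound av))
                  (s≤s⁻¹ (≤-trans (≤-reflexive (≡-sym (flip≡ D-v))) (≤-trans (d-tri s τ v) (+-monoˡ-≤ (d τ v) (bound (flip≡ Dτ))))))
          v-y : d v y ≡ 4
          v-y = trans (away v (flip≡ Dτ) (flip≡ Dy) (y≢τ ∘ ≡-sym) (trans D-v (cong suc (≡-sym (flip≡ τ-v))))) (cong suc D-v)
          via-v : Σ V (λ a → a ≢ e × D′ a ≡ 2 × d′ a v ≡ 1 × (∀ {c} → D′ c ≡ 2 → d′ a c ≤ 3 → d′ c v ≤ 3)) → ⊥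
          via-v (a , a≢e , D′a , av , lift) = clash (flip≡ v-y) (′⇒H (≢e o) (≢e out-v) (≢p o) (≢p out-v)
              (lift D′y (H⇒′ a≢e (≢e o) (≢p out-a) (≢p o) (via {j = 2} (D′⇒D out-a (≤-reflexive D′a)) (bound (flip≡ Dy)))))) ≤-refl
            where
            a≢p : a ≢ p
            a≢p z = M′.clash (M′.flip≡ (trans (p-of′ out-v) (cong (2 +_) D′v)))
              (M′.bound (trans (cong (λ x → d′ x v) (≡-sym z)) av)) (s≤s (s≤s z≤n))
            v-ℓ′ : d′ v ℓ ≡ 6
            v-ℓ′ = trans (proj₂ (proj₂ (B′.along (≢e out-v) (≢ℓ out-v) (≢p out-v) (≢q out-v)))) (cong suc (trans (p-of′ out-v) (cong (2 +_) D′v)))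
            out-a : Out a
            out-a = out (λ z → M′.clash (M′.flip≡ v-ℓ′) (M′.bound (trans (cong (λ x → d′ x v) (≡-sym z)) av)) (s≤s (s≤s z≤n)))
              a≢p (λ z → M′.clash (M′.flip≡ (trans (q-of′ out-v) (cong suc D′v))) (M′.bound (trans (cong (λ x → d′ x v) (≡-sym z)) av)) (s≤s (s≤s z≤n)))
              (λ z → 0≢1+n (trans (≡-sym (M′.d-refl s)) (trans (cong D′ (≡-sym z)) D′a))) a≢e

        y₀≡τ : y₀ ≡ τ
        y₀≡τ with y₀ ≟F τ
        ... | yes z = z
        ... | no z  = ⊥-elim (¬py₀ (kept out-y₀ Dy₀ z))

        pτ : Adj G p τ
        pτ = subst (Adj G p) y₀≡τ py₀

        ¬pτ : ¬ Adj H p τ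
        ¬pτ = ¬py₀ ∘ subst (Adj H p) (≡-sym y₀≡τ)

        D′τ : D′ τ ≡ 2
        D′τ = not-H-level₂ out-τ (≤-trans (≤-reflexive Dτ) (s≤s z≤n)) ¬pτ

        G⇒H : ∀ {x} → x ≢ τ → Adj G p x → Adj H p x
        G⇒H {x} x≢τ px with x ≟F ℓ | x ≟F q | x ≟F s
        ... | yes z | _ | _ = subst (Adj H p) (≡-sym z) (sym-H ℓp)
        ... | no _ | yes z | _ = subst (Adj H p) (≡-sym z) pq-H
        ... | no _ | no _ | yes z = subst (Adj H p) (≡-sym z) ps-H
        ... | no nℓ | no nq | no ns = kept o (G-level₁ o px) x≢τ
          where
          o : Out x
          o = out nℓ (λ z → irrefl G (subst (Adj G p) z px)) nq ns
            (λ z → <⇒≱ e-q (≤-trans (p-ball (flip≤ (close (subst (Adj G p) z px)))) (n≤1+n 2)))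

        b≢τ : b ≢ τ
        b≢τ = ≢-by Db Dτ λ ()

        -- The neighbourhoods of `p` have equal size and only `τ` is lost from `G` to `H`, so only
        -- `b` is gained.
        H⇒G : ∀ {x} → x ≢ b → Adj H p x → Adj G p x
        H⇒G {x} x≢b px with x ≟F τ
        ... | yes z = subst (Adj G p) (≡-sym z) pτ
        ... | no x≢τ = 𝟙⇒ (adj? p x) λ z → 1+n≢0 (trans (≡-sym (𝟙-yes (H? p x) px)) (trans (≡-sym (equal x x≢b x≢τ)) z))
          where
          pointwise : ∀ y → CG.a p y + δ b y ≤ CH.a p y + δ τ y
          pointwise y with y ≟F b | y ≟F τ
          ... | yes z | yes z′ = ⊥-elim (b≢τ (trans (≡-sym z) z′))
          ... | yes refl | no _ = ≤-reflexive (trans (cong (_+ 1) (𝟙-no (adj? p y) ¬pb)) (≡-sym (trans (+-identityʳ (CH.a p y)) (𝟙-yes (H? p y) pb))))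
          ... | no _ | yes refl = ≤-reflexive (trans (+-identityʳ (CG.a p y)) (trans (𝟙-yes (adj? p y) pτ) (≡-sym (cong (_+ 1) (𝟙-no (H? p y) ¬pτ)))))
          ... | no _ | no y≢τ = +-monoˡ-≤ 0 (𝟙-mono (adj? p y) (H? p y) (G⇒H y≢τ))
          tight : ∀ y → CG.a p y + δ b y ≡ CH.a p y + δ τ y
          tight = sum-≤-tight pointwise (≤-reflexive (trans (∑-distrib-+ (CH.a p) (δ τ)) (trans (cong₂ _+_ (≡-sym deg-p) (trans (sum-δ1 τ) (≡-sym (sum-δ1 b))))
            (≡-sym (∑-distrib-+ (CG.a p) (δ b))))))
          equal : ∀ y → y ≢ b → y ≢ τ → CG.a p y ≡ CH.a p y
          equal y y≢b y≢τ = +-cancelʳ-≡ 0 _ _ (trans (cong (CG.a p y +_) (≡-sym (𝟙-no (y ≟F b) y≢b)))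
            (trans (tight y) (cong (CH.a p y +_) (𝟙-no (y ≟F τ) y≢τ))))

        degrees : CG.deg τ ≡ suc (CG.deg b)
        degrees = exchange (≢p out-τ) (≢p out-b) pτ ¬pτ ¬pb pb (λ x≢τ _ → G⇒H x≢τ) (λ _ x≢b → H⇒G x≢b)

        -- Apart from e, whatever is within distance 3 of τ is within distance 3 of b: otherwise
        -- τ and a sibling of b would have a common parent near v in the tree behind H − e.
        towards : ∀ {v} → v ≢ p → v ≢ e → v ≢ b → Adj G τ v → Adj G b v
        towards {v} v≢p v≢e v≢b τv with d v b ≤? 3
        ... | yes le = join (v≢b ∘ ≡-sym) (flip≤ le)
        ... | no gt = ⊥-elim (via-s (step v Dτ))
          where
          v-τ : d v τ ≡ 3
          v-τ with step v τ─b
          ... | inj₁ z = ≤-antisym (flip≤ (close τv)) (s≤s⁻¹ (≤-trans (≰⇒> gt) (≤-reflexive z)))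
          ... | inj₂ z = ⊥-elim (gt (≤-trans (n≤1+n _) (≤-trans (≤-reflexive (≡-sym z)) (flip≤ (close τv)))))
          via-s : D v ≡ suc (d v τ) ⊎ d v τ ≡ suc (D v) → ⊥
          via-s (inj₂ z) = clash v-τ (≤-trans (bound (flip≡ (children (out₂ Dv v≢p) Dv))) ≤-refl) (s≤s (s≤s z≤n))
            where
            Dv : D v ≡ 2
            Dv = suc-injective (trans (≡-sym z) v-τ)
          via-s (inj₁ z) with hop τ v (flip≡ v-τ)
          ... | c , τ─c , c-v = contradict (B′.parent (≢e out-τ) D′τ)
            where
            Dv : D v ≡ 4
            Dv = trans z (cong suc v-τ)
            out-v : Out v
            out-v = out (≢-by Dv D-ℓ λ ()) v≢p (≢-by Dv q─s λ ()) (≢-by Dv (d-refl s) λ ()) v≢e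
            Dc : D c ≡ 2
            Dc = dist2 τ─c Dτ (≢-by c-v (flip≡ Dv) λ ())
            out-c : Out c
            out-c = out₂ Dc (≢-by c-v (flip≡ (trans (p-of out-v) (cong (2 +_) Dv))) λ ())
            c≢b : c ≢ b
            c≢b x = gt (≤-trans (bound (flip≡ (trans (cong (λ y → d y v) (≡-sym x)) c-v))) (n≤1+n 2))
            D′c : D′ c ≡ 2
            D′c = not-H-level₂ out-c (≤-reflexive Dc) λ pc → 1+n≢n (trans (≡-sym Dc) (G-level₁ out-c (H⇒G c≢b pc)))
            contradict : Σ V (λ f → f ≢ e × D′ f ≡ 1 × d′ f τ ≡ 1) → ⊥
            contradict (f , f≢e , D′f , f─τ) = split (f ≟F b)
              where
              f≢ : ∀ {w k} → d′ τ w ≡ suc (suc k) → f ≢ w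
              f≢ {w} τw y = M′.clash (M′.flip≡ τw) (M′.bound (trans (cong (λ u → d′ u τ) (≡-sym y)) f─τ)) (s≤s (s≤s z≤n))
              out-f : Out f
              out-f = out (f≢ (trans (proj₂ (proj₂ (B′.along (≢e out-τ) (≢ℓ out-τ) (≢p out-τ) (≢q out-τ)))) (cong suc (p-of′ out-τ))))
                (f≢ (p-of′ out-τ)) (f≢ (trans (q-of′ out-τ) (cong suc D′τ)))
                (λ y → 0≢1+n (trans (≡-sym (M′.d-refl s)) (trans (cong D′ (≡-sym y)) D′f))) f≢e
              v-f : d v f ≤ 3
              v-f = ′⇒H (≢e out-v) f≢e (≢p out-v) (≢p out-f)
                (B′.siblings (1≢0 τ─c) f─τ
                  (B′.same-parent D′τ D′c (H⇒′ (≢e out-τ) (≢e out-c) (≢p out-τ) (≢p out-c) (≤-trans (bound τ─c) (s≤s z≤n))) D′f f─τ)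
                  (H⇒′ (≢e out-v) (≢e out-τ) (≢p out-v) (≢p out-τ) (bound v-τ))
                  (H⇒′ (≢e out-v) (≢e out-c) (≢p out-v) (≢p out-c) (≤-trans (bound (flip≡ c-v)) (n≤1+n 2))))
              τ≢f : τ ≢ f
              τ≢f y = 1+n≢n (trans (≡-sym D′τ) (trans (cong D′ y) D′f))
              split : Dec (f ≡ b) → ⊥
              split (yes x) = gt (subst (λ y → d v y ≤ 3) x v-f)
              split (no f≢b) = clash (trans (away v (flip≡ Dτ) (flip≡ Df) τ≢f z) (cong suc Dv)) v-f (s≤s (s≤s (s≤s (s≤s z≤n))))
                where
                Df : D f ≡ 1
                Df = G-level₁ out-f (H⇒G f≢b (level₁-H out-f D′f))

        τ≢b : τ ≢ b
        τ≢b = b≢τ ∘ ≡-sym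

        ¬bp : ¬ Adj G b p
        ¬bp = ¬pb ∘ sym-G

        τb : Adj G τ b
        τb = join τ≢b (≤-trans (bound τ─b) (s≤s z≤n))

        -- A vertex near b but not near τ would be farther from ℓ than e, if e is near τ.
        near-b : Adj G τ e → ∀ {g} → g ≢ τ → Adj G b g → Adj G τ g
        near-b τe {g} g≢τ bg with d g τ ≤? 3
        ... | yes le = join (g≢τ ∘ ≡-sym) (flip≤ le)
        ... | no gt with step g τ─b
        ... | inj₁ z = ⊥-elim (gt (≤-trans (n≤1+n _) (≤-trans (≤-reflexive (≡-sym z)) (flip≤ (close bg)))))
        ... | inj₂ z with step g Dτ
        ... | inj₂ z′ = ⊥-elim (gt (≤-trans (n≤1+n _) (≤-trans (≤-reflexive (≡-sym (away g Dτ τ─b s≢b z′))) (flip≤ (close bg)))))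
          where
          s≢b : s ≢ b
          s≢b = ≢-by (d-refl s) Db λ ()
        ... | inj₁ z′ = ⊥-elim (<⇒≱ {7} {8} ≤-refl (≤-trans (≤-reflexive (≡-sym g-ℓ)) (≤-trans (flip≤ (deep g))
              (≤-trans (≤-reflexive (trans (d-sym ℓ e) (along-ℓ e≢ℓ e≢p e≢q))) (+-monoʳ-≤ 3 (via (flip≤ (close τe)) (bound Dτ)))))))
          where
          g-τ : d g τ ≡ 4
          g-τ = ≤-antisym (≤-trans (≤-reflexive z) (s≤s (flip≤ (close bg)))) (≰⇒> gt)
          Dg : D g ≡ 5
          Dg = trans z′ (cong suc g-τ)
          g-ℓ : d g ℓ ≡ 8
          g-ℓ = trans (along-ℓ (≢-by Dg D-ℓ λ ()) (≢-by Dg p-s λ ()) (≢-by Dg q─s λ ())) (cong (3 +_) Dg)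

        -- Otherwise `near-b` would put `b`, its neighbours, `p` and `e` into the closed
        -- neighbourhood of `τ`, one vertex more than `degrees` permits.
        be : Adj G τ e → Adj G b e
        be τe with adj? b e
        ... | yes x = x
        ... | no ¬be = ⊥-elim (1+n≰n (+-cancelˡ-≤ (CG.deg b) _ _ count))
          where
          pointwise : ∀ y → CG.a b y + (δ b y + (δ p y + δ e y)) ≤ CG.a τ y + δ τ y
          pointwise y with y ≟F b | y ≟F p | y ≟F e | y ≟F τ
          ... | yes y≡b | yes y≡p | _ | _ = ⊥-elim (≢p out-b (trans (≡-sym y≡b) y≡p))
          ... | yes y≡b | no _ | yes y≡e | _ = ⊥-elim (≢e out-b (trans (≡-sym y≡b) y≡e))
          ... | yes y≡b | no _ | no _ | yes y≡τ = ⊥-elim (b≢τ (trans (≡-sym y≡b) y≡τ))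
          ... | yes refl | no _ | no _ | no _ = ≤-reflexive (trans (cong (_+ 1) (CG.a-irr y))
                  (≡-sym (trans (+-identityʳ (CG.a τ y)) (𝟙-yes (adj? τ y) τb))))
          ... | no _ | yes y≡p | yes y≡e | _ = ⊥-elim (e≢p (trans (≡-sym y≡e) y≡p))
          ... | no _ | yes y≡p | no _ | yes y≡τ = ⊥-elim (≢p out-τ (trans (≡-sym y≡τ) y≡p))
          ... | no _ | yes refl | no _ | no _ = ≤-reflexive (trans (cong (_+ 1) (𝟙-no (adj? b y) ¬bp))
                  (≡-sym (trans (+-identityʳ (CG.a τ y)) (𝟙-yes (adj? τ y) (sym-G pτ)))))
          ... | no _ | no _ | yes y≡e | yes y≡τ = ⊥-elim (≢e out-τ (trans (≡-sym y≡τ) y≡e))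
          ... | no _ | no _ | yes refl | no _ = ≤-reflexive (trans (cong (_+ 1) (𝟙-no (adj? b y) ¬be))
                  (≡-sym (trans (+-identityʳ (CG.a τ y)) (𝟙-yes (adj? τ y) τe))))
          ... | no _ | no _ | no _ | yes refl = ≤-trans (≤-reflexive (+-identityʳ (CG.a b y)))
                  (≤-trans (≤-reflexive (𝟙-yes (adj? b y) (sym-G τb))) (m≤n+m 1 (CG.a y y)))
          ... | no _ | no _ | no _ | no y≢τ = +-monoˡ-≤ 0 (𝟙-mono (adj? b y) (adj? τ y) (near-b τe y≢τ))
          count : CG.deg b + 3 ≤ CG.deg b + 2
          count = ≤-trans (≤-reflexive (≡-sym (trans (∑-distrib-+ (CG.a b) _) (cong (CG.deg b +_) (trans (∑-distrib-+ (δ b) _)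
              (cong₂ _+_ (sum-δ1 b) (trans (∑-distrib-+ (δ p) (δ e)) (cong₂ _+_ (sum-δ1 p) (sum-δ1 e)))))))))
            (≤-trans (sum-≤ pointwise) (≤-reflexive (trans (∑-distrib-+ (CG.a τ) (δ τ)) (trans (cong₂ _+_ degrees (sum-δ1 τ))
              (trans (+-comm (suc (CG.deg b)) 1) (+-comm 2 (CG.deg b)))))))

        to-b : ∀ {v} → v ≢ p → v ≢ b → Adj G τ v → Adj G b v
        to-b {v} v≢p v≢b τv with v ≟F e
        ... | yes x  = subst (Adj G b) (≡-sym x) (be (subst (Adj G τ) x τv))
        ... | no v≢e = towards v≢p v≢e v≢b τv

        -- By `degrees`, the closed neighbourhoods of `τ` and `b` have equal size once `p` is
        -- removed from the former, so the inclusion `to-b` is an equality.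
        to-τ : ∀ {v} → v ≢ p → v ≢ τ → Adj G b v → Adj G τ v
        to-τ {v} v≢p v≢τ bv with v ≟F b
        ... | yes x  = ⊥-elim (irrefl G (subst (Adj G b) x bv))
        ... | no v≢b = 𝟙⇒ (adj? τ v) λ x → 1+n≢0 (trans (≡-sym (𝟙-yes (adj? b v) bv)) (trans (≡-sym equal) x))
          where
          pointwise : ∀ y → CG.a τ y + δ τ y ≤ CG.a b y + (δ b y + δ p y)
          pointwise y with y ≟F τ | y ≟F b | y ≟F p
          ... | yes y≡τ | yes y≡b | _ = ⊥-elim (τ≢b (trans (≡-sym y≡τ) y≡b))
          ... | yes y≡τ | no _ | yes y≡p = ⊥-elim (≢p out-τ (trans (≡-sym y≡τ) y≡p))
          ... | yes refl | no _ | no _ = ≤-reflexive (trans (cong (_+ 1) (CG.a-irr y))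
                  (≡-sym (trans (+-identityʳ (CG.a b y)) (𝟙-yes (adj? b y) (sym-G τb)))))
          ... | no _ | yes y≡b | yes y≡p = ⊥-elim (≢p out-b (trans (≡-sym y≡b) y≡p))
          ... | no _ | yes refl | no _ = ≤-trans (≤-reflexive (+-identityʳ (CG.a τ y)))
                  (≤-trans (≤-reflexive (𝟙-yes (adj? τ y) τb)) (m≤n+m 1 (CG.a y y)))
          ... | no _ | no _ | yes refl = ≤-trans (≤-reflexive (+-identityʳ (CG.a τ y)))
                  (≤-trans (≤-reflexive (𝟙-yes (adj? τ y) (sym-G pτ))) (m≤n+m 1 (CG.a b y)))
          ... | no _ | no y≢b | no y≢p = +-monoˡ-≤ 0 (𝟙-mono (adj? τ y) (adj? b y) (to-b y≢p y≢b))
          tight : ∀ y → CG.a τ y + δ τ y ≡ CG.a b y + (δ b y + δ p y)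
          tight = sum-≤-tight pointwise (≤-reflexive (trans (∑-distrib-+ (CG.a b) _) (trans (cong (CG.deg b +_)
              (trans (∑-distrib-+ (δ b) (δ p)) (cong₂ _+_ (sum-δ1 b) (sum-δ1 p)))) (trans (+-comm (CG.deg b) 2)
              (trans (+-comm 1 (suc (CG.deg b))) (trans (cong₂ _+_ (≡-sym degrees) (≡-sym (sum-δ1 τ))) (≡-sym (∑-distrib-+ (CG.a τ) (δ τ)))))))))
          equal : CG.a τ v ≡ CG.a b v
          equal = +-cancelʳ-≡ 0 _ _ (trans (cong (CG.a τ v +_) (≡-sym (𝟙-no (v ≟F τ) v≢τ)))
            (trans (tight v) (cong (CG.a b v +_) (cong₂ _+_ (𝟙-no (v ≟F b) v≢b) (𝟙-no (v ≟F p) v≢p)))))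

        -- Off `p`, `τ` and `b` are twins in `G`, so their transposition preserves `G` there, and it
        -- carries the neighbourhood of `p` in `H` to that in `G`.
        swap : V → V
        swap x with x ≟F τ | x ≟F b
        ... | yes _ | _     = b
        ... | no _  | yes _ = τ
        ... | no _  | no _  = x

        swap-b : swap b ≡ τ
        swap-b with b ≟F τ | b ≟F b
        ... | yes z | _     = ⊥-elim (b≢τ z)
        ... | no _  | yes _ = refl
        ... | no _  | no z  = ⊥-elim (z refl)

        swap-τ : swap τ ≡ b
        swap-τ with τ ≟F τ
        ... | yes _ = refl
        ... | no z  = ⊥-elim (z refl)

        swap-other : ∀ {x} → x ≢ τ → x ≢ b → swap x ≡ x
        swap-other {x} x≢τ x≢b with x ≟F τ | x ≟F b
        ... | yes z | _     = ⊥-elim (x≢τ z)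
        ... | no _  | yes z = ⊥-elim (x≢b z)
        ... | no _  | no _  = refl

        swap² : ∀ x → swap (swap x) ≡ x
        swap² x with x ≟F τ | x ≟F b
        ... | yes z | _     = trans swap-b (≡-sym z)
        ... | no _  | yes z = trans swap-τ (≡-sym z)
        ... | no nτ | no nb = swap-other nτ nb

        swap-off : ∀ {x y} → x ≢ p → y ≢ p → Adj G x y → Adj G (swap x) (swap y)
        swap-off {x} {y} x≢p y≢p xy with x ≟F τ | x ≟F b | y ≟F τ | y ≟F b
        ... | yes refl | _        | yes refl | _        = ⊥-elim (irrefl G xy)
        ... | yes refl | _        | no _     | yes refl = sym-G xy
        ... | yes refl | _        | no _     | no y≢b   = to-b y≢p y≢b xy
        ... | no _     | yes refl | yes refl | _        = sym-G xy
        ... | no _     | yes refl | no _     | yes refl = ⊥-elim (irrefl G xy)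
        ... | no _     | yes refl | no y≢τ   | no _     = to-τ y≢p y≢τ xy
        ... | no _     | no x≢b   | yes refl | _        = sym-G (to-b x≢p x≢b (sym-G xy))
        ... | no x≢τ   | no _     | no _     | yes refl = sym-G (to-τ x≢p x≢τ (sym-G xy))
        ... | no _     | no _     | no _     | no _     = xy

        swap-p : swap p ≡ p
        swap-p = swap-other (≢p out-τ ∘ ≡-sym) (≢p out-b ∘ ≡-sym)

        swap-≢p : ∀ {x} → x ≢ p → swap x ≢ p
        swap-≢p {x} x≢p z = x≢p (trans (≡-sym (swap² x)) (trans (cong swap z) swap-p))

        p-H⇒G : ∀ {y} → Adj H p y → Adj G p (swap y)
        p-H⇒G {y} py with y ≟F τ | y ≟F b
        ... | yes refl | _      = ⊥-elim (¬pτ py)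
        ... | no _     | yes _  = pτ
        ... | no _     | no y≢b = H⇒G y≢b py

        p-G⇒H : ∀ {y} → Adj G p y → Adj H p (swap y)
        p-G⇒H {y} py with y ≟F τ | y ≟F b
        ... | yes _    | _        = pb
        ... | no _     | yes refl = ⊥-elim (¬pb py)
        ... | no y≢τ   | no _     = G⇒H y≢τ py

        swapped : Iso H G
        swapped = record { π = permutation swap swap swap² swap² ; to = to ; of = λ {x} {y} a →
            subst₂ (Adj H) (swap² x) (swap² y) (from a) }
          where
          to : ∀ {x y} → Adj H x y → Adj G (swap x) (swap y)
          to {x} {y} a with x ≟F p | y ≟F p
          ... | yes x≡p | _ = subst (λ u → Adj G u (swap y)) (≡-sym (trans (cong swap x≡p) swap-p))
                                (p-H⇒G (subst (λ u → Adj H u y) x≡p a))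
          ... | no _ | yes y≡p = sym-G (subst (λ u → Adj G u (swap x)) (≡-sym (trans (cong swap y≡p) swap-p))
                                   (p-H⇒G (subst (λ u → Adj H u x) y≡p (sym-H a))))
          ... | no x≢p | no y≢p = swap-off x≢p y≢p (off⇐ x≢p y≢p a)
          from : ∀ {x y} → Adj G x y → Adj H (swap x) (swap y)
          from {x} {y} a with x ≟F p | y ≟F p
          ... | yes x≡p | _ = subst (λ u → Adj H u (swap y)) (≡-sym (trans (cong swap x≡p) swap-p))
                                (p-G⇒H (subst (λ u → Adj G u y) x≡p a))
          ... | no _ | yes y≡p = sym-H (subst (λ u → Adj H u (swap x)) (≡-sym (trans (cong swap y≡p) swap-p))
                                   (p-G⇒H (subst (λ u → Adj G u x) y≡p (sym-G a))))
          ... | no x≢p | no y≢p = off⇒ (swap-≢p x≢p) (swap-≢p y≢p) (swap-off x≢p y≢p a)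

      exchanged : Iso H G
      exchanged with any? (λ y → adj? p y ×-dec ¬? (H? p y)) | any? (λ y → H? p y ×-dec ¬? (adj? p y))
      ... | no none | _ = by-⊆ λ y py → decidable-stable (H? p y) λ ¬py → none (y , py , ¬py)
      ... | yes _ | no none = by-⊇ λ y py → decidable-stable (adj? p y) λ ¬py → none (y , py , ¬py)
      ... | yes (y , py , ¬py) | yes (b , pb , ¬pb) = Difference.swapped py ¬py pb ¬pb

    module Apart (¬pe : ¬ Adj H p e) where

      sim-e-H : Simplicial H e
      sim-e-H {y} {z} ey ez y≢z = off⇒ (≢p ey) (≢p ez) (sim-e (off⇐ e≢p (≢p ey) ey) (off⇐ e≢p (≢p ez) ez) y≢z)
        where
        ≢p : ∀ {y} → Adj H e y → y ≢ p
        ≢p ey z = ¬pe (sym-H (subst (Adj H e) z ey))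

      open Card sim-ℓ-H sim-e-H e≢ℓ (far-from-q (≤-trans (bound (flip≡ q-t)) (n≤1+n 2)) ∘ ≡-sym)
      open M′.Pendant pend′ using (c-x₂; x₁-x₃; x₁─x₂; x₂─x₃; c─x₁; x₁≢x₃) renaming (x₂ to X₂; x₃ to X₃; Px₂ to X₂≢e; Px₃ to X₃≢e)

      pqs : V → Set
      pqs y = y ≡ p ⊎ y ≡ q ⊎ y ≡ s

      near-ℓ : ∀ {y} → y ≢ e → y ≢ ℓ → d′ y ℓ ≤ 3 → pqs y
      near-ℓ {y} y≢e y≢ℓ yℓ with y ≟F p
      ... | yes z = inj₁ z
      ... | no y≢p with ℓ-ball₄ (close (off⇐ y≢p ℓ≢p (join′ y≢e (e≢ℓ ∘ ≡-sym) y≢ℓ yℓ)))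
      ... | inj₁ z        = ⊥-elim (y≢ℓ z)
      ... | inj₂ (inj₁ z) = ⊥-elim (y≢p z)
      ... | inj₂ (inj₂ z) = inj₂ z

      X₁≢X₂ : X₁ ≢ X₂
      X₁≢X₂ = M′.1≢0 x₁─x₂

      X₂≢X₃ : X₂ ≢ X₃
      X₂≢X₃ = M′.1≢0 x₂─x₃

      X₂≢ℓ : X₂ ≢ ℓ
      X₂≢ℓ z = 0≢1+n (trans (≡-sym (M′.d-refl ℓ)) (trans (cong (d′ ℓ) (≡-sym z)) c-x₂))

      X₃≢ℓ : X₃ ≢ ℓ
      X₃≢ℓ z = 0≢1+n (suc-injective (trans (≡-sym (M′.flip≡ c─x₁)) (trans (cong (d′ X₁) (≡-sym z)) x₁-x₃)))

      -- The ball about `ℓ` consists of `ℓ` and at most `p`, `q`, `s`. Their order along the path is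
      -- left open, so that the reversed order can be refuted from the same lemma.
      beyond′ : (∀ {y} → pqs y → y ≡ X₁ ⊎ y ≡ X₂ ⊎ y ≡ X₃) → S′.Beyond (_≢ e) ℓ X₁ X₂ X₃
      beyond′ match = S′.Tail.tail-beyond record { pendant = pend′ ; only = only }
        where
        only : ∀ v → v ≢ e → d′ v ℓ ≤ 3 → v ≡ ℓ ⊎ v ≡ X₁ ⊎ v ≡ X₂ ⊎ v ≡ X₃
        only v v≢e vℓ with v ≟F ℓ
        ... | yes z = inj₁ z
        ... | no v≢ℓ = inj₂ (match (near-ℓ v≢e v≢ℓ vℓ))

      at-q-s : X₁ ≡ p → X₂ ≡ q → X₃ ≡ s → Iso H G
      at-q-s a b c = Exchange.exchanged ¬pe (card-metric sim-e-H) transported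
        where
        match : ∀ {y} → pqs y → y ≡ X₁ ⊎ y ≡ X₂ ⊎ y ≡ X₃
        match (inj₁ z)        = inj₁ (trans z (≡-sym a))
        match (inj₂ (inj₁ z)) = inj₂ (inj₁ (trans z (≡-sym b)))
        match (inj₂ (inj₂ z)) = inj₂ (inj₂ (trans z (≡-sym c)))
        transported : S′.Beyond (_≢ e) ℓ p q s
        transported = subst (S′.Beyond (_≢ e) ℓ p q) c (subst (λ y → S′.Beyond (_≢ e) ℓ p y X₃) b
          (subst (λ x → S′.Beyond (_≢ e) ℓ x X₂ X₃) a (beyond′ match)))

      -- The reversed order is impossible, since v is near s but not near q.
      at-s-q : X₁ ≡ p → X₂ ≡ s → X₃ ≡ q → ⊥
      at-s-q a b c = clash v-q (close (off⇐ v≢p (p≢q ∘ ≡-sym) (join′ v≢e (e≢q ∘ ≡-sym) v≢q (≤-trans v-q′ (n≤1+n 2))))) ≤-refl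
        where
        match : ∀ {y} → pqs y → y ≡ X₁ ⊎ y ≡ X₂ ⊎ y ≡ X₃
        match (inj₁ z)        = inj₁ (trans z (≡-sym a))
        match (inj₂ (inj₁ z)) = inj₂ (inj₂ (trans z (≡-sym c)))
        match (inj₂ (inj₂ z)) = inj₂ (inj₁ (trans z (≡-sym b)))
        v≢s : v ≢ s
        v≢s = ≢-by D-v (d-refl s) λ ()
        along′ : d′ v X₂ ≡ suc (d′ v X₃)
        along′ = proj₁ (S′.Beyond.along (beyond′ match) v≢e v≢ℓ (λ z → v≢p (trans z a)) (λ z → v≢s (trans z b)))
        v-s′ : d′ v s ≤ 3
        v-s′ = close′ v≢e (λ z → <⇒≱ e-D (≤-trans (≤-reflexive (trans (cong (λ x → d x s) (≡-sym z)) (d-refl s))) z≤n))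
                 (join-H v≢p s≢p v≢s (bound D-v))
        v-q′ : d′ v q ≤ 2
        v-q′ = s≤s⁻¹ (≤-trans (≤-reflexive (trans (cong (suc ∘ d′ v) (≡-sym c)) (trans (≡-sym along′) (cong (d′ v) b)))) v-s′)

      reconstruct : Iso H G
      reconstruct with X₁ ≟F p
      ... | no X₁≢p with otherwise X₁≢p
      ... | inj₁ (b , bq , _ , f) = full (λ le → <⇒≱ e-q (≤-trans le (n≤1+n 2))) bq f
      ... | inj₂ small = by-⊇ λ y py → join (≢-H py)
              (flip≤ (q-ball (small y (λ z → ¬pe (subst (Adj H p) z py)) py)))
      reconstruct | yes a with near-ℓ X₂≢e X₂≢ℓ (≤-trans (M′.bound (M′.flip≡ c-x₂)) (n≤1+n 2))
                             | near-ℓ X₃≢e X₃≢ℓ (M′.flip≤ (M′.via (M′.bound c-x₂) (M′.bound x₂─x₃)))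
      ... | inj₁ z        | _             = ⊥-elim (X₁≢X₂ (trans a (≡-sym z)))
      ... | inj₂ _        | inj₁ z        = ⊥-elim (x₁≢x₃ (trans a (≡-sym z)))
      ... | inj₂ (inj₁ b) | inj₂ (inj₁ c) = ⊥-elim (X₂≢X₃ (trans b (≡-sym c)))
      ... | inj₂ (inj₂ b) | inj₂ (inj₂ c) = ⊥-elim (X₂≢X₃ (trans b (≡-sym c)))
      ... | inj₂ (inj₁ b) | inj₂ (inj₂ c) = at-q-s a b c
      ... | inj₂ (inj₂ b) | inj₂ (inj₁ c) = ⊥-elim (at-s-q a b c)

    reconstruct : Iso H G
    reconstruct with e-apart
    ... | inj₁ iso = iso
    ... | inj₂ ¬pe = Apart.reconstruct ¬pe

  reconstruct : Iso H G
  reconstruct with any? (λ b → (d q b ≟ 1) ×-dec (¬? (b ≟F p) ×-dec ¬? (b ≟F s)))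
  ... | yes (b , qb , b≢p , b≢s) = Branching.reconstruct qb b≢p b≢s
  ... | no none = Thin.reconstruct two
    where
    two : ∀ {b} → d q b ≡ 1 → b ≡ p ⊎ b ≡ s
    two {b} qb with b ≟F p | b ≟F s
    ... | yes z | _     = inj₁ z
    ... | no _  | yes z = inj₂ z
    ... | no np | no ns = ⊥-elim (none (b , qb , np , ns))

-- The tree around a simplicial vertex without twins

module ParentDeleted {N : ℕ} {G H : Graph N} (M : TreeMetric N) (isCube : IsCube G M)
  (far : ∀ c → Σ (Fin N) λ g → 3 < TreeMetric.d M c g)
  (H? : ∀ x y → Dec (Adj H x y)) (3<N : 3 < N)
  {ℓ : Fin N} (sim-ℓ : Simplicial G ℓ)
  (min-ℓ : ∀ x → Simplicial G x → Cube.CG.deg M isCube far ℓ ≤ Cube.CG.deg M isCube far x)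
  (no-twin : ∀ y → (∀ v → TreeMetric.d M v y ≤ 3 → TreeMetric.d M v ℓ ≤ 3) →
    (∀ v → TreeMetric.d M v ℓ ≤ 3 → TreeMetric.d M v y ≤ 3) → y ≡ ℓ)
  (agrees : AgreesOff G H (Metric.Pendant.x₁ (Cube.pendant M isCube far sim-ℓ)))
  {e : Fin N} (deep : ∀ y → TreeMetric.d M ℓ y ≤ TreeMetric.d M ℓ e)
  where

  open Metric M
  open Structure M
  private
    pend = Cube.pendant M isCube far sim-ℓ
    module Root where
      open Pendant pend public
      open NoTwin pend no-twin public
  open Root public using () renaming (x₁ to p; x₂ to q; c─x₁ to ℓ─p; x₁─x₂ to p─q)
  open Root public using (p-neighbours; beyond; ℓ-ball)
  open Hole M isCube far H? 3<N p agrees public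

  private V = Fin N

  ℓ≢p : ℓ ≢ p
  ℓ≢p = 1≢0 ℓ─p

  ℓ-q : d ℓ q ≡ 2
  ℓ-q = Root.c-x₂

  p-ball : ∀ {v} → d v p ≤ 3 → d v q ≤ 2
  p-ball = Root.to-x₂ _ tt

  q-ball : ∀ {v} → d v q ≤ 2 → d v p ≤ 3
  q-ball le = via le (bound (flip≡ p─q))

  beyond-ℓ : ∀ {v} → v ≢ ℓ → v ≢ p → d v ℓ ≡ suc (suc (d v q))
  beyond-ℓ v≢ℓ v≢p = trans (proj₂ (beyond v≢ℓ v≢p)) (cong suc (proj₁ (beyond v≢ℓ v≢p)))

  not-near : ∀ {v k} → k < d v q → 2 ≤ k → v ≢ ℓ × v ≢ p
  not-near lt 2≤k = (λ { refl → <⇒≱ lt (≤-trans (bound ℓ-q) 2≤k) })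
                  , (λ { refl → <⇒≱ lt (≤-trans (bound p─q) (≤-trans (s≤s z≤n) 2≤k)) })

  -- Away from `ℓ` and `p`, distance to `ℓ` is distance to `q` plus 2, so the maximality of `e`
  -- carries over to `q`.
  e-far : ∀ {g k} → k < d g q → 2 ≤ k → k < d e q
  e-far {g} {k} lt 2≤k = s≤s⁻¹ (s≤s⁻¹ (≤-trans
    (≤-trans (s≤s (s≤s lt)) (≤-reflexive (≡-sym (uncurry beyond-ℓ (not-near lt 2≤k)))))
    (≤-trans (≤-trans (flip≤ (deep g)) (bound (d-sym ℓ e))) e-ℓ)))
    where
    uncurry : ∀ {v} {A : Set} → (v ≢ ℓ → v ≢ p → A) → v ≢ ℓ × v ≢ p → A
    uncurry f (a , b) = f a b
    e-ℓ : d e ℓ ≤ suc (suc (d e q))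
    e-ℓ = ≤-trans (d-tri e q ℓ) (≤-trans (+-monoʳ-≤ (d e q) (bound (flip≡ ℓ-q))) (≤-reflexive (+-comm (d e q) 2)))

  e-q : 3 < d e q
  e-q = e-far (≤-trans (proj₂ (far q)) (≤-reflexive (d-sym _ _))) (s≤s (s≤s z≤n))

  e≢ℓ : e ≢ ℓ
  e≢ℓ = proj₁ (not-near e-q (s≤s (s≤s z≤n)))

  e≢p : e ≢ p
  e≢p = proj₂ (not-near e-q (s≤s (s≤s z≤n)))

  sim-e : Simplicial G e
  sim-e = metric-simplicial (deepest-simplicial deep (≤-trans (s≤s (s≤s z≤n))
    (≤-reflexive (≡-sym (flip≡ (beyond-ℓ e≢ℓ e≢p))))))

  record Path₂ : Set where
    field
      s t : V
      q─s : d q s ≡ 1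
      s─t : d s t ≡ 1
      q-t : d q t ≡ 2
      s-e : suc (d s e) ≡ d q e
      t-e : suc (d t e) ≡ d s e

  abstract
    path₂ : Path₂
    path₂ = go _ refl (≤-trans e-q (≤-reflexive (d-sym e q)))
      where
      go : ∀ k → d q e ≡ k → 3 < k → Path₂
      go zero _ ()
      go (suc zero) _ (s≤s ())
      go (suc (suc k)) qe _ with hop q e qe
      ... | s , qs , se with hop s e se
      ... | t , st , te = record { s = s ; t = t ; q─s = qs ; s─t = st ; s-e = trans (cong suc se) (≡-sym qe)
        ; t-e = trans (cong suc te) (≡-sym se) ; q-t = dist2 (flip≡ qs) st (≢-by qe te λ ()) }

  open Path₂ path₂ public

  t≢ℓ : t ≢ ℓ
  t≢ℓ z = m≢1+n+m (d t e) {3} (trans (cong (λ x → d x e) z) (trans (flip≡ (beyond-ℓ e≢ℓ e≢p)) (trans (cong (2 +_) (d-sym e q))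
    (trans (cong (2 +_) (≡-sym s-e)) (cong (3 +_) (≡-sym t-e))))))

  t≢p : t ≢ p
  t≢p = ≢-by (flip≡ q-t) p─q λ ()

  t-ℓ : d t ℓ ≡ 4
  t-ℓ = trans (beyond-ℓ t≢ℓ t≢p) (cong (2 +_) (flip≡ q-t))

  s≢p : s ≢ p
  s≢p z with p-neighbours (subst (λ x → d x t ≡ 1) z s─t)
  ... | inj₁ t≡ℓ = t≢ℓ t≡ℓ
  ... | inj₂ t≡q = 0≢1+n (trans (≡-sym (d-refl q)) (trans (cong (d q) (≡-sym t≡q)) q-t))

  not-simplicial-p : ¬ Simplicial G p
  not-simplicial-p sim = clash (flip≡ t-ℓ) (simplicial-metric sim (≤-trans (bound ℓ─p) (s≤s z≤n)) (q-ball (bound (flip≡ q-t)))) ≤-refl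

  not-simplicial-H-p : ¬ Simplicial H p
  not-simplicial-H-p sim = not-simplicial-p (simplicial-σ⁻¹ (subst (Simplicial H) (≡-sym σ-fix) sim))

  ℓp : Adj H ℓ p
  ℓp = locate sim-ℓ min-ℓ (join ℓ≢p (≤-trans (bound ℓ─p) (s≤s z≤n)))

  -- `σ` carries the simplicial vertices `e` and `ℓ` of `G` to two of `H`, at most one of which is
  -- `ℓ`.
  another-simplicial : Σ V λ u → u ≢ ℓ × Simplicial H u
  another-simplicial with (σ ⟨$⟩ʳ e) ≟F ℓ
  ... | no ne = σ ⟨$⟩ʳ e , ne , simplicial-σ sim-e
  ... | yes z = σ ⟨$⟩ʳ ℓ , (λ z′ → e≢ℓ (perm-inj σ (trans z (≡-sym z′)))) , simplicial-σ sim-ℓ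

  situation : Situation G H M
  situation = record
    { isCube = isCube ; far = far ; H? = H? ; ℓ = ℓ ; p = p ; q = q ; s = s ; t = t ; e = e
    ; ℓ─p = ℓ─p ; p─q = p─q ; q─s = q─s ; s─t = s─t ; q-t = q-t ; ℓ-q = ℓ-q ; t-ℓ = t-ℓ ; s≢p = s≢p
    ; e-q = e-q ; t-e = trans (cong suc t-e) s-e ; deep = deep ; beyond = beyond
    ; ℓ-ball = ℓ-ball ; p-ball = p-ball ; sim-ℓ = sim-ℓ ; sim-e = sim-e ; off⇒ = off⇒ ; off⇐ = off⇐
    ; not-simplicial-H-p = not-simplicial-H-p ; ℓp = ℓp ; by-⊆ = by-⊆ ; by-⊇ = by-⊇ ; card-metric = card-metric
    ; another = another-simplicial ; transfer = transfer ; transfer-≤ = transfer-≤ ; deg-p = deg-p ; exchange = exchange }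

-- Extremal choices and assembly

maximiser : ∀ {n} (f : Fin (suc n) → ℕ) → Σ (Fin (suc n)) λ i → ∀ j → f j ≤ f i
maximiser {zero} f = zero , λ { zero → ≤-refl }
maximiser {suc n} f with maximiser (f ∘ suc)
... | i , max with f zero ≤? f (suc i)
... | yes le = suc i , λ { zero → le ; (suc j) → max j }
... | no gt  = zero , λ { zero → ≤-refl ; (suc j) → ≤-trans (max j) (<⇒≤ (≰⇒> gt)) }

minimiser : ∀ {n} {P : Fin n → Set} (P? : ∀ i → Dec (P i)) (f : Fin n → ℕ) {i : Fin n} → P i →
  Σ (Fin n) λ i → P i × (∀ j → P j → f i ≤ f j)
minimiser P? f {i} Pi with least (λ k → any? λ i → P? i ×-dec (f i ≟ k)) (f i) (i , Pi , refl)
... | k , (i , Pi , refl) , min = i , Pi , λ j Pj → min (f j) (j , Pj , refl)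

far⇒3<n : ∀ {n} (M : TreeMetric n) {c g : Fin n} → 3 < TreeMetric.d M c g → 3 < n
far⇒3<n {n} M {c} {g} lt = go _ refl lt
  where
  open Metric M
  go : ∀ k → d c g ≡ k → 3 < k → 3 < n
  go zero _ ()
  go (suc zero) _ (s≤s ())
  go (suc (suc zero)) _ (s≤s (s≤s ()))
  go (suc (suc (suc k))) cg _ with hop c g cg
  ... | a , _ , ag with hop a g ag
  ... | b , _ , bg with hop b g bg
  -- The index plus the distance to `g` is constant along the path, so equal vertices have equal
  -- indices.
  ... | f , _ , fg = injective⇒≤ {f = vertex} λ {i} {j} e → toℕ-injective (+-cancelʳ-≡ (d (vertex j) g) _ _
      (trans (cong (λ x → toℕ i + d x g) (≡-sym e)) (trans (level i) (≡-sym (level j)))))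
    where
    vertex : Fin 4 → Fin n
    vertex zero = c
    vertex (suc zero) = a
    vertex (suc (suc zero)) = b
    vertex (suc (suc (suc zero))) = f
    level : ∀ i → toℕ i + d (vertex i) g ≡ suc (suc (suc k))
    level zero = cg
    level (suc zero) = cong suc ag
    level (suc (suc zero)) = cong (2 +_) bg
    level (suc (suc (suc zero))) = cong (3 +_) fg

reconstruct-far : ∀ {k} {G H : Graph (suc (suc (suc k)))} (M : TreeMetric (suc (suc (suc k)))) (isCube : IsCube G M) →
  (∀ c → Σ (Fin (suc (suc (suc k)))) λ g → 3 < TreeMetric.d M c g) → Deck G H → Iso H G
reconstruct-far {k} {G} {H} M isCube far 𝔻 = from-minimal (minimiser CG.simplicial? CG.deg sim-e)
  where
  open Cube M isCube far
  open Metric M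
  open Structure M
  3<N : 3 < suc (suc (suc k))
  3<N = far⇒3<n M (proj₂ (far zero))
  deepest : ∀ o → Σ (Fin (suc (suc (suc k)))) λ e → ∀ y → d o y ≤ d o e
  deepest o = maximiser (d o)
  -- A vertex farthest from an arbitrary root is simplicial, so the minimum below is taken over a
  -- nonempty set.
  sim-e : Simplicial G (proj₁ (deepest zero))
  sim-e = metric-simplicial (deepest-simplicial (proj₂ (deepest zero))
    (≤-trans (s≤s (s≤s z≤n)) (≤-trans (proj₂ (far zero)) (proj₂ (deepest zero) _))))
  from-minimal : (Σ (Fin (suc (suc (suc k)))) λ ℓ → Simplicial G ℓ × (∀ x → Simplicial G x → CG.deg ℓ ≤ CG.deg x)) → Iso H G
  from-minimal (ℓ , sim-ℓ , min) with any? (λ y → ¬? (y ≟F ℓ) ×-dec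
    (all? (λ v → (d v y ≤? 3) →-dec (d v ℓ ≤? 3)) ×-dec all? (λ v → (d v ℓ ≤? 3) →-dec (d v y ≤? 3))))
  ... | yes (y , y≢ℓ , y⊆ℓ , ℓ⊆y) with normalise 𝔻 y
  ... | H′ , agrees , iso = Iso-trans iso (Hole.twin M isCube far (deck-dec adj? (AgreesOff.deck agrees)) 3<N y agrees
          sim-ℓ min y≢ℓ y⊆ℓ ℓ⊆y)
  from-minimal (ℓ , sim-ℓ , min) | no none with normalise 𝔻 (Metric.Pendant.x₁ (pendant sim-ℓ))
  ... | H′ , agrees , iso = Iso-trans iso (Reconstruction.reconstruct (ParentDeleted.situation M isCube far
          (deck-dec adj? (AgreesOff.deck agrees)) 3<N sim-ℓ min
          (λ y y⊆ℓ ℓ⊆y → decidable-stable (y ≟F ℓ) λ y≢ℓ → none (y , y≢ℓ , y⊆ℓ , ℓ⊆y)) agrees (proj₂ (deepest ℓ))))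

reconstruct-cube : ∀ {k} {G H : Graph (suc (suc (suc k)))} (M : TreeMetric (suc (suc (suc k)))) → IsCube G M →
  Deck G H → Iso H G
reconstruct-cube {k} {G} {H} M isCube 𝔻 with any? (λ c → all? λ g → TreeMetric.d M c g ≤? 3)
... | no none = reconstruct-far M isCube far 𝔻
  where
  open TreeMetric M
  far : ∀ c → Σ (Fin (suc (suc (suc k)))) λ g → 3 < d c g
  far c with any? (λ g → 3 <? d c g)
  ... | yes g = g
  ... | no near = ⊥-elim (none (c , λ g → ≮⇒≥ λ lt → near (g , lt)))
-- Every vertex other than `c` is adjacent to `c` in `G`, so the inclusion of neighbourhoods is
-- immediate, and the equality of degrees does the rest.
... | yes (c , dominating) with normalise 𝔻 c
... | H′ , agrees , iso = Iso-trans iso (OffCard.by-⊇ {G = G} {H′} adj? H? off⇒ off⇐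
        (trans (deg-σ c) (cong (Counts.deg H′ H?) σ-fix))
        λ y cy → join (λ { refl → irrefl H′ cy }) (dominating y))
  where
  open IsCube isCube
  open AgreesOff agrees
  H? : ∀ x y → Dec (Adj H′ x y)
  H? = deck-dec adj? deck
  open DeckDegrees adj? H? deck (s≤s (s≤s (s≤s z≤n)))

theorem4p1 : ∀ {n : ℕ} (G : Graph (suc n)) → 2 ≤ n →
    (Σ ℕ λ k → Σ (Graph k) λ T → IsTree T × (G ≅ cube T)) →
    ∀ {m : ℕ} (H : Graph (suc m)) → SameDeck G H → H ≅ G
theorem4p1 {suc (suc j)} G _ (k , T , (connected , acyclic) , G≅T³) H same
  with same-deck {G = G} {H = H} same
... | 𝔻 with ↔⇒≡ (Deck.σ 𝔻)
... | refl = Iso⇒≅ (reconstruct-cube (pull-metric metric (Iso.π iso)) isCube 𝔻)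
  where
  open TreeDistance connected acyclic
  iso : Iso G (cube T)
  iso = ≅⇒Iso G≅T³
  isCube : IsCube G (pull-metric metric (Iso.π iso))
  isCube = record
    { close = λ a → distLE⇒ (proj₂ (Iso.to iso a))
    ; join  = λ x≢y le → Iso.of iso ((λ e → x≢y (perm-inj (Iso.π iso) e)) , distLE⇐ le) }
theorem4p1 {suc zero} G (s≤s ()) _ H _
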